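{- Let $n\ge 1$ and let $b=(b_1,\dots,b_n)$ be a sequence of positive integers. The set of quadratic straightening relations $$x_{\pi_1}x_{\pi_2}-x_{\eta_1}x_{\eta_2},$$ where $x_{\pi_1}x_{\pi_2}$ runs over the non-standard monomials of degree $2$ of $\mathcal{A}(b)$ and $\eta_1\oplus\eta_2$ is the canonical decomposition of $\pi_1+\pi_2$, is a Gröbner basis of the ideal $\mathcal{I}$ with respect to the monomial order $\succ$. In particular, $A(b)$ is Koszul.
   Context: For $b=(b_1,\dots,b_n)$ set $b_0=b_{n+1}:=1$ and $N_k:=\mathrm{lcm}(b_k,b_{k-1})$ for $k=1,\dots,n+1$. Let $e_1,\dots,e_{n+1}$ be the canonical basis of $\mathbb{R}^{n+1}$ and let $L(b)\subset\mathbb{R}^{n+1}$ be the lattice generated by $v_j:=\frac{e_j-e_{j+1}}{b_j}$ for $j=1,\dots,n$ and $v_{n+1}:=e_{n+1}$. The monoid of L-S paths with bonds $b$ is $\Pi(b):=L(b)\cap\mathbb{R}^{n+1}_{\ge 0}$. For $\pi=(a_1,\dots,a_{n+1})\in\Pi(b)$, $\operatorname{supp}\pi:=\{j : a_j\ne 0\}$ and $\deg(\pi):=a_1+\cdots+a_{n+1}$, a non-negative integer; $\Pi(b)_k$ is the set of L-S paths of degree $k$. The canonical decomposition of $\pi\in\Pi(b)_k$, written $\pi=\eta_1\oplus\cdots\oplus\eta_k$, is the unique decomposition $\pi=\eta_1+\cdots+\eta_k$ with all $\eta_i\in\Pi(b)_1$ and $\max\operatorname{supp}\eta_j\le\min\operatorname{supp}\eta_{j+1}$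 for $j=1,\dots,k-1$ (it always exists). Let $R:=\mathbb{C}[t_1^{1/N_1},\dots,t_{n+1}^{1/N_{n+1}}]$ be the polynomial algebra in the indeterminates $t_k^{1/N_k}$; for $\pi\in\Pi(b)$ one has $N_ka_k\in\mathbb{Z}_{\ge0}$ and $t^\pi:=t_1^{a_1}\cdots t_{n+1}^{a_{n+1}}\in R$. The semigroup algebra is $A(b):=\bigoplus_{\pi\in\Pi(b)}\mathbb{C}\,t^\pi\subseteq R$, graded by $\deg t^\pi=\deg\pi$. Let $\mathcal{A}(b):=\mathbb{C}[x_\pi\mid\pi\in\Pi(b)_1]$ be the polynomial ring, $\phi:\mathcal{A}(b)\to A(b)$ the algebra homomorphism $x_\pi\mapsto t^\pi$, and $\mathcal{I}:=\ker\phi$. A monomial written as $x_{\pi_1}\cdots x_{\pi_k}$ is in standard form if $\max\operatorname{supp}\pi_j\le\min\operatorname{supp}\pi_{j+1}$ for all $j=1,\dots,k-1$; a monomial is standard if its factors can be rearranged so that it is in standard form, and non-standard otherwise. Order on $\Pi(b)_1$: for $\pi=(a_1,\dots,a_{n+1})$ and $\eta=(c_1,\dots,c_{n+1})$, $\pi\succ\eta$ (and $x_\pi\succ x_\eta$) if and only if the leftmost non-zero entry of $(a_1-c_1,\dots,a_{n+1}-c_{n+1})$ is negative. The monomial order $\succ$ on $\mathcal{A}(b)$ is the associated graded reverse lexicographic order: if $\Pi(b)_1=\{\eta_1\succ\cdots\succ\eta_s\}$, then $x_{\eta_1}^{\alpha_1}\cdots x_{\eta_s}^{\alpha_s}\succ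 x_{\eta_1}^{\beta_1}\cdots x_{\eta_s}^{\beta_s}$ if and only if the first has larger degree, or the degrees are equal and the rightmost non-zero entry of $(\alpha_1-\beta_1,\dots,\alpha_s-\beta_s)$ is negative. A standard graded $\mathbb{C}$-algebra $A$ is Koszul if its residue field $\mathbb{C}=A/A_{>0}$ has a linear graded free resolution over $A$. -}

module Defs where

open import Algebra.Apartness.Bundles using (HeytingField; HeytingCommutativeRing)
open import Algebra.Bundles using (CommutativeMonoid; CommutativeRing)
open import Algebra.Module.Bundles.Raw using (RawLeftModule)
open import Algebra.Module.Morphism.Structures using (module LeftModuleMorphisms)
open import Algebra.Morphism.Structures using (module MonoidMorphisms; module RingMorphisms)
import Algebra.Properties.CommutativeMonoid.Sum as Sum
import Algebra.Properties.Semiring.Sum as SemiringSum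
open import Data.Bool.Base using (true; false; if_then_else_)
open import Data.Empty using (⊥-elim)
open import Data.Fin.Base as Fin using (Fin; zero; suc; toℕ; inject₁; fromℕ)
import Data.Fin.Properties as Fin
open import Data.Integer.Base as ℤ using (ℤ; +_)
import Data.Integer.Properties as ℤ
open import Data.List.Base using (List; []; _∷_; _++_; map; length; foldr; filter)
import Data.List.Membership.Setoid as Membership
import Data.List.Membership.Setoid.Properties as MembershipProperties
import Data.List.Relation.Binary.Permutation.Setoid as Permutation
import Data.List.Relation.Binary.Permutation.Setoid.Properties as PermutationProperties
open import Data.List.Relation.Binary.Pointwise.Base using ([]; _∷_)
open import Data.List.Relation.Unary.All using (All; []; _∷_)
open import Data.List.Relation.Unary.Any using (any?; here)
open import Data.List.Relation.Unary.Linked using (Linked)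
open import Data.Nat.Base as ℕ using (ℕ; zero; suc; z≤n; s≤s; NonZero)
import Data.Nat.Properties as ℕ
open import Data.Product.Base using (_×_; _,_; proj₁; proj₂; Σ-syntax; ∃-syntax)
import Data.Rational.Base as Rational
import Data.Rational.Properties as ℚ
open import Data.Rational.Unnormalised.Base using (mkℚᵘ; *≡*; *≤*)
import Data.Rational.Unnormalised.Properties as ℚᵘ
open import Data.Sum.Base using (_⊎_)
open import Data.Vec.Functional using (Vector)
open import Data.Vec.Functional.Relation.Binary.Pointwise using (Pointwise)
import Data.Vec.Functional.Relation.Binary.Pointwise.Properties as PointwiseProperties
open import Function.Bundles using (_⇔_)
open import Function.Definitions using (Injective; Surjective)
open import Level using (Level; _⊔_; 0ℓ) renaming (suc to lsuc)
open import Relation.Binary.Bundles using (DecSetoid)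
import Relation.Binary.Construct.On as On
open import Relation.Binary.Core using (Rel)
open import Relation.Binary.Definitions using (Decidable; _Respects_)
open import Relation.Binary.PropositionalEquality.Core as ≡ using (_≡_; _≢_)
open import Relation.Binary.PropositionalEquality.Properties using (module ≡-Reasoning)
open import Relation.Nullary.Decidable.Core using (Dec; does; yes; no)
open import Relation.Nullary.Negation.Core using (¬_)
open import Relation.Unary using (Pred; _∈_; _⊆_; _≐_)

module MonoidAlgebra {c ℓ m ℓm : Level} (K : CommutativeRing c ℓ) (M : CommutativeMonoid m ℓm)
                     (_≟_ : Decidable (CommutativeMonoid._≈_ M)) where

  private
    module K = CommutativeRing K
    module M = CommutativeMonoid M
  open K using (_≈_; _+_; _*_; -_; 0#; 1#)
  open M using (_∙_; ε) renaming (_≈_ to _≈ᴹ_)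
  open import Algebra.Properties.Ring K.ring using (-0#≈0#; -‿+-comm; -‿distribˡ-*)
  open import Algebra.Properties.Group K.+-group using () renaming (x∙y⁻¹≈ε⇒x≈y to x-y≈0⇒x≈y)
  open import Algebra.Properties.CommutativeSemigroup K.+-commutativeSemigroup using (interchange; x∙yz≈y∙xz)
  open import Algebra.Properties.CommutativeSemigroup K.*-commutativeSemigroup using () renaming (x∙yz≈y∙xz to x*yz≈y*xz)
  open import Relation.Binary.Reasoning.Setoid K.setoid

  -- A list of terms (cᵢ , pᵢ) stands for the formal sum Σ cᵢ pᵢ; repeated
  -- monomials and zero coefficients are allowed.
  Carrier : Set (c ⊔ m)
  Carrier = List (K.Carrier × M.Carrier)

  coeff : M.Carrier → Carrier → K.Carrier
  coeff p []            = 0#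
  coeff p ((c , q) ∷ f) = (if does (p ≟ q) then c else 0#) + coeff p f

  infix 4 _≋_
  record _≋_ (f g : Carrier) : Set (m ⊔ ℓ) where
    constructor coeffwise
    field coeff-≈ : ∀ p → coeff p f ≈ coeff p g
  open _≋_ public

  scale : K.Carrier → M.Carrier → Carrier → Carrier
  scale c p = map (λ (d , q) → (c * d , p ∙ q))

  infixl 7 _*ᴬ_
  _*ᴬ_ : Carrier → Carrier → Carrier
  []            *ᴬ g = []
  ((c , p) ∷ f) *ᴬ g = scale c p g ++ f *ᴬ g

  -ᴬ_ : Carrier → Carrier
  -ᴬ_ = map (λ (c , p) → (- c , p))

  monomial : M.Carrier → Carrier
  monomial p = (1# , p) ∷ []

  scalar : K.Carrier → Carrier
  scalar c = (c , ε) ∷ []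

  -- Linear extension of h : M → K to K[M], used below to verify the ring laws.
  ∫ : (M.Carrier → K.Carrier) → Carrier → K.Carrier
  ∫ h []            = 0#
  ∫ h ((c , p) ∷ f) = c * h p + ∫ h f

  δ : M.Carrier → M.Carrier → K.Carrier
  δ p q = if does (p ≟ q) then 1# else 0#

  δ-cong : ∀ p {q r} → q ≈ᴹ r → δ p q ≈ δ p r
  δ-cong p {q} {r} q≈r with p ≟ q | p ≟ r
  ... | yes _   | yes _   = K.refl
  ... | no _    | no _    = K.refl
  ... | yes p≈q | no p≉r  = ⊥-elim (p≉r (M.trans p≈q q≈r))
  ... | no p≉q  | yes p≈r = ⊥-elim (p≉q (M.trans p≈r (M.sym q≈r)))

  coeff-∫ : ∀ p f → coeff p f ≈ ∫ (δ p) f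
  coeff-∫ p []            = K.refl
  coeff-∫ p ((c , q) ∷ f) with does (p ≟ q)
  ... | true  = K.+-cong (K.sym (K.*-identityʳ c)) (coeff-∫ p f)
  ... | false = K.+-cong (K.sym (K.zeroʳ c)) (coeff-∫ p f)

  ∫-cong : ∀ {h k} → (∀ p → h p ≈ k p) → ∀ f → ∫ h f ≈ ∫ k f
  ∫-cong h≈k []            = K.refl
  ∫-cong h≈k ((c , p) ∷ f) = K.+-cong (K.*-congˡ (h≈k p)) (∫-cong h≈k f)

  ∫-++ : ∀ h f g → ∫ h (f ++ g) ≈ ∫ h f + ∫ h g
  ∫-++ h []            g = K.sym (K.+-identityˡ _)
  ∫-++ h ((c , p) ∷ f) g = K.trans (K.+-congˡ (∫-++ h f g)) (K.sym (K.+-assoc _ _ _))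

  ∫-neg : ∀ h f → ∫ h (-ᴬ f) ≈ - ∫ h f
  ∫-neg h []            = K.sym -0#≈0#
  ∫-neg h ((c , p) ∷ f) = K.trans (K.+-cong (K.sym (-‿distribˡ-* c (h p))) (∫-neg h f)) (-‿+-comm _ _)

  ∫-scale : ∀ h c p g → ∫ h (scale c p g) ≈ c * ∫ (λ q → h (p ∙ q)) g
  ∫-scale h c p []            = K.sym (K.zeroʳ c)
  ∫-scale h c p ((d , q) ∷ g) = K.trans (K.+-cong (K.*-assoc c d _) (∫-scale h c p g)) (K.sym (K.distribˡ c _ _))

  ∫-* : ∀ h f g → ∫ h (f *ᴬ g) ≈ ∫ (λ p → ∫ (λ q → h (p ∙ q)) g) f
  ∫-* h []            g = K.refl
  ∫-* h ((c , p) ∷ f) g = K.trans (∫-++ h (scale c p g) (f *ᴬ g)) (K.+-cong (∫-scale h c p g) (∫-* h f g))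

  ∫-zero : ∀ f → ∫ (λ _ → 0#) f ≈ 0#
  ∫-zero []            = K.refl
  ∫-zero ((c , p) ∷ f) = K.trans (K.+-cong (K.zeroʳ c) (∫-zero f)) (K.+-identityˡ _)

  ∫-+ : ∀ h k f → ∫ (λ p → h p + k p) f ≈ ∫ h f + ∫ k f
  ∫-+ h k []            = K.sym (K.+-identityˡ _)
  ∫-+ h k ((c , p) ∷ f) = K.trans (K.+-cong (K.distribˡ c _ _) (∫-+ h k f)) (interchange _ _ _ _)

  ∫-*ˡ : ∀ d h f → ∫ (λ p → d * h p) f ≈ d * ∫ h f
  ∫-*ˡ d h []            = K.sym (K.zeroʳ d)
  ∫-*ˡ d h ((c , p) ∷ f) = K.trans (K.+-cong (x*yz≈y*xz c d _) (∫-*ˡ d h f)) (K.sym (K.distribˡ d _ _))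

  ∫-swap : ∀ (H : M.Carrier → M.Carrier → K.Carrier) f g →
           ∫ (λ p → ∫ (H p) g) f ≈ ∫ (λ q → ∫ (λ p → H p q) f) g
  ∫-swap H []            g = K.sym (∫-zero g)
  ∫-swap H ((c , p) ∷ f) g = begin
    c * ∫ (H p) g + ∫ (λ p → ∫ (H p) g) f                 ≈⟨ K.+-cong (K.sym (∫-*ˡ c (H p) g)) (∫-swap H f g) ⟩
    ∫ (λ q → c * H p q) g + ∫ (λ q → ∫ (λ p → H p q) f) g ≈⟨ K.sym (∫-+ _ _ g) ⟩
    ∫ (λ q → ∫ (λ p → H p q) ((c , p) ∷ f)) g             ∎

  private
    without : M.Carrier → Carrier → Carrier
    without q []            = []
    without q ((d , r) ∷ f) = if does (q ≟ r) then without q f else (d , r) ∷ without q f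

    length-without : ∀ q f → length (without q f) ℕ.≤ length f
    length-without q []            = z≤n
    length-without q ((d , r) ∷ f) with does (q ≟ r)
    ... | true  = ℕ.m≤n⇒m≤1+n (length-without q f)
    ... | false = s≤s (length-without q f)

    length-without-head : ∀ c q f → length (without q ((c , q) ∷ f)) ℕ.≤ length f
    length-without-head c q f with q ≟ q
    ... | yes _  = length-without q f
    ... | no q≉q = ⊥-elim (q≉q M.refl)

    ∫-without : ∀ {h} → (∀ {p q} → p ≈ᴹ q → h p ≈ h q) → ∀ q f →
                ∫ h f ≈ coeff q f * h q + ∫ h (without q f)
    ∫-without h-cong q []            = K.sym (K.trans (K.+-identityʳ _) (K.zeroˡ _))
    ∫-without {h} h-cong q ((d , r) ∷ f) with q ≟ r
    ... | yes q≈r = begin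
      d * h r + ∫ h f                                      ≈⟨ K.+-cong (K.*-congˡ (h-cong (M.sym q≈r))) (∫-without h-cong q f) ⟩
      d * h q + (coeff q f * h q + ∫ h (without q f))      ≈⟨ K.sym (K.+-assoc _ _ _) ⟩
      (d * h q + coeff q f * h q) + ∫ h (without q f)      ≈⟨ K.+-congʳ (K.sym (K.distribʳ _ _ _)) ⟩
      (d + coeff q f) * h q + ∫ h (without q f)            ∎
    ... | no _ = begin
      d * h r + ∫ h f                                        ≈⟨ K.+-congˡ (∫-without h-cong q f) ⟩
      d * h r + (coeff q f * h q + ∫ h (without q f))        ≈⟨ x∙yz≈y∙xz _ _ _ ⟩
      coeff q f * h q + (d * h r + ∫ h (without q f))        ≈⟨ K.+-congʳ (K.*-congʳ (K.sym (K.+-identityˡ _))) ⟩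
      (0# + coeff q f) * h q + (d * h r + ∫ h (without q f)) ∎

    coeff-without : ∀ q f → (∀ p → coeff p f ≈ 0#) → ∀ p → coeff p (without q f) ≈ 0#
    coeff-without q f f≈0 p with q ≟ p
    ... | yes q≈p = gone f
      where
      gone : ∀ f → coeff p (without q f) ≈ 0#
      gone []            = K.refl
      gone ((d , r) ∷ f) with q ≟ r
      ... | yes _ = gone f
      ... | no q≉r with p ≟ r
      ... | yes p≈r = ⊥-elim (q≉r (M.trans q≈p p≈r))
      ... | no _    = K.trans (K.+-identityˡ _) (gone f)
    ... | no q≉p = K.trans (kept f) (f≈0 p)
      where
      kept : ∀ f → coeff p (without q f) ≈ coeff p f
      kept []            = K.refl
      kept ((d , r) ∷ f) with q ≟ r
      ... | no _ = K.+-congˡ (kept f)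
      ... | yes q≈r with p ≟ r
      ... | yes p≈r = ⊥-elim (q≉p (M.trans q≈r (M.sym p≈r)))
      ... | no _    = K.trans (kept f) (K.sym (K.+-identityˡ _))

    ∫-null : ∀ {h} → (∀ {p q} → p ≈ᴹ q → h p ≈ h q) → ∀ n f → length f ℕ.≤ n →
             (∀ p → coeff p f ≈ 0#) → ∫ h f ≈ 0#
    ∫-null h-cong n       []            _         _   = K.refl
    ∫-null {h} h-cong (suc n) f′@((c , q) ∷ f) (s≤s len) f≈0 = begin
      ∫ h f′                                  ≈⟨ ∫-without h-cong q f′ ⟩
      coeff q f′ * h q + ∫ h (without q f′)   ≈⟨ K.+-cong (K.trans (K.*-congʳ (f≈0 q)) (K.zeroˡ _))
                                                   (∫-null h-cong n (without q f′) (ℕ.≤-trans (length-without-head c q f) len)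
                                                     (coeff-without q f′ f≈0)) ⟩
      0# + 0#                                 ≈⟨ K.+-identityˡ _ ⟩
      0#                                      ∎

  coeff-++ : ∀ p f g → coeff p (f ++ g) ≈ coeff p f + coeff p g
  coeff-++ p []            g = K.sym (K.+-identityˡ _)
  coeff-++ p ((c , q) ∷ f) g = K.trans (K.+-congˡ (coeff-++ p f g)) (K.sym (K.+-assoc _ _ _))

  coeff-neg : ∀ p f → coeff p (-ᴬ f) ≈ - coeff p f
  coeff-neg p f = K.trans (coeff-∫ p (-ᴬ f)) (K.trans (∫-neg (δ p) f) (K.-‿cong (K.sym (coeff-∫ p f))))

  ∫-resp : ∀ {h} → (∀ {p q} → p ≈ᴹ q → h p ≈ h q) → ∀ {f g} → f ≋ g → ∫ h f ≈ ∫ h g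
  ∫-resp {h} h-cong {f} {g} f≋g = x-y≈0⇒x≈y _ _ (begin
    ∫ h f + - ∫ h g       ≈⟨ K.+-congˡ (K.sym (∫-neg h g)) ⟩
    ∫ h f + ∫ h (-ᴬ g)    ≈⟨ K.sym (∫-++ h f (-ᴬ g)) ⟩
    ∫ h (f ++ -ᴬ g)       ≈⟨ ∫-null h-cong _ (f ++ -ᴬ g) ℕ.≤-refl (λ p → begin
        coeff p (f ++ -ᴬ g)          ≈⟨ coeff-++ p f (-ᴬ g) ⟩
        coeff p f + coeff p (-ᴬ g)   ≈⟨ K.+-cong (coeff-≈ f≋g p) (coeff-neg p g) ⟩
        coeff p g + - coeff p g      ≈⟨ K.-‿inverseʳ _ ⟩
        0#                           ∎) ⟩
    0#                    ∎)

  private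
    ∫⇒≋ : ∀ {f g} → (∀ h → (∀ {p q} → p ≈ᴹ q → h p ≈ h q) → ∫ h f ≈ ∫ h g) → f ≋ g
    ∫⇒≋ {f} {g} eq = coeffwise λ p →
      K.trans (coeff-∫ p f) (K.trans (eq (δ p) (δ-cong p)) (K.sym (coeff-∫ p g)))

  ≋-refl : ∀ {f} → f ≋ f
  ≋-refl = coeffwise λ p → K.refl

  ≋-sym : ∀ {f g} → f ≋ g → g ≋ f
  ≋-sym e = coeffwise λ p → K.sym (coeff-≈ e p)

  ≋-trans : ∀ {f g h} → f ≋ g → g ≋ h → f ≋ h
  ≋-trans d e = coeffwise λ p → K.trans (coeff-≈ d p) (coeff-≈ e p)

  term-cong : ∀ c {p q} → p ≈ᴹ q → (c , p) ∷ [] ≋ (c , q) ∷ []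
  term-cong c p≈q = ∫⇒≋ λ h h-cong → K.+-congʳ (K.*-congˡ (h-cong p≈q))

  private
    +-cong : ∀ {f f′ g g′} → f ≋ f′ → g ≋ g′ → f ++ g ≋ f′ ++ g′
    +-cong {f} {f′} {g} {g′} d e = coeffwise λ p →
      K.trans (coeff-++ p f g) (K.trans (K.+-cong (coeff-≈ d p) (coeff-≈ e p)) (K.sym (coeff-++ p f′ g′)))

    +-assoc : ∀ f g h → (f ++ g) ++ h ≋ f ++ (g ++ h)
    +-assoc f g h = ∫⇒≋ λ k _ → begin
      ∫ k ((f ++ g) ++ h)          ≈⟨ K.trans (∫-++ k (f ++ g) h) (K.+-congʳ (∫-++ k f g)) ⟩
      ∫ k f + ∫ k g + ∫ k h        ≈⟨ K.+-assoc _ _ _ ⟩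
      ∫ k f + (∫ k g + ∫ k h)      ≈⟨ K.sym (K.trans (∫-++ k f (g ++ h)) (K.+-congˡ (∫-++ k g h))) ⟩
      ∫ k (f ++ (g ++ h))          ∎

    +-comm : ∀ f g → f ++ g ≋ g ++ f
    +-comm f g = coeffwise λ p →
      K.trans (coeff-++ p f g) (K.trans (K.+-comm _ _) (K.sym (coeff-++ p g f)))

    +-identityʳ : ∀ f → f ++ [] ≋ f
    +-identityʳ f = coeffwise λ p → K.trans (coeff-++ p f []) (K.+-identityʳ _)

    -‿cong : ∀ {f g} → f ≋ g → -ᴬ f ≋ -ᴬ g
    -‿cong {f} {g} e = coeffwise λ p →
      K.trans (coeff-neg p f) (K.trans (K.-‿cong (coeff-≈ e p)) (K.sym (coeff-neg p g)))

    -‿inverseʳ : ∀ f → f ++ (-ᴬ f) ≋ []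
    -‿inverseʳ f = coeffwise λ p →
      K.trans (coeff-++ p f (-ᴬ f)) (K.trans (K.+-congˡ (coeff-neg p f)) (K.-‿inverseʳ _))

    *-cong : ∀ {f f′ g g′} → f ≋ f′ → g ≋ g′ → f *ᴬ g ≋ f′ *ᴬ g′
    *-cong {f} {f′} {g} {g′} d e = ∫⇒≋ λ k k-cong → begin
      ∫ k (f *ᴬ g)                              ≈⟨ ∫-* k f g ⟩
      ∫ (λ p → ∫ (λ q → k (p ∙ q)) g) f         ≈⟨ ∫-cong (λ p → ∫-resp (λ q≈r → k-cong (M.∙-congˡ q≈r)) e) f ⟩
      ∫ (λ p → ∫ (λ q → k (p ∙ q)) g′) f        ≈⟨ ∫-resp (λ p≈r → ∫-cong (λ q → k-cong (M.∙-congʳ p≈r)) g′) d ⟩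
      ∫ (λ p → ∫ (λ q → k (p ∙ q)) g′) f′       ≈⟨ K.sym (∫-* k f′ g′) ⟩
      ∫ k (f′ *ᴬ g′)                            ∎

    *-assoc : ∀ f g h → (f *ᴬ g) *ᴬ h ≋ f *ᴬ (g *ᴬ h)
    *-assoc f g h = ∫⇒≋ λ k k-cong → begin
      ∫ k ((f *ᴬ g) *ᴬ h)                                      ≈⟨ ∫-* k (f *ᴬ g) h ⟩
      ∫ (λ s → ∫ (λ r → k (s ∙ r)) h) (f *ᴬ g)                 ≈⟨ ∫-* _ f g ⟩
      ∫ (λ p → ∫ (λ q → ∫ (λ r → k ((p ∙ q) ∙ r)) h) g) f      ≈⟨ ∫-cong (λ p → ∫-cong (λ q → ∫-cong (λ r → k-cong (M.assoc p q r)) h) g) f ⟩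
      ∫ (λ p → ∫ (λ q → ∫ (λ r → k (p ∙ (q ∙ r))) h) g) f      ≈⟨ ∫-cong (λ p → K.sym (∫-* (λ s → k (p ∙ s)) g h)) f ⟩
      ∫ (λ p → ∫ (λ s → k (p ∙ s)) (g *ᴬ h)) f                 ≈⟨ K.sym (∫-* k f (g *ᴬ h)) ⟩
      ∫ k (f *ᴬ (g *ᴬ h))                                      ∎

    *-comm : ∀ f g → f *ᴬ g ≋ g *ᴬ f
    *-comm f g = ∫⇒≋ λ k k-cong → begin
      ∫ k (f *ᴬ g)                          ≈⟨ ∫-* k f g ⟩
      ∫ (λ p → ∫ (λ q → k (p ∙ q)) g) f     ≈⟨ ∫-swap (λ p q → k (p ∙ q)) f g ⟩
      ∫ (λ q → ∫ (λ p → k (p ∙ q)) f) g     ≈⟨ ∫-cong (λ q → ∫-cong (λ p → k-cong (M.comm p q)) f) g ⟩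
      ∫ (λ q → ∫ (λ p → k (q ∙ p)) f) g     ≈⟨ K.sym (∫-* k g f) ⟩
      ∫ k (g *ᴬ f)                          ∎

    *-identityˡ : ∀ f → monomial ε *ᴬ f ≋ f
    *-identityˡ f = ∫⇒≋ λ k k-cong → begin
      ∫ k (monomial ε *ᴬ f)               ≈⟨ ∫-* k (monomial ε) f ⟩
      1# * ∫ (λ q → k (ε ∙ q)) f + 0#     ≈⟨ K.trans (K.+-identityʳ _) (K.*-identityˡ _) ⟩
      ∫ (λ q → k (ε ∙ q)) f               ≈⟨ ∫-cong (λ q → k-cong (M.identityˡ q)) f ⟩
      ∫ k f                               ∎

    distribʳ : ∀ f g h → (g ++ h) *ᴬ f ≋ g *ᴬ f ++ h *ᴬ f
    distribʳ f g h = ∫⇒≋ λ k _ → begin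
      ∫ k ((g ++ h) *ᴬ f)                    ≈⟨ ∫-* k (g ++ h) f ⟩
      ∫ _ (g ++ h)                           ≈⟨ ∫-++ _ g h ⟩
      ∫ _ g + ∫ _ h                          ≈⟨ K.sym (K.+-cong (∫-* k g f) (∫-* k h f)) ⟩
      ∫ k (g *ᴬ f) + ∫ k (h *ᴬ f)            ≈⟨ K.sym (∫-++ k (g *ᴬ f) (h *ᴬ f)) ⟩
      ∫ k (g *ᴬ f ++ h *ᴬ f)                 ∎

  commutativeRing : CommutativeRing (c ⊔ m) (m ⊔ ℓ)
  commutativeRing = record
    { Carrier = Carrier ; _≈_ = _≋_ ; _+_ = _++_ ; _*_ = _*ᴬ_ ; -_ = -ᴬ_ ; 0# = [] ; 1# = monomial ε
    ; isCommutativeRing = record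
      { isRing = record
        { +-isAbelianGroup = record
          { isGroup = record
            { isMonoid = record
              { isSemigroup = record
                { isMagma = record
                  { isEquivalence = record { refl = ≋-refl ; sym = ≋-sym ; trans = ≋-trans }
                  ; ∙-cong = +-cong
                  }
                ; assoc = +-assoc
                }
              ; identity = (λ f → ≋-refl) , +-identityʳ
              }
            ; inverse = (λ f → ≋-trans (+-comm (-ᴬ f) f) (-‿inverseʳ f)) , -‿inverseʳ
            ; ⁻¹-cong = -‿cong
            }
          ; comm = +-comm
          }
        ; *-cong = *-cong
        ; *-assoc = *-assoc
        ; *-identity = *-identityˡ , (λ f → ≋-trans (*-comm f (monomial ε)) (*-identityˡ f))
        ; distrib = (λ f g h → ≋-trans (*-comm f (g ++ h))
                       (≋-trans (distribʳ f g h) (+-cong (*-comm g f) (*-comm h f))))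
                  , distribʳ
        }
      ; *-comm = *-comm
      }
    }

module MonoidAlgebraMap {c ℓ m ℓm n ℓn : Level} (K : CommutativeRing c ℓ)
  (M : CommutativeMonoid m ℓm) (_≟ᴹ_ : Decidable (CommutativeMonoid._≈_ M))
  (N : CommutativeMonoid n ℓn) (_≟ᴺ_ : Decidable (CommutativeMonoid._≈_ N))
  (h : CommutativeMonoid.Carrier M → CommutativeMonoid.Carrier N)
  (h-isMonoidHomomorphism : MonoidMorphisms.IsMonoidHomomorphism
    (CommutativeMonoid.rawMonoid M) (CommutativeMonoid.rawMonoid N) h)
  where

  private
    module K = CommutativeRing K
    module M = CommutativeMonoid M
    module N = CommutativeMonoid N
    module K[M] = MonoidAlgebra K M _≟ᴹ_
    module K[N] = MonoidAlgebra K N _≟ᴺ_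
  private module h = MonoidMorphisms.IsMonoidHomomorphism h-isMonoidHomomorphism
  open RingMorphisms (CommutativeRing.rawRing K[M].commutativeRing) (CommutativeRing.rawRing K[N].commutativeRing)
  open import Relation.Binary.Reasoning.Setoid K.setoid

  -- Σ cᵢ pᵢ ↦ Σ cᵢ h(pᵢ)
  ⟦_⟧ : K[M].Carrier → K[N].Carrier
  ⟦_⟧ = map (λ (c , p) → (c , h p))

  private
    ∫-⟦⟧ : ∀ k f → K[N].∫ k ⟦ f ⟧ K.≈ K[M].∫ (λ p → k (h p)) f
    ∫-⟦⟧ k []            = K.refl
    ∫-⟦⟧ k ((c , p) ∷ f) = K.+-congˡ (∫-⟦⟧ k f)

    ⟦⟧-++ : ∀ f g → ⟦ f ++ g ⟧ K[N].≋ ⟦ f ⟧ ++ ⟦ g ⟧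
    ⟦⟧-++ []            g = K[N].≋-refl
    ⟦⟧-++ (x ∷ f) g = K[N].coeffwise λ p → K.+-congˡ (K[N].coeff-≈ (⟦⟧-++ f g) p)

    ⟦⟧-neg : ∀ f → ⟦ K[M].-ᴬ f ⟧ K[N].≋ K[N].-ᴬ ⟦ f ⟧
    ⟦⟧-neg []            = K[N].≋-refl
    ⟦⟧-neg (x ∷ f) = K[N].coeffwise λ p → K.+-congˡ (K[N].coeff-≈ (⟦⟧-neg f) p)

    ⟦⟧-cong : ∀ {f g} → f K[M].≋ g → ⟦ f ⟧ K[N].≋ ⟦ g ⟧
    ⟦⟧-cong {f} {g} f≋g = K[N].coeffwise λ q → begin
      K[N].coeff q ⟦ f ⟧                 ≈⟨ K.trans (K[N].coeff-∫ q ⟦ f ⟧) (∫-⟦⟧ _ f) ⟩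
      K[M].∫ (λ p → K[N].δ q (h p)) f    ≈⟨ K[M].∫-resp (λ p≈r → K[N].δ-cong q (h.⟦⟧-cong p≈r)) f≋g ⟩
      K[M].∫ (λ p → K[N].δ q (h p)) g    ≈⟨ K.sym (K.trans (K[N].coeff-∫ q ⟦ g ⟧) (∫-⟦⟧ _ g)) ⟩
      K[N].coeff q ⟦ g ⟧                 ∎

    ⟦⟧-* : ∀ f g → ⟦ f K[M].*ᴬ g ⟧ K[N].≋ ⟦ f ⟧ K[N].*ᴬ ⟦ g ⟧
    ⟦⟧-* f g = K[N].coeffwise λ r → begin
      K[N].coeff r ⟦ f K[M].*ᴬ g ⟧
        ≈⟨ K.trans (K[N].coeff-∫ r ⟦ f K[M].*ᴬ g ⟧) (K.trans (∫-⟦⟧ _ (f K[M].*ᴬ g)) (K[M].∫-* _ f g)) ⟩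
      K[M].∫ (λ p → K[M].∫ (λ q → K[N].δ r (h (p M.∙ q))) g) f
        ≈⟨ K[M].∫-cong (λ p → K[M].∫-cong (λ q → K[N].δ-cong r (h.homo p q)) g) f ⟩
      K[M].∫ (λ p → K[M].∫ (λ q → K[N].δ r (h p N.∙ h q)) g) f
        ≈⟨ K[M].∫-cong (λ p → K.sym (∫-⟦⟧ (λ q → K[N].δ r (h p N.∙ q)) g)) f ⟩
      K[M].∫ (λ p → K[N].∫ (λ q → K[N].δ r (h p N.∙ q)) ⟦ g ⟧) f
        ≈⟨ K.sym (∫-⟦⟧ _ f) ⟩
      K[N].∫ (λ p → K[N].∫ (λ q → K[N].δ r (p N.∙ q)) ⟦ g ⟧) ⟦ f ⟧
        ≈⟨ K.sym (K.trans (K[N].coeff-∫ r (⟦ f ⟧ K[N].*ᴬ ⟦ g ⟧)) (K[N].∫-* _ ⟦ f ⟧ ⟦ g ⟧)) ⟩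
      K[N].coeff r (⟦ f ⟧ K[N].*ᴬ ⟦ g ⟧) ∎

  isRingHomomorphism : IsRingHomomorphism ⟦_⟧
  isRingHomomorphism = record
    { isSemiringHomomorphism = record
      { isNearSemiringHomomorphism = record
        { +-isMonoidHomomorphism = record
          { isMagmaHomomorphism = record
            { isRelHomomorphism = record { cong = ⟦⟧-cong }
            ; homo = ⟦⟧-++
            }
          ; ε-homo = K[N].≋-refl
          }
        ; *-homo = ⟦⟧-*
        }
      ; 1#-homo = K[N].term-cong K.1# h.ε-homo
      }
    ; -‿homo = ⟦⟧-neg
    }

record GradedAlgebra {c ℓ : Level} (K : CommutativeRing c ℓ) (a r p : Level) : Set (c ⊔ ℓ ⊔ lsuc (a ⊔ r ⊔ p)) where
  field
    commutativeRing : CommutativeRing a r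
  open CommutativeRing commutativeRing public

  FiniteSumOf : ∀ {q} → Pred Carrier q → Pred Carrier (a ⊔ r ⊔ q)
  FiniteSumOf P x = ∃[ xs ] All P xs × x ≈ foldr _+_ 0# xs

  field
    algebraMap                    : CommutativeRing.Carrier K → Carrier
    algebraMap-isRingHomomorphism : RingMorphisms.IsRingHomomorphism (CommutativeRing.rawRing K) rawRing algebraMap
    Homogeneous                   : ℕ → Pred Carrier p
    Homogeneous-resp              : ∀ {d} → Homogeneous d Respects _≈_
    0#-homogeneous                : ∀ {d} → Homogeneous d 0#
    +-homogeneous                 : ∀ {d x y} → Homogeneous d x → Homogeneous d y → Homogeneous d (x + y)
    algebraMap-homogeneous        : ∀ k → Homogeneous 0 (algebraMap k)
    *-homogeneous                 : ∀ {d e x y} → Homogeneous d x → Homogeneous e y → Homogeneous (d ℕ.+ e) (x * y)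
    decomposition                 : ∀ x → FiniteSumOf (λ y → ∃[ d ] Homogeneous d y) x
    independence                  : ∀ {n} (f : Vector Carrier n) → (∀ i → Homogeneous (toℕ i) (f i)) →
                                    Sum.sum +-commutativeMonoid f ≈ 0# → ∀ i → f i ≈ 0#

module _ {c ℓ a r p : Level} {K : CommutativeRing c ℓ} (A : GradedAlgebra K a r p) where

  private
    module K = CommutativeRing K
  open GradedAlgebra A

  open Membership setoid using () renaming (_∈_ to _∈ᴸ_)

  data Adjoin {q : Level} (S : Pred Carrier q) : Pred Carrier (c ⊔ a ⊔ r ⊔ q) where
    generator : ∀ {x} → S x → Adjoin S x
    constant  : ∀ k → Adjoin S (algebraMap k)
    plus      : ∀ {x y} → Adjoin S x → Adjoin S y → Adjoin S (x + y)
    times     : ∀ {x y} → Adjoin S x → Adjoin S y → Adjoin S (x * y)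
    resp      : ∀ {x y} → x ≈ y → Adjoin S x → Adjoin S y

  -- A₀ = K and A is generated as a K-algebra by finitely many elements of A₁.
  record IsStandardGraded : Set (c ⊔ ℓ ⊔ a ⊔ r ⊔ p) where
    field
      algebraMap-injective  : Injective K._≈_ _≈_ algebraMap
      algebraMap-onto       : ∀ {x} → Homogeneous 0 x → ∃[ k ] x ≈ algebraMap k
      generators            : List Carrier
      generators-degree-one : All (Homogeneous 1) generators
      generates             : ∀ x → Adjoin (_∈ᴸ generators) x

  IrrelevantIdeal : Pred Carrier (a ⊔ r ⊔ p)
  IrrelevantIdeal = FiniteSumOf (λ y → ∃[ d ] Homogeneous (suc d) y)

  -- A / A_{>0}: the carrier of A with the coarser equality.
  residueField : RawLeftModule Carrier a (a ⊔ r ⊔ p)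
  residueField = record
    { Carrierᴹ = Carrier ; _≈ᴹ_ = λ x y → x - y ∈ IrrelevantIdeal
    ; _+ᴹ_ = _+_ ; _*ₗ_ = _*_ ; 0ᴹ = 0# ; -ᴹ_ = -_
    }

  free : ℕ → RawLeftModule Carrier a r
  free β = record
    { Carrierᴹ = Vector Carrier β ; _≈ᴹ_ = Pointwise _≈_
    ; _+ᴹ_ = λ u v k → u k + v k ; _*ₗ_ = λ x v k → x * v k ; 0ᴹ = λ _ → 0# ; -ᴹ_ = λ v k → - v k
    }

  -- The degree d component of A(-i), namely A_{d-i}, which is zero for d < i.
  Twisted : ℕ → ℕ → Pred Carrier (r ⊔ p)
  Twisted i d x = (∃[ e ] i ℕ.+ e ≡ d × Homogeneous e x) ⊎ (d ℕ.< i × x ≈ 0#)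

  -- A resolution ⋯ → A(-2)^β₂ → A(-1)^β₁ → A^β₀ → A/A_{>0} → 0 by graded A-linear maps of degree 0.
  record LinearResolution : Set (a ⊔ r ⊔ p) where
    module 𝕜 = RawLeftModule residueField
    field
      β            : ℕ → ℕ
      ∂            : ∀ i → Vector Carrier (β (suc i)) → Vector Carrier (β i)
      ε            : Vector Carrier (β 0) → Carrier
      ∂-linear     : ∀ i → LeftModuleMorphisms.IsLeftModuleHomomorphism (free (β (suc i))) (free (β i)) (∂ i)
      ε-linear     : LeftModuleMorphisms.IsLeftModuleHomomorphism (free (β 0)) residueField ε
      ∂-graded     : ∀ i {d} v → (∀ k → Twisted (suc i) d (v k)) → ∀ k → Twisted i d (∂ i v k)
      ε-graded     : ∀ {d} v → (∀ k → Twisted 0 d (v k)) → ∃[ x ] Homogeneous d x × ε v 𝕜.≈ᴹ x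
      ε-surjective : Surjective (Pointwise _≈_) 𝕜._≈ᴹ_ ε
      ε-exact      : ∀ v → ε v 𝕜.≈ᴹ 0# ⇔ (∃[ w ] Pointwise _≈_ (∂ 0 w) v)
      ∂-exact      : ∀ i v → Pointwise _≈_ (∂ i v) (λ _ → 0#) ⇔ (∃[ w ] Pointwise _≈_ (∂ (suc i) w) v)

  record IsKoszul : Set (c ⊔ ℓ ⊔ a ⊔ r ⊔ p) where
    field
      isStandardGraded : IsStandardGraded
      linearResolution : LinearResolution

module GradedMonoidAlgebra {c ℓ m ℓm : Level} (K : CommutativeRing c ℓ)
  (M : CommutativeMonoid m ℓm) (_≟_ : Decidable (CommutativeMonoid._≈_ M))
  (deg : CommutativeMonoid.Carrier M → ℕ)
  (deg-isMonoidHomomorphism : MonoidMorphisms.IsMonoidHomomorphism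
    (CommutativeMonoid.rawMonoid M) ℕ.+-0-rawMonoid deg)
  where

  private
    module K = CommutativeRing K
    module M = CommutativeMonoid M
    module deg = MonoidMorphisms.IsMonoidHomomorphism deg-isMonoidHomomorphism
  open MonoidAlgebra K M _≟_
  open CommutativeRing commutativeRing using (+-commutativeMonoid; rawRing)
  open import Relation.Binary.Reasoning.Setoid K.setoid
  open Sum +-commutativeMonoid using (sum)

  Homogeneous : ℕ → Pred Carrier (m ⊔ ℓ)
  Homogeneous d f = ∀ p → deg p ≢ d → coeff p f K.≈ K.0#

  private
    term-homogeneous : ∀ c q → Homogeneous (deg q) ((c , q) ∷ [])
    term-homogeneous c q p p≢q with p ≟ q
    ... | yes p≈q = ⊥-elim (p≢q (deg.⟦⟧-cong p≈q))
    ... | no _    = K.+-identityˡ _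

    +-homogeneous : ∀ {d f g} → Homogeneous d f → Homogeneous d g → Homogeneous d (f ++ g)
    +-homogeneous {f = f} {g} f∈ g∈ p p≢d =
      K.trans (coeff-++ p f g) (K.trans (K.+-cong (f∈ p p≢d) (g∈ p p≢d)) (K.+-identityˡ _))

    -- Only the terms of degree d matter for a linear extension evaluated at a homogeneous element.
    ∫-homogeneous : ∀ {h d} f → (∀ {p q} → p M.≈ q → h p K.≈ h q) → (∀ p → deg p ≡ d → h p K.≈ K.0#) →
                    Homogeneous d f → ∫ h f K.≈ K.0#
    ∫-homogeneous {h} {d} f h-cong h≈0 f∈ = begin
      ∫ h f                        ≈⟨ ∫-resp h-cong f≋ ⟩
      ∫ h (only f)                 ≈⟨ vanish f ⟩
      K.0#                         ∎
      where
      keep : ∀ {q} → Dec (deg q ≡ d) → K.Carrier × M.Carrier → Carrier → Carrier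
      keep (yes _) t f = t ∷ f
      keep (no _)  t f = f

      only : Carrier → Carrier
      only []            = []
      only ((c , q) ∷ f) = keep {q} (deg q ℕ.≟ d) (c , q) (only f)

      only-coeff : ∀ p → deg p ≡ d → ∀ f → coeff p f K.≈ coeff p (only f)
      only-coeff p p≡d []            = K.refl
      only-coeff p p≡d ((c , q) ∷ f) with deg q ℕ.≟ d
      ... | yes _ = K.+-congˡ (only-coeff p p≡d f)
      ... | no q≢d with p ≟ q
      ... | yes p≈q = ⊥-elim (q≢d (≡.trans (≡.sym (deg.⟦⟧-cong p≈q)) p≡d))
      ... | no _    = K.trans (K.+-identityˡ _) (only-coeff p p≡d f)

      only-coeff′ : ∀ p → deg p ≢ d → ∀ f → coeff p (only f) K.≈ K.0#
      only-coeff′ p p≢d []            = K.refl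
      only-coeff′ p p≢d ((c , q) ∷ f) with deg q ℕ.≟ d
      ... | no _ = only-coeff′ p p≢d f
      ... | yes q≡d with p ≟ q
      ... | yes p≈q = ⊥-elim (p≢d (≡.trans (deg.⟦⟧-cong p≈q) q≡d))
      ... | no _    = K.trans (K.+-identityˡ _) (only-coeff′ p p≢d f)

      f≋ : f ≋ only f
      f≋ = coeffwise go
        where
        go : ∀ p → coeff p f K.≈ coeff p (only f)
        go p with deg p ℕ.≟ d
        ... | yes p≡d = only-coeff p p≡d f
        ... | no p≢d  = K.trans (f∈ p p≢d) (K.sym (only-coeff′ p p≢d f))

      vanish : ∀ f → ∫ h (only f) K.≈ K.0#
      vanish []            = K.refl
      vanish ((c , q) ∷ f) with deg q ℕ.≟ d
      ... | yes q≡d = K.trans (K.+-cong (K.trans (K.*-congˡ (h≈0 q q≡d)) (K.zeroʳ c)) (vanish f)) (K.+-identityˡ _)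
      ... | no _    = vanish f

    *-homogeneous : ∀ {d e f g} → Homogeneous d f → Homogeneous e g → Homogeneous (d ℕ.+ e) (f *ᴬ g)
    *-homogeneous {d} {e} {f} {g} f∈ g∈ r r≢d+e = begin
      coeff r (f *ᴬ g)                              ≈⟨ K.trans (coeff-∫ r (f *ᴬ g)) (∫-* _ f g) ⟩
      ∫ (λ p → ∫ (λ q → δ r (p M.∙ q)) g) f         ≈⟨ ∫-homogeneous f (λ p≈ → ∫-cong (λ q → δ-cong r (M.∙-congʳ p≈)) g)
                                                         (λ p p≡d → ∫-homogeneous g (λ q≈ → δ-cong r (M.∙-congˡ q≈))
                                                           (λ q q≡e → off p q p≡d q≡e) g∈) f∈ ⟩
      K.0#                                          ∎
      where
      off : ∀ p q → deg p ≡ d → deg q ≡ e → δ r (p M.∙ q) K.≈ K.0#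
      off p q p≡d q≡e with r ≟ (p M.∙ q)
      ... | yes r≈ = ⊥-elim (r≢d+e (≡.trans (deg.⟦⟧-cong r≈) (≡.trans (deg.homo p q) (≡.cong₂ ℕ._+_ p≡d q≡e))))
      ... | no _   = K.refl

    decomposition : ∀ f → ∃[ xs ] All (λ y → ∃[ d ] Homogeneous d y) xs × f ≋ foldr _++_ [] xs
    decomposition []            = [] , [] , ≋-refl
    decomposition ((c , q) ∷ f) with xs , xs∈ , f≋xs ← decomposition f =
      ((c , q) ∷ []) ∷ xs , (deg q , term-homogeneous c q) ∷ xs∈ ,
      coeffwise λ p → K.+-congˡ (coeff-≈ f≋xs p)

    sum-off : ∀ {n} (f : Vector Carrier n) p → (∀ i → coeff p (f i) K.≈ K.0#) → coeff p (sum f) K.≈ K.0#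
    sum-off {zero}  f p f≈0 = K.refl
    sum-off {suc n} f p f≈0 = K.trans (coeff-++ p (f zero) _) (K.trans
      (K.+-cong (f≈0 zero) (sum-off (λ i → f (suc i)) p (λ i → f≈0 (suc i)))) (K.+-identityˡ _))

    sum-at : ∀ {n} (f : Vector Carrier n) p i → (∀ j → j ≢ i → coeff p (f j) K.≈ K.0#) →
             coeff p (sum f) K.≈ coeff p (f i)
    sum-at {suc n} f p zero    f≈0 = K.trans (coeff-++ p (f zero) _) (K.trans
      (K.+-congˡ (sum-off (λ i → f (suc i)) p (λ i → f≈0 (suc i) λ ()))) (K.+-identityʳ _))
    sum-at {suc n} f p (suc i) f≈0 = K.trans (coeff-++ p (f zero) _) (K.trans
      (K.+-cong (f≈0 zero λ ()) (sum-at (λ i → f (suc i)) p i (λ j j≢i → f≈0 (suc j) (λ e → j≢i (Fin.suc-injective e)))))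
      (K.+-identityˡ _))

    independence : ∀ {n} (f : Vector Carrier n) → (∀ i → Homogeneous (toℕ i) (f i)) →
                   sum f ≋ [] → ∀ i → f i ≋ []
    independence f f∈ Σf≋0 i = coeffwise go
      where
      go : ∀ p → coeff p (f i) K.≈ K.0#
      go p with deg p ℕ.≟ toℕ i
      ... | no p≢i  = f∈ i p p≢i
      ... | yes p≡i = K.trans (K.sym (sum-at f p i λ j j≢i → f∈ j p λ p≡j →
                        j≢i (Fin.toℕ-injective (≡.trans (≡.sym p≡j) p≡i)))) (coeff-≈ Σf≋0 p)

    scalar-isRingHomomorphism : RingMorphisms.IsRingHomomorphism K.rawRing rawRing scalar
    scalar-isRingHomomorphism = record
      { isSemiringHomomorphism = record
        { isNearSemiringHomomorphism = record
          { +-isMonoidHomomorphism = record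
            { isMagmaHomomorphism = record
              { isRelHomomorphism = record { cong = λ c≈d → coeffwise λ p → K.+-congʳ (if-cong (does (p ≟ M.ε)) c≈d) }
              ; homo = λ c d → coeffwise λ p → if-+ (does (p ≟ M.ε)) c d
              }
            ; ε-homo = coeffwise λ p → if-0 (does (p ≟ M.ε))
            }
          ; *-homo = λ c d → term-cong (c K.* d) (M.sym (M.identityˡ M.ε))
          }
        ; 1#-homo = ≋-refl
        }
      ; -‿homo = λ c → ≋-refl
      }
      where
      if-cong : ∀ b {c d} → c K.≈ d → (if b then c else K.0#) K.≈ (if b then d else K.0#)
      if-cong true  e = e
      if-cong false e = K.refl

      if-+ : ∀ b c d → (if b then c K.+ d else K.0#) K.+ K.0# K.≈
                       (if b then c else K.0#) K.+ ((if b then d else K.0#) K.+ K.0#)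
      if-+ true  c d = K.+-assoc c d K.0#
      if-+ false c d = K.sym (K.+-identityˡ _)

      if-0 : ∀ b → (if b then K.0# else K.0#) K.+ K.0# K.≈ K.0#
      if-0 true  = K.+-identityˡ _
      if-0 false = K.+-identityˡ _

  gradedAlgebra : GradedAlgebra K (c ⊔ m) (m ⊔ ℓ) (m ⊔ ℓ)
  gradedAlgebra = record
    { commutativeRing = commutativeRing
    ; algebraMap = scalar
    ; algebraMap-isRingHomomorphism = scalar-isRingHomomorphism
    ; Homogeneous = Homogeneous
    ; Homogeneous-resp = λ f≋g f∈ p p≢d → K.trans (K.sym (coeff-≈ f≋g p)) (f∈ p p≢d)
    ; 0#-homogeneous = λ _ _ → K.refl
    ; +-homogeneous = λ {_} {f} {g} → +-homogeneous {f = f} {g}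
    ; algebraMap-homogeneous = λ c p p≢0 → term-homogeneous c M.ε p (λ e → p≢0 (≡.trans e deg.ε-homo))
    ; *-homogeneous = λ {_} {_} {f} {g} → *-homogeneous {f = f} {g}
    ; decomposition = decomposition
    ; independence = independence
    }

module _ {a r : Level} (R : CommutativeRing a r) where

  open CommutativeRing R using (Carrier; _≈_; _+_; _*_; 0#)

  data Ideal⟨_⟩ {q : Level} (S : Pred Carrier q) : Pred Carrier (a ⊔ r ⊔ q) where
    generator : ∀ {x} → S x → Ideal⟨ S ⟩ x
    null      : Ideal⟨ S ⟩ 0#
    plus      : ∀ {x y} → Ideal⟨ S ⟩ x → Ideal⟨ S ⟩ y → Ideal⟨ S ⟩ (x + y)
    times     : ∀ x {y} → Ideal⟨ S ⟩ y → Ideal⟨ S ⟩ (x * y)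
    resp      : ∀ {x y} → x ≈ y → Ideal⟨ S ⟩ x → Ideal⟨ S ⟩ y

-- Monomials in the indeterminates X, as lists of indeterminates up to permutation.
module Monomials {x ℓx : Level} (X : DecSetoid x ℓx) where

  private
    module X = DecSetoid X
  open X using (_≟_)
  open Permutation X.setoid using (_↭_; ↭-sym; ↭-trans; ↭-prep; ↭-refl; ↭-reflexive-≋)
  open PermutationProperties X.setoid using (¬x∷xs↭[]; ∈-resp-↭; shift; drop-∷)

  Monomial : Set x
  Monomial = List X.Carrier

  monoid : CommutativeMonoid x (x ⊔ ℓx)
  monoid = PermutationProperties.++-commutativeMonoid X.setoid

  infix 4 _↭?_
  _↭?_ : Decidable _↭_
  []       ↭? []       = yes ↭-refl
  []       ↭? (y ∷ ys) = no (λ p → ¬x∷xs↭[] (↭-sym p))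
  (x ∷ xs) ↭? ys with any? (x ≟_) ys
  ... | no x∉ys  = no (λ p → x∉ys (∈-resp-↭ p (here X.refl)))
  ... | yes x∈ys with hs , zs , w , x≈w , ys≋ ← MembershipProperties.∈-∃++ X.setoid x∈ys
                 with x∷hs++zs↭ys ← ↭-sym (↭-trans (↭-reflexive-≋ ys≋) (shift (X.sym x≈w) hs zs))
                 with xs ↭? (hs ++ zs)
  ... | yes p = yes (↭-trans (↭-prep x p) x∷hs++zs↭ys)
  ... | no ¬p = no (λ q → ¬p (drop-∷ (↭-trans q (↭-sym x∷hs++zs↭ys))))

  exponent : X.Carrier → Monomial → ℕ
  exponent x m = length (filter (x ≟_) m)

  -- The degree reverse lexicographic order on monomials induced by a total order
  -- on X.  If X is enumerated decreasingly, η is the rightmost indeterminate at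
  -- which the exponents of m and m′ differ.
  module DegRevLex {o : Level} (_≻_ : Rel X.Carrier o) where

    infix 4 _≻ᵐ_
    _≻ᵐ_ : Rel Monomial (x ⊔ o)
    m ≻ᵐ m′ = length m ℕ.> length m′
            ⊎ (length m ≡ length m′ × (∃[ η ] exponent η m ℕ.< exponent η m′
                                           × (∀ η′ → η ≻ η′ → exponent η′ m ≡ exponent η′ m′)))

module Gröbner {c ℓ₁ ℓ₂ x ℓx o : Level} (K : HeytingField c ℓ₁ ℓ₂) (X : DecSetoid x ℓx)
               (_≻_ : Rel (List (DecSetoid.Carrier X)) o) where

  private
    module K = HeytingField K
  open K using (_#_)
  open Monomials X using (Monomial; monoid; _↭?_)
  open MonoidAlgebra (HeytingCommutativeRing.commutativeRing K.heytingCommutativeRing) monoid _↭?_ public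
  open Membership (CommutativeRing.setoid commutativeRing) using () renaming (_∈_ to _∈ᴸ_)

  -- A relation rather than a function: over a field without decidable equality
  -- the leading monomial of a polynomial cannot be computed.
  IsLeadingMonomial : Monomial → Carrier → Set (ℓ₁ ⊔ ℓ₂ ⊔ x ⊔ o)
  IsLeadingMonomial m f = coeff m f # K.0# × (∀ m′ → m′ ≻ m → coeff m′ f K.≈ K.0#)

  InitialIdeal : ∀ {q} → Pred Carrier q → Pred Carrier (c ⊔ ℓ₁ ⊔ ℓ₂ ⊔ x ⊔ o ⊔ q)
  InitialIdeal S = Ideal⟨_⟩ commutativeRing λ g → ∃[ f ] S f × (∃[ m ] IsLeadingMonomial m f × g ≋ monomial m)

  record IsGröbnerBasis {q r} (G : Pred Carrier q) (I : Pred Carrier r) : Set (c ⊔ ℓ₁ ⊔ ℓ₂ ⊔ x ⊔ o ⊔ q ⊔ r) where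
    field
      finite        : ∃[ gs ] (∀ f → f ∈ G ⇔ f ∈ᴸ gs)
      contained     : G ⊆ I
      initial-ideal : InitialIdeal G ≐ InitialIdeal I

-- Indices are shifted by one: b j is b_{j+1} and coordinate k is a_{k+1}.
module LSPaths (n : ℕ) (b : Fin n → ℕ) (b>0 : ∀ j → NonZero (b j)) where

  open Rational using (ℚ; 0ℚ; 1ℚ; _+_; _-_; _*_; -_; _≤_; _<_; _/_)
  open SemiringSum (CommutativeRing.semiring ℚ.+-*-commutativeRing)
    using (sum; ∑-distrib-+; ∑-comm; *-distribˡ-sum; *-distribʳ-sum; sum-cong-≗; sum-replicate-zero)

  e : Fin (suc n) → Vector ℚ (suc n)
  e i k = if does (i Fin.≟ k) then 1ℚ else 0ℚ

  1/b : Fin n → ℚ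
  1/b j = _/_ (+ 1) (b j) {{b>0 j}}

  v : Fin n → Vector ℚ (suc n)
  v j k = (e (inject₁ j) k - e (suc j) k) * 1/b j

  v-last : Vector ℚ (suc n)
  v-last = e (fromℕ n)

  -- L(b), the ℤ-span of the vectors v j and v-last, as a subset of ℚ^{n+1}.
  InLattice : Pred (Vector ℚ (suc n)) 0ℓ
  InLattice a = Σ[ z ∈ Vector ℤ n ] Σ[ z′ ∈ ℤ ] (∀ k → a k ≡ sum (λ j → (z j / 1) * v j k) + (z′ / 1) * v-last k)

  record LSPath : Set where
    constructor lsPath
    field
      coord     : Vector ℚ (suc n)
      inLattice : InLattice coord
      coord≥0   : ∀ k → 0ℚ ≤ coord k
  open LSPath public

  decSetoid : DecSetoid 0ℓ 0ℓ
  decSetoid = On.decSetoid (PointwiseProperties.decSetoid ℚ.≡-decSetoid (suc n)) coord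

  open DecSetoid decSetoid public using () renaming (_≈_ to _≈ᴾ_; _≟_ to _≟ᴾ_)

  private
    /1-homo : ∀ x y → (x ℤ.+ y) / 1 ≡ x / 1 + y / 1
    /1-homo x y = ℚ.toℚᵘ-injective (ℚᵘ.≃-trans (ℚ.toℚᵘ-fromℚᵘ (mkℚᵘ (x ℤ.+ y) 0)) (ℚᵘ.≃-trans
      (*≡* (≡.cong (ℤ._* (+ 1)) (≡.sym (≡.cong₂ ℤ._+_ (ℤ.*-identityʳ x) (ℤ.*-identityʳ y)))))
      (ℚᵘ.≃-sym (ℚᵘ.≃-trans (ℚ.toℚᵘ-homo-+ (x / 1) (y / 1))
        (ℚᵘ.+-cong (ℚ.toℚᵘ-fromℚᵘ (mkℚᵘ x 0)) (ℚ.toℚᵘ-fromℚᵘ (mkℚᵘ y 0)))))))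

    /1-injective : ∀ {x y} → x / 1 ≡ y / 1 → x ≡ y
    /1-injective {x} {y} eq with *≡* p ← ℚ.fromℚᵘ-injective {mkℚᵘ x 0} {mkℚᵘ y 0} eq =
      ≡.trans (≡.sym (ℤ.*-identityʳ x)) (≡.trans p (ℤ.*-identityʳ y))

    /1-nonNeg : ∀ z → 0ℚ ≤ z / 1 → + ℤ.∣ z ∣ ≡ z
    /1-nonNeg z 0≤z with *≤* p ← ℚᵘ.≤-respʳ-≃ (ℚ.toℚᵘ-fromℚᵘ (mkℚᵘ z 0)) (ℚ.toℚᵘ-mono-≤ 0≤z) =
      ℤ.0≤i⇒+∣i∣≡i (≡.subst (ℤ.0ℤ ℤ.≤_) (ℤ.*-identityʳ z) p)

    sum-nonNeg : ∀ {m} (f : Vector ℚ m) → (∀ k → 0ℚ ≤ f k) → 0ℚ ≤ sum f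
    sum-nonNeg {zero}  f f≥0 = ℚ.≤-refl
    sum-nonNeg {suc m} f f≥0 = ℚ.≤-trans (ℚ.≤-reflexive (≡.sym (ℚ.+-identityˡ 0ℚ)))
      (ℚ.+-mono-≤ (f≥0 zero) (sum-nonNeg (λ k → f (suc k)) (λ k → f≥0 (suc k))))

    sum-neg : ∀ {m} (f : Vector ℚ m) → sum (λ k → - f k) ≡ - sum f
    sum-neg {zero}  f = ≡.refl
    sum-neg {suc m} f = ≡.trans (≡.cong (λ q → - f zero + q) (sum-neg (λ k → f (suc k))))
                                (≡.sym (ℚ.neg-distrib-+ (f zero) _))

    sum-e : ∀ {m} (i : Fin m) → sum (λ k → if does (i Fin.≟ k) then 1ℚ else 0ℚ) ≡ 1ℚ
    sum-e {suc m} zero    = ≡.trans (≡.cong (λ q → 1ℚ + q) (sum-replicate-zero m)) (ℚ.+-identityʳ 1ℚ)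
    sum-e {suc m} (suc i) = ≡.trans (ℚ.+-identityˡ _) (sum-e i)

    sum-v : ∀ j → sum (v j) ≡ 0ℚ
    sum-v j = begin
      sum (v j)
        ≡⟨ *-distribʳ-sum (1/b j) (λ k → e (inject₁ j) k - e (suc j) k) ⟨
      sum (λ k → e (inject₁ j) k - e (suc j) k) * 1/b j
        ≡⟨ ≡.cong (_* 1/b j) (≡.trans (∑-distrib-+ (e (inject₁ j)) (λ k → - e (suc j) k))
             (≡.cong₂ _+_ (sum-e (inject₁ j)) (≡.trans (sum-neg (e (suc j))) (≡.cong -_ (sum-e (suc j)))))) ⟩
      (1ℚ - 1ℚ) * 1/b j
        ≡⟨ ℚ.*-zeroˡ (1/b j) ⟩
      0ℚ ∎
      where open ≡-Reasoning

    sum-lattice : ∀ (z : Vector ℤ n) (z′ : ℤ) → sum (λ k → sum (λ j → (z j / 1) * v j k) + (z′ / 1) * v-last k) ≡ z′ / 1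
    sum-lattice z z′ = begin
      sum (λ k → sum (λ j → (z j / 1) * v j k) + (z′ / 1) * v-last k)
        ≡⟨ ∑-distrib-+ (λ k → sum (λ j → (z j / 1) * v j k)) (λ k → (z′ / 1) * v-last k) ⟩
      sum (λ k → sum (λ j → (z j / 1) * v j k)) + sum (λ k → (z′ / 1) * v-last k)
        ≡⟨ ≡.cong₂ _+_ (∑-comm (λ k j → (z j / 1) * v j k)) (≡.sym (*-distribˡ-sum (z′ / 1) v-last)) ⟩
      sum (λ j → sum (λ k → (z j / 1) * v j k)) + (z′ / 1) * sum v-last
        ≡⟨ ≡.cong₂ _+_ (sum-cong-≗ (λ j → ≡.trans (≡.sym (*-distribˡ-sum (z j / 1) (v j)))
             (≡.trans (≡.cong ((z j / 1) *_) (sum-v j)) (ℚ.*-zeroʳ (z j / 1)))))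
             (≡.trans (≡.cong ((z′ / 1) *_) (sum-e (fromℕ n))) (ℚ.*-identityʳ (z′ / 1))) ⟩
      sum {n} (λ j → 0ℚ) + (z′ / 1)
        ≡⟨ ≡.trans (≡.cong (λ q → q + (z′ / 1)) (sum-replicate-zero n)) (ℚ.+-identityˡ (z′ / 1)) ⟩
      z′ / 1 ∎
      where open ≡-Reasoning

  deg-integral : ∀ π → ∃[ d ] sum (coord π) ≡ (+ d) / 1
  deg-integral (lsPath a (z , z′ , a≡) a≥0) =
    ℤ.∣ z′ ∣ , ≡.trans Σa≡z′ (≡.cong (_/ 1) (≡.sym (/1-nonNeg z′ (≡.subst (0ℚ ≤_) Σa≡z′ (sum-nonNeg a a≥0)))))
    where
    Σa≡z′ : sum a ≡ z′ / 1
    Σa≡z′ = ≡.trans (sum-cong-≗ a≡) (sum-lattice z z′)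

  -- The sum of the coordinates, see deg-sum.
  deg : LSPath → ℕ
  deg π = proj₁ (deg-integral π)

  deg-sum : ∀ π → sum (coord π) ≡ (+ deg π) / 1
  deg-sum π = proj₂ (deg-integral π)

  infixl 6 _+ᴾ_
  _+ᴾ_ : LSPath → LSPath → LSPath
  lsPath a (y , y′ , a≡) a≥0 +ᴾ lsPath c (z , z′ , c≡) c≥0 = record
    { coord     = λ k → a k + c k
    ; inLattice = (λ j → y j ℤ.+ z j) , y′ ℤ.+ z′ , λ k → begin
        a k + c k
          ≡⟨ ≡.cong₂ _+_ (a≡ k) (c≡ k) ⟩
        (sum (λ j → (y j / 1) * v j k) + (y′ / 1) * v-last k) + (sum (λ j → (z j / 1) * v j k) + (z′ / 1) * v-last k)
          ≡⟨ interchange (sum (λ j → (y j / 1) * v j k)) _ _ _ ⟩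
        (sum (λ j → (y j / 1) * v j k) + sum (λ j → (z j / 1) * v j k)) + ((y′ / 1) * v-last k + (z′ / 1) * v-last k)
          ≡⟨ ≡.cong₂ _+_ (≡.sym (∑-distrib-+ (λ j → (y j / 1) * v j k) (λ j → (z j / 1) * v j k)))
               (/1-*-homo y′ z′ (v-last k)) ⟩
        sum (λ j → (y j / 1) * v j k + (z j / 1) * v j k) + ((y′ ℤ.+ z′) / 1) * v-last k
          ≡⟨ ≡.cong (λ q → q + ((y′ ℤ.+ z′) / 1) * v-last k) (sum-cong-≗ (λ j → /1-*-homo (y j) (z j) (v j k))) ⟩
        sum (λ j → ((y j ℤ.+ z j) / 1) * v j k) + ((y′ ℤ.+ z′) / 1) * v-last k ∎
    ; coord≥0   = λ k → ℚ.≤-trans (ℚ.≤-reflexive (≡.sym (ℚ.+-identityˡ 0ℚ))) (ℚ.+-mono-≤ (a≥0 k) (c≥0 k))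
    }
    where
    open ≡-Reasoning
    open import Algebra.Properties.CommutativeSemigroup
      (CommutativeRing.+-commutativeSemigroup ℚ.+-*-commutativeRing) using (interchange)

    /1-*-homo : ∀ x y q → (x / 1) * q + (y / 1) * q ≡ ((x ℤ.+ y) / 1) * q
    /1-*-homo x y q = ≡.trans (≡.sym (ℚ.*-distribʳ-+ q (x / 1) (y / 1))) (≡.cong (_* q) (≡.sym (/1-homo x y)))

  0ᴾ : LSPath
  0ᴾ = record
    { coord     = λ _ → 0ℚ
    ; inLattice = (λ _ → + 0) , + 0 , λ k → ≡.sym (≡.trans
        (≡.cong₂ _+_ (≡.trans (sum-cong-≗ (λ j → ℚ.*-zeroˡ (v j k))) (sum-replicate-zero n)) (ℚ.*-zeroˡ (v-last k)))
        (ℚ.+-identityˡ 0ℚ))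
    ; coord≥0   = λ _ → ℚ.≤-refl
    }

  monoid : CommutativeMonoid 0ℓ 0ℓ
  monoid = record
    { Carrier = LSPath ; _≈_ = _≈ᴾ_ ; _∙_ = _+ᴾ_ ; ε = 0ᴾ
    ; isCommutativeMonoid = record
      { isMonoid = record
        { isSemigroup = record
          { isMagma = record
            { isEquivalence = DecSetoid.isEquivalence decSetoid
            ; ∙-cong = λ p q k → ≡.cong₂ _+_ (p k) (q k)
            }
          ; assoc = λ π η θ k → ℚ.+-assoc (coord π k) (coord η k) (coord θ k)
          }
        ; identity = (λ π k → ℚ.+-identityˡ (coord π k)) , (λ π k → ℚ.+-identityʳ (coord π k))
        }
      ; comm = λ π η k → ℚ.+-comm (coord π k) (coord η k)
      }
    }

  deg-isMonoidHomomorphism : MonoidMorphisms.IsMonoidHomomorphism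
    (CommutativeMonoid.rawMonoid monoid) ℕ.+-0-rawMonoid deg
  deg-isMonoidHomomorphism = record
    { isMagmaHomomorphism = record
      { isRelHomomorphism = record { cong = λ {π} {η} p →
          unique (≡.trans (≡.sym (deg-sum π)) (≡.trans (sum-cong-≗ p) (deg-sum η))) }
      ; homo = λ π η → unique (≡.trans (≡.sym (deg-sum (π +ᴾ η))) (≡.trans (∑-distrib-+ (coord π) (coord η))
          (≡.trans (≡.cong₂ _+_ (deg-sum π) (deg-sum η)) (≡.sym (/1-homo (+ deg π) (+ deg η))))))
      }
    ; ε-homo = ≡.refl
    }
    where
    unique : ∀ {d d′} → (+ d) / 1 ≡ (+ d′) / 1 → d ≡ d′
    unique eq = ℤ.+-injective (/1-injective eq)

  supp : LSPath → Pred (Fin (suc n)) 0ℓ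
  supp π k = coord π k ≢ 0ℚ

  -- max supp π ≤ min supp η, for π and η with non-empty support.
  _⊴_ : Rel LSPath 0ℓ
  π ⊴ η = ∀ {i j} → i ∈ supp π → j ∈ supp η → i Fin.≤ j

  -- Π(b)₁
  LSPath₁ : Set
  LSPath₁ = Σ[ π ∈ LSPath ] deg π ≡ 1

  path : LSPath₁ → LSPath
  path = proj₁

  decSetoid₁ : DecSetoid 0ℓ 0ℓ
  decSetoid₁ = On.decSetoid decSetoid path

  -- k is the leftmost coordinate at which π and η differ.
  _≻_ : Rel LSPath₁ 0ℓ
  π ≻ η = ∃[ k ] coord (path π) k - coord (path η) k < 0ℚ
               × (∀ j → j Fin.< k → coord (path π) j - coord (path η) j ≡ 0ℚ)

  open Monomials decSetoid₁ public using (Monomial; _↭?_) renaming (monoid to monomialMonoid)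
  open Monomials.DegRevLex decSetoid₁ _≻_ public using (_≻ᵐ_)
  open Permutation (DecSetoid.setoid decSetoid₁) using (_↭_; refl; prep; swap; trans)

  StandardForm : Pred Monomial 0ℓ
  StandardForm = Linked (λ π η → path π ⊴ path η)

  Standard : Pred Monomial 0ℓ
  Standard m = ∃[ m′ ] m ↭ m′ × StandardForm m′

  ⨁ : List LSPath₁ → LSPath
  ⨁ []      = 0ᴾ
  ⨁ (π ∷ m) = path π +ᴾ ⨁ m

  IsCanonicalDecomposition : LSPath → List LSPath₁ → Set
  IsCanonicalDecomposition π ηs = π ≈ᴾ ⨁ ηs × StandardForm ηs

  private
    ⨁-cong : ∀ {m m′} → m ↭ m′ → ⨁ m ≈ᴾ ⨁ m′
    ⨁-cong (refl [])           k = ≡.refl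
    ⨁-cong (refl (π≈η ∷ m≋m′)) k = ≡.cong₂ _+_ (π≈η k) (⨁-cong (refl m≋m′) k)
    ⨁-cong (prep π≈η m↭m′)     k = ≡.cong₂ _+_ (π≈η k) (⨁-cong m↭m′ k)
    ⨁-cong (swap {x = π} {y = η} π≈π′ η≈η′ m↭m′) k = ≡.trans
      (x∙yz≈y∙xz (coord (path π) k) (coord (path η) k) _)
      (≡.cong₂ _+_ (η≈η′ k) (≡.cong₂ _+_ (π≈π′ k) (⨁-cong m↭m′ k)))
      where open import Algebra.Properties.CommutativeSemigroup
              (CommutativeRing.+-commutativeSemigroup ℚ.+-*-commutativeRing) using (x∙yz≈y∙xz)
    ⨁-cong (trans m↭m′ m′↭m″)  k = ≡.trans (⨁-cong m↭m′ k) (⨁-cong m′↭m″ k)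

    ⨁-++ : ∀ m m′ → ⨁ (m ++ m′) ≈ᴾ ⨁ m +ᴾ ⨁ m′
    ⨁-++ []      m′ k = ≡.sym (ℚ.+-identityˡ (coord (⨁ m′) k))
    ⨁-++ (π ∷ m) m′ k = ≡.trans (≡.cong (λ q → coord (path π) k + q) (⨁-++ m m′ k))
      (≡.sym (ℚ.+-assoc (coord (path π) k) (coord (⨁ m) k) (coord (⨁ m′) k)))

  ⨁-isMonoidHomomorphism : MonoidMorphisms.IsMonoidHomomorphism
    (CommutativeMonoid.rawMonoid monomialMonoid) (CommutativeMonoid.rawMonoid monoid) ⨁
  ⨁-isMonoidHomomorphism = record
    { isMagmaHomomorphism = record
      { isRelHomomorphism = record { cong = ⨁-cong }
      ; homo = ⨁-++
      }
    ; ε-homo = λ k → ≡.refl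
    }

-- The coefficient field may be any K; it is the complex numbers in the classical
-- setting, with x # y meaning x ≢ y.
module LSAlgebra {c ℓ₁ ℓ₂ : Level} (K : HeytingField c ℓ₁ ℓ₂)
                 (n : ℕ) (b : Fin n → ℕ) (b>0 : ∀ j → NonZero (b j)) where

  open LSPaths n b b>0
  private
    𝕜 = HeytingCommutativeRing.commutativeRing (HeytingField.heytingCommutativeRing K)

  -- A(b), with t^π t^η = t^{π+η}.
  A[b] : GradedAlgebra 𝕜 c ℓ₁ ℓ₁
  A[b] = GradedMonoidAlgebra.gradedAlgebra 𝕜 monoid _≟ᴾ_ deg deg-isMonoidHomomorphism

  -- 𝒜(b) = K[x_π | π ∈ Π(b)₁]
  module 𝒜 = Gröbner K decSetoid₁ _≻ᵐ_

  -- φ(x_π) = t^π, so that φ(x_{π₁} ⋯ x_{πₖ}) = t^{π₁ + ⋯ + πₖ}.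
  module φ = MonoidAlgebraMap 𝕜 monomialMonoid _↭?_ monoid _≟ᴾ_ ⨁ ⨁-isMonoidHomomorphism

  -- 𝓘 = ker φ
  𝓘 : Pred 𝒜.Carrier ℓ₁
  𝓘 f = GradedAlgebra._≈_ A[b] φ.⟦ f ⟧ (GradedAlgebra.0# A[b])

  StraighteningRelations : Pred 𝒜.Carrier ℓ₁
  StraighteningRelations f = ∃[ π₁ ] ∃[ π₂ ] ∃[ η₁ ] ∃[ η₂ ]
      ¬ Standard (π₁ ∷ π₂ ∷ [])
    × IsCanonicalDecomposition (path π₁ +ᴾ path π₂) (η₁ ∷ η₂ ∷ [])
    × f 𝒜.≋ 𝒜.monomial (π₁ ∷ π₂ ∷ []) ++ 𝒜.-ᴬ 𝒜.monomial (η₁ ∷ η₂ ∷ [])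

{-# OPTIONS --safe #-}
-- Write a path as its sequence of partial sums a_1 + ⋯ + a_k. Straightening a product of
-- two degree-one paths x, y replaces it by (min(x + y, 1), max(x + y - 1, 0)), computed
-- separately at each k.
--
-- Gröbner basis: the first factor of a standard monomial is the lexicographically largest path
-- below the sum, so a standard monomial is the ≻-least one in its fibre of φ and never leads an
-- element of 𝓘, while a non-standard monomial contains a non-standard pair.
--
-- Koszulness: straightening is idempotent and satisfies the braid relation, so words of length q
-- carry an action of the 0-Hecke monoid. Its signed symmetrizer Λ_q projects onto the degree q
-- part of the Koszul dual coalgebra, which has a basis indexed by the words all of whose adjacent
-- pairs are non-standard. On the Koszul complex A ⊗ im Λ_q, moving the last factor of the
-- canonical decomposition of t^π across the tensor sign is a contracting homotopy, because
-- Λ_{q+1} = (1 ⊗ Λ_q)(1 - ρ)(1 ⊗ Λ_q) and ρ commutes with forming the canonical decomposition.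
module Submission where

open import Defs
open import Algebra.Apartness.Bundles using (HeytingField; HeytingCommutativeRing)
open import Algebra.Bundles using (AbelianGroup; CommutativeMonoid; CommutativeRing)
open import Algebra.Morphism.Structures using (module MonoidMorphisms; module RingMorphisms)
import Algebra.Properties.Semiring.Sum as SemiringSum
open import Data.Bool.Base using (true; false; if_then_else_)
open import Data.Empty using (⊥; ⊥-elim)
open import Data.Fin.Base as Fin using (Fin; zero; suc; toℕ; inject₁; fromℕ)
import Data.Fin.Induction as Fin
import Data.Fin.Properties as Fin
open import Data.Fin.Relation.Unary.Top using (view; ‵fromℕ; ‵inject₁)
open import Data.Integer.Base as ℤ using (ℤ)
import Data.Integer.Properties as ℤ
open import Data.List.Base as List
  using (List; []; _∷_; _++_; allFin; cartesianProduct; cartesianProductWith; filter; foldr; length; upTo)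
open import Data.List.Membership.Propositional using (find; lose) renaming (_∈_ to _∈ˡ_)
open import Data.List.Membership.Propositional.Properties
  using (∈-allFin; ∈-cartesianProduct⁺; ∈-cartesianProductWith⁺; ∈-filter⁺; ∈-filter⁻; ∈-lookup; ∈-map⁺; ∈-upTo⁺)
import Data.List.Membership.Setoid as Membership
import Data.List.Membership.Setoid.Properties as MembershipProperties
open import Data.List.Properties using (filter-accept; filter-reject)
import Data.List.Relation.Binary.Permutation.Setoid as Permutation
import Data.List.Relation.Binary.Permutation.Setoid.Properties as PermutationProperties
import Data.List.Relation.Binary.Pointwise.Base as Pointwise
open import Data.List.Relation.Unary.All as All using (All; []; _∷_)
import Data.List.Relation.Unary.All.Properties as All
open import Data.List.Relation.Unary.AllPairs as AllPairs using (AllPairs; []; _∷_)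
open import Data.List.Relation.Unary.Any as Any using (any?; here; there)
import Data.List.Relation.Unary.Any.Properties as Any
open import Data.List.Relation.Unary.Linked as Linked using (Linked; [-]; _∷_)
open import Data.List.Relation.Unary.Linked.Properties using (AllPairs⇒Linked; Linked⇒AllPairs)
open import Data.List.Relation.Unary.Unique.Propositional using (Unique)
import Data.List.Relation.Unary.Unique.Propositional.Properties as Unique
open import Data.Maybe.Base using (Maybe; just; nothing)
open import Data.Maybe.Relation.Binary.Pointwise as Maybe using (just; nothing)
open import Data.Nat.Base as ℕ using (ℕ; zero; suc; NonZero; _≥_)
import Data.Nat.Properties as ℕ
open import Data.Product.Base using (_×_; _,_; proj₁; proj₂; ∃-syntax)
open import Data.Rational.Base as ℚ using (ℚ; 0ℚ; 1ℚ; _/_; toℚᵘ)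
import Data.Rational.Properties as ℚ
import Data.Rational.Solver as ℚSolver
open import Data.Rational.Unnormalised.Base as ℚᵘ using (mkℚᵘ; *≡*; *≤*)
import Data.Rational.Unnormalised.Properties as ℚᵘ
open import Data.Sum.Base as Sum using (_⊎_; inj₁; inj₂; [_,_]′)
open import Data.Unit.Base using (⊤; tt)
open import Data.Vec.Base as Vec using (Vec; []; _∷_)
open import Data.Vec.Functional using (Vector)
open import Data.Vec.Functional.Relation.Binary.Pointwise using (Pointwise)
import Data.Vec.Properties as Vec
open import Function.Bundles using (_⇔_; mk⇔)
open import Level using (Level; _⊔_)
open import Relation.Binary.Bundles using (DecSetoid)
open import Relation.Binary.Core using (Rel)
open import Relation.Binary.Definitions using (Decidable; DecidableEquality; tri<; tri≈; tri>)
open import Relation.Binary.PropositionalEquality.Core as ≡ using (_≡_; _≢_; _≗_)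
open import Relation.Binary.PropositionalEquality.Properties using (module ≡-Reasoning)
open import Relation.Nullary.Decidable using (Dec; does; yes; no; _×-dec_; _⊎-dec_; ¬?)
open import Relation.Nullary.Negation using (¬_)
open import Relation.Unary as Unary using (Pred; _∈_; _⊆_)

-- The Koszul complex is written out rather than deduced from the Gröbner basis; the two halves of
-- the theorem share only the arithmetic of paths. The coefficient field may have any characteristic
-- and undecidable equality, so factorials cannot be divided by and bases cannot be found by
-- elimination. The 0-Hecke relations remove this obstacle: for idempotent braided `ρ` the operators
-- `1 - ρ` are again idempotent and braided, so their product along the longest permutation, which
-- is `Λ`, is a projector without normalisation, and its image has a basis cut out by a decidable
-- condition on words.
--
-- `Λ` acts on functions of words, not on combinations of words: matrix entries are then values of
-- such functions, and precomposition with `ρ` needs no linear extension. Case distinctions are made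
-- on paths and monomials, where equality is decidable, never on coefficients. Scaling partial sums
-- by `b` turns straightening into a minimum and a truncated difference of natural numbers, and the
-- degree-one paths into a finite alphabet with propositional equality.

-- The 0-Hecke action on words and its antisymmetrizer

-- An idempotent ρ on pairs of letters satisfying the braid relation makes
-- words into a module over the 0-Hecke monoid.
module Words {x} {X : Set x} (ρ₁ ρ₂ : X → X → X) where

  infixr 9 _at-head _at-second

  _at-head : ∀ {q} → Vec X (suc (suc q)) → Vec X (suc (suc q))
  (x ∷ y ∷ w) at-head = ρ₁ x y ∷ ρ₂ x y ∷ w

  _at-second : ∀ {q} → Vec X (suc (suc (suc q))) → Vec X (suc (suc (suc q)))
  (x ∷ w) at-second = x ∷ w at-head

  record IsZeroHecke : Set x where
    field
      idempotent : ∀ {q} (w : Vec X (suc (suc q))) → w at-head at-head ≡ w at-head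
      braid      : ∀ {q} (w : Vec X (suc (suc (suc q)))) →
                   w at-head at-second at-head ≡ w at-second at-head at-second

module Antisymmetrizer {x} {X : Set x} (ρ₁ ρ₂ : X → X → X)
                       {a ℓ} (E : AbelianGroup a ℓ) where

  open Words ρ₁ ρ₂
  open AbelianGroup E renaming (_∙_ to _+_; ε to 0#; _⁻¹ to -_; ∙-cong to +-cong; ⁻¹-cong to -‿cong;
    identityˡ to +-identityˡ; identityʳ to +-identityʳ; inverseʳ to -‿inverseʳ; comm to +-comm)
  open import Algebra.Properties.AbelianGroup E using () renaming (⁻¹-∙-comm to -‿+-comm; ε⁻¹≈ε to -0≈0)
  open import Algebra.Properties.CommutativeSemigroup commutativeSemigroup using (interchange)
  open import Relation.Binary.Reasoning.Setoid setoid

  Functional : ℕ → Set _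
  Functional q = Vec X q → Carrier

  infix 4 _≐_
  _≐_ : ∀ {q} → Functional q → Functional q → Set _
  f ≐ g = ∀ w → f w ≈ g w

  under : ∀ {q} → (Functional q → Functional q) → Functional (suc q) → Functional (suc q)
  under T f (x ∷ w) = T (λ w′ → f (x ∷ w′)) w

  τ : ∀ {q} → Functional (suc (suc q)) → Functional (suc (suc q))
  τ f w = f w - f (w at-head)

  -- Transpose of Σ_σ (-1)^{ℓ(σ)} ρ_σ (σ ∈ S_q), in the factored form
  -- Λ_{q+1} = (1 ⊗ Λ_q)(1 - ρ at the head)(1 ⊗ Λ_q).
  Λ : ∀ q → Functional q → Functional q
  Λ 0             f = f
  Λ 1             f = f
  Λ (suc (suc q)) f = under (Λ (suc q)) (τ (under (Λ (suc q)) f))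

  private
    x-x≈0 : ∀ {x y} → x ≈ y → x - y ≈ 0#
    x-x≈0 {x} {y} x≈y = trans (+-cong x≈y refl) (-‿inverseʳ y)

    x-0≈x : ∀ {x y} → y ≈ 0# → x - y ≈ x
    x-0≈x {x} y≈0 = trans (+-cong refl (trans (-‿cong y≈0) -0≈0)) (+-identityʳ x)

    sub-cong : ∀ {x x′ y y′} → x ≈ x′ → y ≈ y′ → x - y ≈ x′ - y′
    sub-cong x≈ y≈ = +-cong x≈ (-‿cong y≈)

  τ-cong : ∀ {q} {f g : Functional (suc (suc q))} → f ≐ g → τ f ≐ τ g
  τ-cong f≐g w = sub-cong (f≐g w) (f≐g (w at-head))

  under-cong : ∀ {q} {T : Functional q → Functional q} → (∀ {f g} → f ≐ g → T f ≐ T g) →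
               ∀ {f g} → f ≐ g → under T f ≐ under T g
  under-cong T-cong f≐g (x ∷ w) = T-cong (λ w′ → f≐g (x ∷ w′)) w

  Λ-cong : ∀ q {f g} → f ≐ g → Λ q f ≐ Λ q g
  Λ-cong 0             f≐g = f≐g
  Λ-cong 1             f≐g = f≐g
  Λ-cong (suc (suc q)) f≐g =
    under-cong (Λ-cong (suc q)) (τ-cong (under-cong (Λ-cong (suc q)) f≐g))

  -- Only additivity of `φ` is assumed: besides negation and multiplication by a ring element, `φ`
  -- will be `lin H`, which is linear over the coefficients but not over the ring.
  Λ-hom : ∀ (φ : Carrier → Carrier) → (∀ {x y} → x ≈ y → φ x ≈ φ y) → (∀ x y → φ (x - y) ≈ φ x - φ y) →
          ∀ q f → Λ q (λ w → φ (f w)) ≐ λ w → φ (Λ q f w)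
  Λ-hom φ φ-cong φ-sub 0             f w = refl
  Λ-hom φ φ-cong φ-sub 1             f w = refl
  Λ-hom φ φ-cong φ-sub (suc (suc q)) f (x ∷ w) = trans
    (Λ-cong (suc q) (λ w′ → trans
      (τ-cong (under-natural (Λ-hom φ φ-cong φ-sub (suc q)) f) (x ∷ w′)) (sym (φ-sub _ _))) w)
    (Λ-hom φ φ-cong φ-sub (suc q) _ w)
    where
    under-natural : ∀ {q} {T : Functional q → Functional q} →
                    (∀ f → T (λ w → φ (f w)) ≐ λ w → φ (T f w)) →
                    ∀ f → under T (λ w → φ (f w)) ≐ λ w → φ (under T f w)
    under-natural T-natural f (x ∷ w) = T-natural (λ w′ → f (x ∷ w′)) w

  Λ-+ : ∀ q f g → Λ q (λ w → f w + g w) ≐ λ w → Λ q f w + Λ q g w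
  Λ-+ 0             f g w = refl
  Λ-+ 1             f g w = refl
  Λ-+ (suc (suc q)) f g (x ∷ w) = trans
    (Λ-cong (suc q) (λ w′ → trans (τ-cong (under-+ (Λ-+ (suc q)) f g) (x ∷ w′)) (+-sub _ _ _ _)) w)
    (Λ-+ (suc q) _ _ w)
    where
    under-+ : ∀ {q} {T : Functional q → Functional q} →
              (∀ f g → T (λ w → f w + g w) ≐ λ w → T f w + T g w) →
              ∀ f g → under T (λ w → f w + g w) ≐ λ w → under T f w + under T g w
    under-+ T-+ f g (x ∷ w) = T-+ (λ w′ → f (x ∷ w′)) (λ w′ → g (x ∷ w′)) w

    +-sub : ∀ a b c d → (a + b) - (c + d) ≈ (a - c) + (b - d)
    +-sub a b c d = trans (+-cong refl (sym (-‿+-comm c d))) (interchange a b (- c) (- d))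

  Λ-neg : ∀ q f → Λ q (λ w → - f w) ≐ λ w → - Λ q f w
  Λ-neg q f = Λ-hom -_ -‿cong (λ x y → sym (-‿+-comm x (- y))) q f

  Λ-sub : ∀ q f g → Λ q (λ w → f w - g w) ≐ λ w → Λ q f w - Λ q g w
  Λ-sub q f g w = trans (Λ-+ q f (λ w → - g w) w) (+-cong refl (Λ-neg q g w))

  Λ-0 : ∀ q {f} → (∀ w → f w ≈ 0#) → ∀ w → Λ q f w ≈ 0#
  Λ-0 q f≐0 w = trans (Λ-cong q f≐0 w)
    (Λ-hom (λ _ → 0#) (λ _ → refl) (λ _ _ → sym (x-x≈0 refl)) q (λ _ → 0#) w)

  -- Taken with `P` the elements homogeneous of degree 1, this makes the differential linear.
  Λ-closed : ∀ {p} (P : Carrier → Set p) → (∀ {x y} → P x → P y → P (x - y)) →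
             ∀ q {f} → (∀ w → P (f w)) → ∀ w → P (Λ q f w)
  Λ-closed P P-sub 0             Pf w = Pf w
  Λ-closed P P-sub 1             Pf w = Pf w
  Λ-closed P P-sub (suc (suc q)) {f} Pf (x ∷ w) =
    Λ-closed P P-sub (suc q) (λ w′ → P-sub
    (under-closed (Λ-closed P P-sub (suc q)) Pf (x ∷ w′))
    (under-closed (Λ-closed P P-sub (suc q)) Pf ((x ∷ w′) at-head))) w
    where
    under-closed : ∀ {q} {T : Functional q → Functional q} →
                   (∀ {f} → (∀ w → P (f w)) → ∀ w → P (T f w)) →
                   ∀ {f} → (∀ w → P (f w)) → ∀ w → P (under T f w)
    under-closed T-closed Pf (x ∷ w) = T-closed (λ w′ → Pf (x ∷ w′)) w

  module _ (isZeroHecke : IsZeroHecke) where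
    open IsZeroHecke isZeroHecke

    private
      cong-at : ∀ {q} (f : Functional q) {w w′} → w ≡ w′ → f w ≈ f w′
      cong-at f ≡.refl = refl

      τ-invariant : ∀ {q} (f : Functional (suc (suc q))) w → τ f (w at-head) ≈ 0#
      τ-invariant f w = x-x≈0 (cong-at f (≡.sym (idempotent w)))

      -- `ΛΛ` is kept one length behind the other two laws: at length `q + 2` it follows from `ρΛ`
      -- at that length and `ΛΛ` at length `q + 1`.
      record Laws (q : ℕ) : Set (x ⊔ a ⊔ ℓ) where
        field
          ρΛ : ∀ (f : Functional (suc (suc q))) w → Λ (suc (suc q)) f (w at-head) ≈ 0#
          Λρ : ∀ (f : Functional (suc (suc q))) w → Λ (suc (suc q)) (λ w → f (w at-head)) w ≈ 0#
          ΛΛ : ∀ (f : Functional (suc q)) w → Λ (suc q) (Λ (suc q) f) w ≈ Λ (suc q) f w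

      -- The longest element absorbs every generator, so `Λ` is annihilated by `ρ` on both sides.
      -- Only the head position needs the induction; `ρ` at the second position meets the factor
      -- `1 ⊗ Λ`, to which the induction hypothesis applies.
      laws : ∀ q → Laws q
      laws zero = record
        { ρΛ = λ { f (x ∷ y ∷ []) → τ-invariant f (x ∷ y ∷ []) }
        ; Λρ = λ { f (x ∷ y ∷ []) → x-x≈0 (cong-at f (≡.sym (idempotent (x ∷ y ∷ [])))) }
        ; ΛΛ = λ _ _ → refl
        }
      laws (suc q) = record { ρΛ = ρΛ′ ; Λρ = Λρ′ ; ΛΛ = ΛΛ′ }
        where
        open Laws (laws q)
        U : Functional (suc (suc (suc q))) → Functional (suc (suc (suc q)))
        U = under (Λ (suc (suc q)))
        V : Functional (suc (suc (suc q))) → Functional (suc (suc (suc q)))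
        V = under (under (Λ (suc q)))
        τ₂ : Functional (suc (suc (suc q))) → Functional (suc (suc (suc q)))
        τ₂ f w = f w - f (w at-second)

        U-cong : ∀ {f g} → f ≐ g → U f ≐ U g
        U-cong = under-cong (Λ-cong (suc (suc q)))
        V-cong : ∀ {f g} → f ≐ g → V f ≐ V g
        V-cong = under-cong (under-cong (Λ-cong (suc q)))

        V-sub : ∀ f g → V (λ w → f w - g w) ≐ λ w → V f w - V g w
        V-sub f g (x ∷ y ∷ w) = Λ-sub (suc q) _ _ w
        V-0 : ∀ {f} → (∀ w → f w ≈ 0#) → ∀ w → V f w ≈ 0#
        V-0 f≐0 (x ∷ y ∷ w) = Λ-0 (suc q) (λ w′ → f≐0 (x ∷ y ∷ w′)) w

        -- `V` acts from the third letter on and `ρ` on the first two, so the two commute.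
        V-ρ : ∀ f w → V f (w at-head) ≈ V (λ w → f (w at-head)) w
        V-ρ f (x ∷ y ∷ w) = refl

        -- The recursion for `Λ` one letter further in, with `τ₂` as its middle factor.
        U≐VτV : ∀ f → U f ≐ V (τ₂ (V f))
        U≐VτV f (x ∷ y ∷ w) = Λ-cong (suc q) (λ w′ → refl) w

        VV : ∀ f → V (V f) ≐ V f
        VV f (x ∷ y ∷ w) = ΛΛ (λ w′ → f (x ∷ y ∷ w′)) w

        τ₂-cong : ∀ {f g} → f ≐ g → τ₂ f ≐ τ₂ g
        τ₂-cong f≐g w = sub-cong (f≐g w) (f≐g (w at-second))

        VU : ∀ f → V (U f) ≐ U f
        VU f w = trans (V-cong (U≐VτV f) w) (trans (VV _ w) (sym (U≐VτV f w)))

        UV : ∀ f → U (V f) ≐ U f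
        UV f w = trans (U≐VτV (V f) w) (trans (V-cong (τ₂-cong (VV f)) w) (sym (U≐VτV f w)))

        τV : ∀ f → τ (V f) ≐ V (τ f)
        τV f w = sym (trans (V-sub f _ w) (+-cong refl (-‿cong (sym (V-ρ f w)))))

        ρU : ∀ f w → U f (w at-second) ≈ 0#
        ρU f (x ∷ w) = ρΛ (λ w′ → f (x ∷ w′)) w

        Uρ : ∀ f w → U (λ w → f (w at-second)) w ≈ 0#
        Uρ f (x ∷ w) = Λρ (λ w′ → f (x ∷ w′)) w

        ρΛ′ : ∀ f w → U (τ (U f)) (w at-head) ≈ 0#
        ρΛ′ f w = begin
          U (τ F) (w at-head)                 ≈⟨ U≐VτV (τ F) (w at-head) ⟩
          V (τ₂ (V (τ F))) (w at-head)        ≈⟨ V-ρ _ w ⟩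
          V (λ w → τ₂ (V (τ F)) (w at-head)) w ≈⟨ V-0 vanish w ⟩
          0#                                  ∎
          where
          F = U f
          VτF : V (τ F) ≐ τ F
          VτF w = trans (sym (τV F w)) (τ-cong (VU f) w)
          -- The term at `w at-head` vanishes by idempotence. In the other, the braid relation makes
          -- the longer word end in `at-second`, as the shorter one already does, and `F = U f`
          -- vanishes on such words.
          vanish : ∀ w → τ₂ (V (τ F)) (w at-head) ≈ 0#
          vanish w = begin
            τ₂ (V (τ F)) (w at-head)                         ≈⟨ τ₂-cong VτF (w at-head) ⟩
            τ F (w at-head) - τ F (w at-head at-second)      ≈⟨ sub-cong (τ-invariant F w)
              (sub-cong (ρU f (w at-head)) (trans (cong-at F (braid w)) (ρU f (w at-second at-head)))) ⟩
            0# - (0# - 0#)                                   ≈⟨ x-x≈0 (sym (x-x≈0 refl)) ⟩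
            0#                                               ∎

        Λρ′ : ∀ f w → U (τ (U (λ w → f (w at-head)))) w ≈ 0#
        Λρ′ f w = begin
          U (τ (U (λ w → f (w at-head)))) w       ≈⟨ U-cong (τ-cong Uf) w ⟩
          U (τ (V (τ₂ (λ w → F (w at-head))))) w  ≈⟨ U-cong (τV _) w ⟩
          U (V (τ (τ₂ (λ w → F (w at-head))))) w  ≈⟨ UV _ w ⟩
          U (τ (τ₂ (λ w → F (w at-head)))) w      ≈⟨ U-cong rewrite-τ w ⟩
          U (λ w → G (w at-second)) w             ≈⟨ Uρ G w ⟩
          0#                                      ∎
          where
          F = V f
          G : Functional (suc (suc (suc q)))
          G w = F (w at-head at-second) - F (w at-head)
          Uf : U (λ w → f (w at-head)) ≐ V (τ₂ (λ w → F (w at-head)))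
          Uf w = trans (U≐VτV _ w) (V-cong (τ₂-cong (λ w → sym (V-ρ f w))) w)
          swap-sub : ∀ a b c → (a - b) - (a - c) ≈ c - b
          swap-sub a b c = begin
            (a - b) - (a - c)        ≈⟨ +-cong refl (sym (-‿+-comm a (- c))) ⟩
            (a - b) + (- a - - c)    ≈⟨ interchange a (- b) (- a) (- - c) ⟩
            (a - a) + (- b - - c)    ≈⟨ +-cong (-‿inverseʳ a) (+-cong refl (⁻¹-involutive c)) ⟩
            0# + (- b + c)           ≈⟨ trans (+-identityˡ _) (+-comm _ _) ⟩
            c - b                    ∎
            where open import Algebra.Properties.Group group using (⁻¹-involutive)
          -- Of the four terms, `F (w at-head)` cancels against its idempotent repetition. The braid
          -- relation makes the remaining two depend on `w at-second` only, so `U` annihilates them.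
          rewrite-τ : τ (τ₂ (λ w → F (w at-head))) ≐ λ w → G (w at-second)
          rewrite-τ w = trans
            (sub-cong refl (sub-cong (cong-at F (idempotent w)) (cong-at F (braid w))))
            (swap-sub _ _ _)

        ΛΛ′ : ∀ f w → Λ (suc (suc q)) (Λ (suc (suc q)) f) w ≈ Λ (suc (suc q)) f w
        ΛΛ′ f w = begin
          U₁ (τ (U₁ (U₁ (τ (U₁ f))))) w  ≈⟨ U₁-cong (τ-cong (UU (τ (U₁ f)))) w ⟩
          -- The second `τ` acts as the identity because `Λ f` vanishes on `w at-head`.
          U₁ (τ (U₁ (τ (U₁ f)))) w       ≈⟨ U₁-cong (λ w → x-0≈x (ρΛ f w)) w ⟩
          U₁ (U₁ (τ (U₁ f))) w           ≈⟨ UU (τ (U₁ f)) w ⟩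
          U₁ (τ (U₁ f)) w                ∎
          where
          U₁ : Functional (suc (suc q)) → Functional (suc (suc q))
          U₁ = under (Λ (suc q))
          U₁-cong : ∀ {f g} → f ≐ g → U₁ f ≐ U₁ g
          U₁-cong = under-cong (Λ-cong (suc q))
          UU : ∀ f → U₁ (U₁ f) ≐ U₁ f
          UU f (x ∷ w) = ΛΛ (λ w′ → f (x ∷ w′)) w

    Λ-at-head : ∀ q f w → Λ (suc (suc q)) f (w at-head) ≈ 0#
    Λ-at-head q = Laws.ρΛ (laws q)

    -- An invariant functional is of the form `f ∘ ρ`, which `Λ` annihilates. Products `t x * t y`
    -- supply such functionals.
    Λ-invariant : ∀ q {f} → (∀ w → f w ≈ f (w at-head)) → ∀ w → Λ (suc (suc q)) f w ≈ 0#
    Λ-invariant q {f} f≐ w = trans (Λ-cong (suc (suc q)) f≐ w) (Laws.Λρ (laws q) f w)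

    -- (1 ⊗ Λ_q) Λ_{q+1} = Λ_{q+1}, transposed
    Λ-absorb : ∀ q f w → Λ (suc (suc q)) (under (Λ (suc q)) f) w ≈ Λ (suc (suc q)) f w
    Λ-absorb q f = under-cong (Λ-cong (suc q)) (τ-cong λ { (x ∷ w) → Laws.ΛΛ (laws q) (λ w′ → f (x ∷ w′)) w })

-- Words over a finite alphabet, Kronecker sums and chains

allVecs : ∀ N q → List (Vec (Fin N) q)
allVecs N zero    = [] ∷ []
allVecs N (suc q) = cartesianProductWith _∷_ (allFin N) (allVecs N q)

∈-allVecs : ∀ {N q} (w : Vec (Fin N) q) → w ∈ˡ allVecs N q
∈-allVecs []      = here ≡.refl
∈-allVecs (x ∷ w) = ∈-cartesianProductWith⁺ _∷_ (∈-allFin x) (∈-allVecs w)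

allVecs-unique : ∀ N q → Unique (allVecs N q)
allVecs-unique N zero    = [] ∷ []
allVecs-unique N (suc q) = Unique.cartesianProductWith⁺ _∷_ Vec.∷-injective (Unique.allFin⁺ N) (allVecs-unique N q)

module KroneckerSum {a ℓ} (R : CommutativeRing a ℓ) {w} {W : Set w} (_≟_ : DecidableEquality W) where

  open CommutativeRing R hiding (zero)
  open SemiringSum semiring using (sum; sum-cong-≋; sum-replicate-zero)

  δ : W → W → Carrier
  δ x y = if does (x ≟ y) then 1# else 0#

  δ-≢ : ∀ {x y} → x ≢ y → δ x y ≈ 0#
  δ-≢ {x} {y} x≢y with x ≟ y
  ... | yes x≡y = ⊥-elim (x≢y x≡y)
  ... | no _    = refl

  δ-≡ : ∀ x → δ x x ≈ 1#
  δ-≡ x with x ≟ x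
  ... | yes _  = refl
  ... | no x≢x = ⊥-elim (x≢x ≡.refl)

  sum-δ-∉ : ∀ x xs (g : W → Carrier) → All (x ≢_) xs → sum (λ k → δ x (List.lookup xs k) * g (List.lookup xs k)) ≈ 0#
  sum-δ-∉ x []       g []             = refl
  sum-δ-∉ x (y ∷ xs) g (x≢y ∷ x∉xs) =
    trans (+-cong (trans (*-congʳ (δ-≢ x≢y)) (zeroˡ _)) (sum-δ-∉ x xs g x∉xs)) (+-identityˡ _)

  sum-δ-∈ : ∀ {x xs} (g : W → Carrier) → Unique xs → x ∈ˡ xs →
            sum (λ k → δ x (List.lookup xs k) * g (List.lookup xs k)) ≈ g x
  sum-δ-∈ {x} {_ ∷ xs} g (x∉xs ∷ _) (here ≡.refl) =
    trans (+-cong (trans (*-congʳ (δ-≡ x)) (*-identityˡ _)) (sum-δ-∉ x xs g x∉xs)) (+-identityʳ _)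
  sum-δ-∈ {x} {y ∷ xs} g (y∉xs ∷ xs!) (there x∈xs) =
    trans (+-cong (trans (*-congʳ (δ-≢ λ x≡y → All.lookup y∉xs x∈xs (≡.sym x≡y))) (zeroˡ _)) (sum-δ-∈ g xs! x∈xs))
          (+-identityˡ _)

  sum-δ-lookup : ∀ {xs} → Unique xs → (v : Vector Carrier (List.length xs)) → ∀ k →
                 sum (λ l → v l * δ (List.lookup xs l) (List.lookup xs k)) ≈ v k
  sum-δ-lookup {x ∷ xs} (x∉xs ∷ xs!) v zero = trans
    (+-cong (trans (*-congˡ (δ-≡ x)) (*-identityʳ _)) (trans
      (sum-cong-≋ {List.length xs} (λ l → trans (*-congˡ (δ-≢ λ e → All.lookup x∉xs (∈-lookup l) (≡.sym e))) (zeroʳ _)))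
      (sum-replicate-zero (List.length xs))))
    (+-identityʳ _)
  sum-δ-lookup {x ∷ xs} (x∉xs ∷ xs!) v (suc k) = trans
    (+-cong (trans (*-congˡ (δ-≢ (All.lookup x∉xs (∈-lookup k)))) (zeroʳ _)) (sum-δ-lookup xs! (λ l → v (suc l)) k))
    (+-identityˡ _)

module Chains {N} (ρ₁ ρ₂ : Fin N → Fin N → Fin N) where

  open Words ρ₁ ρ₂

  -- The pair is ordered: for paths, a pair that becomes standard only after its two letters are
  -- exchanged is not fixed, and may occur in a chain.
  Fixed : Fin N → Fin N → Set
  Fixed x y = ρ₁ x y ≡ x × ρ₂ x y ≡ y

  fixed? : ∀ x y → Dec (Fixed x y)
  fixed? x y = ρ₁ x y Fin.≟ x ×-dec ρ₂ x y Fin.≟ y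

  Chain : ∀ {q} → Vec (Fin N) q → Set
  Chain []          = ⊤
  Chain (x ∷ [])    = ⊤
  Chain (x ∷ y ∷ w) = ¬ Fixed x y × Chain (y ∷ w)

  chain? : ∀ {q} (w : Vec (Fin N) q) → Dec (Chain w)
  chain? []          = yes tt
  chain? (x ∷ [])    = yes tt
  chain? (x ∷ y ∷ w) = ¬? (fixed? x y) ×-dec chain? (y ∷ w)

  chain-tail : ∀ {q x} (w : Vec (Fin N) q) → Chain (x ∷ w) → Chain w
  chain-tail []      _       = tt
  chain-tail (y ∷ w) (_ , c) = c

  chains : ∀ q → List (Vec (Fin N) q)
  chains q = filter chain? (allVecs N q)

  β : ℕ → ℕ
  β q = List.length (chains q)

  word : ∀ q → Fin (β q) → Vec (Fin N) q
  word q = List.lookup (chains q)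

  infix 4 _≟ʷ_
  _≟ʷ_ : ∀ {q} → DecidableEquality (Vec (Fin N) q)
  _≟ʷ_ = Vec.≡-dec Fin._≟_

-- The Koszul complex on chains

module _ {a ℓ} (R : CommutativeRing a ℓ) {x} {X : Set x} (ρ₁ ρ₂ : X → X → X) where

  open CommutativeRing R

  RespectsBraiding : (X → Carrier) → Set (ℓ ⊔ x)
  RespectsBraiding t = ∀ x y → t x * t y ≈ t (ρ₁ x y) * t (ρ₂ x y)

module ChainComplex {a ℓ} (R : CommutativeRing a ℓ) {N} (ρ₁ ρ₂ : Fin N → Fin N → Fin N)
  (isZeroHecke : Words.IsZeroHecke ρ₁ ρ₂)
  (t : Fin N → CommutativeRing.Carrier R) (t-ρ : RespectsBraiding R ρ₁ ρ₂ t) where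

  open CommutativeRing R hiding (zero)
  open Words ρ₁ ρ₂
  open IsZeroHecke isZeroHecke
  open Chains ρ₁ ρ₂
  open Antisymmetrizer ρ₁ ρ₂ +-abelianGroup
  open SemiringSum semiring using (sum; sum-cong-≋; ∑-comm; *-distribˡ-sum; *-distribʳ-sum)
  open import Algebra.Properties.Ring ring using (-0#≈0#; x[y-z]≈xy-xz; [y-z]x≈yx-zx)
  open import Relation.Binary.Reasoning.Setoid setoid

  VanishesOffChains : ∀ {q} → Functional q → Set _
  VanishesOffChains f = ∀ w → ¬ Chain w → f w ≈ 0#

  -- By idempotence the pair produced by `ρ` is fixed.
  at-head-¬chain : ∀ {q} (w : Vec (Fin N) (suc (suc q))) → ¬ Chain (w at-head)
  at-head-¬chain (x ∷ y ∷ w) (¬fixed , _) = ¬fixed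
    (proj₁ (Vec.∷-injective (idempotent (x ∷ y ∷ w))) , proj₁ (Vec.∷-injective (proj₂ (Vec.∷-injective (idempotent (x ∷ y ∷ w))))))

  -- If the first two letters form a fixed pair, then the word equals its own `at-head`, where `Λ f`
  -- vanishes. Otherwise the defect lies in the tail, on which the outer factor `1 ⊗ Λ` acts.
  Λ-¬chain : ∀ q f → VanishesOffChains (Λ q f)
  Λ-¬chain zero    f []       ¬c = ⊥-elim (¬c tt)
  Λ-¬chain (suc q) f (x ∷ w) ¬c = go q x w f ¬c
    where
    go : ∀ q x (w : Vec (Fin N) q) f → ¬ Chain (x ∷ w) → Λ (suc q) f (x ∷ w) ≈ 0#
    go zero    x []      f ¬c = ⊥-elim (¬c tt)
    go (suc q) x (y ∷ w) f ¬c with fixed? x y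
    ... | yes (≡₁ , ≡₂) = trans
      (reflexive (≡.cong (Λ (suc (suc q)) f) (≡.sym (≡.cong₂ (λ x y → x ∷ y ∷ w) ≡₁ ≡₂))))
      (Λ-at-head isZeroHecke q f (x ∷ y ∷ w))
    ... | no ¬fixed = go q y w _ (λ c → ¬c (¬fixed , c))

  -- A functional that vanishes off chains is zero on every `w at-head`, so each factor `1 - ρ` acts
  -- as the identity. Together with `Λ-¬chain`, the image of `Λ` consists exactly of the functionals
  -- that vanish off chains, a free module with coordinates indexed by chains.
  Λ-vanishing : ∀ q {f} → VanishesOffChains f → Λ q f ≐ f
  Λ-vanishing 0             f⊥ w = refl
  Λ-vanishing 1             f⊥ w = refl
  Λ-vanishing (suc (suc q)) {f} f⊥ (x ∷ w) = begin
    Λ (suc q) (λ w′ → τ (under (Λ (suc q)) f) (x ∷ w′)) w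
      ≈⟨ Λ-cong (suc q) (λ w′ → trans (τ-cong (under-id (Λ-vanishing (suc q)) f⊥) (x ∷ w′)) (τf (x ∷ w′))) w ⟩
    Λ (suc q) (λ w′ → f (x ∷ w′)) w
      ≈⟨ under-id (Λ-vanishing (suc q)) f⊥ (x ∷ w) ⟩
    f (x ∷ w) ∎
    where
    under-id : ∀ {q} {T : Functional q → Functional q} → (∀ {f} → VanishesOffChains f → T f ≐ f) →
               ∀ {f} → VanishesOffChains f → under T f ≐ f
    under-id T-id f⊥ (x ∷ w) = T-id (λ w ¬c → f⊥ (x ∷ w) (λ c → ¬c (chain-tail w c))) w

    τf : τ f ≐ f
    τf w = trans (+-congˡ (trans (-‿cong (f⊥ (w at-head) (at-head-¬chain w))) -0#≈0#)) (+-identityʳ _)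

  Λ-*ˡ : ∀ q c f → Λ q (λ w → c * f w) ≐ λ w → c * Λ q f w
  Λ-*ˡ q c f = Λ-hom (c *_) *-congˡ (x[y-z]≈xy-xz c) q f

  Λ-*ʳ : ∀ q c f → Λ q (λ w → f w * c) ≐ λ w → Λ q f w * c
  Λ-*ʳ q c f = Λ-hom (_* c) *-congʳ ([y-z]x≈yx-zx c) q f

  Λ-sum : ∀ q {n} (f : Fin n → Functional q) → Λ q (λ w → sum (λ k → f k w)) ≐ λ w → sum (λ k → Λ q (f k) w)
  Λ-sum q {zero}  f w = Λ-0 q (λ _ → refl) w
  Λ-sum q {suc n} f w = trans (Λ-+ q (f zero) _ w) (+-congˡ (Λ-sum q (λ k → f (suc k)) w))

  open module Kronecker {q} = KroneckerSum R (_≟ʷ_ {q}) using (δ) public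

  -- The k-th coordinate of w, read as 0 unless w is a chain.
  ⟨_∣_⟩ : ∀ {q} → Vec (Fin N) q → Fin (β q) → Carrier
  ⟨_∣_⟩ {q} w k = δ w (word q k)

  word-chain : ∀ q k → Chain (word q k)
  word-chain q k = proj₂ (∈-filter⁻ chain? {xs = allVecs N q} (∈-lookup k))

  ⟨⟩-vanishes : ∀ {q} k → VanishesOffChains {q} (λ w → ⟨ w ∣ k ⟩)
  ⟨⟩-vanishes {q} k w ¬c = Kronecker.δ-≢ {q} {w} {word q k} (λ { ≡.refl → ¬c (word-chain q k) })

  -- On a chain one summand survives; on any other word every coordinate is zero, and so is `f` by
  -- hypothesis.
  expand : ∀ {q} {f : Functional q} → VanishesOffChains f → ∀ w → sum (λ k → ⟨ w ∣ k ⟩ * f (word q k)) ≈ f w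
  expand {q} {f} f⊥ w with chain? w
  ... | yes c = Kronecker.sum-δ-∈ f (Unique.filter⁺ chain? (allVecs-unique N q)) (∈-filter⁺ chain? (∈-allVecs w) c)
  ... | no ¬c = trans (Kronecker.sum-δ-∉ w (chains q) f (All.tabulate λ v∈ w≡v →
    ¬c (≡.subst Chain (≡.sym w≡v) (proj₂ (∈-filter⁻ chain? {xs = allVecs N q} v∈))))) (sym (f⊥ w ¬c))

  collect : ∀ {q} (v : Vector Carrier (β q)) k → sum (λ l → v l * ⟨ word q l ∣ k ⟩) ≈ v k
  collect {q} = Kronecker.sum-δ-lookup (Unique.filter⁺ chain? (allVecs-unique N q))

  infixr 7 t⊗_
  t⊗_ : ∀ {q} → Functional q → Functional (suc q)
  (t⊗ f) (x ∷ w) = t x * f w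

  -- The Koszul differential a ⊗ x₁⋯x_q ↦ a t_{x₁} ⊗ x₂⋯x_q, the basis chains being
  -- identified with their antisymmetrizations.
  entry : ∀ q → Fin (β q) → Functional (suc q)
  entry q k = Λ (suc q) (t⊗ λ w → ⟨ w ∣ k ⟩)

  ∂ : ∀ q → Vector Carrier (β (suc q)) → Vector Carrier (β q)
  ∂ q v k = sum (λ l → v l * entry q k (word (suc q) l))

  entry-vanishes : ∀ q k → VanishesOffChains (entry q k)
  entry-vanishes q k = Λ-¬chain (suc q) _

  -- Summing against the entries substitutes `f` for the coordinate function inside `Λ (t⊗ ...)`.
  -- Composites of differentials thereby become nested applications of `Λ`.
  sum-entry : ∀ {q} {f : Functional q} → VanishesOffChains f →
              ∀ w → sum (λ k → entry q k w * f (word q k)) ≈ Λ (suc q) (t⊗ f) w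
  sum-entry {q} {f} f⊥ w = begin
    sum (λ k → entry q k w * f (word q k))
      ≈⟨ sum-cong-≋ (λ k → Λ-*ʳ (suc q) (f (word q k)) (t⊗ λ w → ⟨ w ∣ k ⟩) w) ⟨
    sum (λ k → Λ (suc q) (λ w → (t⊗ λ w → ⟨ w ∣ k ⟩) w * f (word q k)) w)
      ≈⟨ Λ-sum (suc q) (λ k w → (t⊗ λ w → ⟨ w ∣ k ⟩) w * f (word q k)) w ⟨
    Λ (suc q) (λ w → sum (λ k → (t⊗ λ w → ⟨ w ∣ k ⟩) w * f (word q k))) w
      ≈⟨ Λ-cong (suc q) (λ { (x ∷ w) → begin
           sum (λ k → (t x * ⟨ w ∣ k ⟩) * f (word q k))   ≈⟨ sum-cong-≋ {β q} (λ k → *-assoc (t x) _ _) ⟩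
           sum (λ k → t x * (⟨ w ∣ k ⟩ * f (word q k)))   ≈⟨ *-distribˡ-sum (t x) (λ k → ⟨ w ∣ k ⟩ * f (word q k)) ⟨
           t x * sum (λ k → ⟨ w ∣ k ⟩ * f (word q k))     ≈⟨ *-congˡ (expand f⊥ w) ⟩
           t x * f w                                      ∎ }) w ⟩
    Λ (suc q) (t⊗ f) w ∎

  -- In the nested expression the inner `Λ` is absorbed by the outer one. What remains depends on
  -- the first two letters only through `t x * t y`, which straightening preserves.
  ∂∂≈0 : ∀ q v k → ∂ q (∂ (suc q) v) k ≈ 0#
  ∂∂≈0 q v k = begin
    sum (λ l → sum (λ m → v m * entry (suc q) l (word _ m)) * entry q k (word _ l))
      ≈⟨ sum-cong-≋ (λ l → *-distribʳ-sum (entry q k (word _ l)) (λ m → v m * entry (suc q) l (word _ m))) ⟩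
    sum (λ l → sum (λ m → (v m * entry (suc q) l (word _ m)) * entry q k (word _ l)))
      ≈⟨ ∑-comm (λ l m → (v m * entry (suc q) l (word _ m)) * entry q k (word _ l)) ⟩
    sum (λ m → sum (λ l → (v m * entry (suc q) l (word _ m)) * entry q k (word _ l)))
      ≈⟨ sum-cong-≋ (λ m → trans (sum-cong-≋ {β (suc q)} (λ l → *-assoc (v m) _ _))
           (sym (*-distribˡ-sum (v m) (λ l → entry (suc q) l (word _ m) * entry q k (word _ l))))) ⟩
    sum (λ m → v m * sum (λ l → entry (suc q) l (word _ m) * entry q k (word _ l)))
      ≈⟨ sum-cong-≋ (λ m → *-congˡ (trans (sum-entry (entry-vanishes q k) (word _ m)) (vanish (word _ m)))) ⟩
    sum (λ m → v m * 0#)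
      ≈⟨ *-distribʳ-sum 0# v ⟨
    sum v * 0#
      ≈⟨ zeroʳ _ ⟩
    0# ∎
    where
    D : Functional (suc (suc q))
    D = t⊗ t⊗ λ w → ⟨ w ∣ k ⟩

    vanish : ∀ w → Λ (suc (suc q)) (t⊗ entry q k) w ≈ 0#
    vanish w = begin
      Λ (suc (suc q)) (t⊗ entry q k) w             ≈⟨ Λ-cong (suc (suc q)) (λ { (x ∷ w) → sym (Λ-*ˡ (suc q) (t x) _ w) }) w ⟩
      Λ (suc (suc q)) (under (Λ (suc q)) D) w      ≈⟨ Λ-absorb isZeroHecke q D w ⟩
      Λ (suc (suc q)) D w                          ≈⟨ Λ-invariant isZeroHecke q (λ { (x ∷ y ∷ w) → begin
        t x * (t y * ⟨ w ∣ k ⟩)                    ≈⟨ *-assoc _ _ _ ⟨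
        (t x * t y) * ⟨ w ∣ k ⟩                    ≈⟨ *-congʳ (t-ρ x y) ⟩
        (t (ρ₁ x y) * t (ρ₂ x y)) * ⟨ w ∣ k ⟩      ≈⟨ *-assoc _ _ _ ⟩
        t (ρ₁ x y) * (t (ρ₂ x y) * ⟨ w ∣ k ⟩)      ∎ }) w ⟩
      0#                                           ∎

  -- The functional under `Λ` vanishes on words with a non-chain tail, so the inner `1 ⊗ Λ` leaves
  -- it alone, and the outer one leaves the summand without `ρ` alone. The subtracted term is the
  -- one that the homotopy must cancel.
  entry-∷ : ∀ q k y w → entry (suc q) k (y ∷ w) ≈
            t y * ⟨ w ∣ k ⟩ - Λ (suc q) (λ w → (t⊗ λ w → ⟨ w ∣ k ⟩) ((y ∷ w) at-head)) w
  entry-∷ q k y w = begin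
    Λ (suc q) (λ w → τ (under (Λ (suc q)) D) (y ∷ w)) w
      ≈⟨ Λ-cong (suc q) (λ w → τ-cong under-D (y ∷ w)) w ⟩
    Λ (suc q) (λ w → D (y ∷ w) - D ((y ∷ w) at-head)) w
      ≈⟨ Λ-sub (suc q) (λ w → D (y ∷ w)) (λ w → D ((y ∷ w) at-head)) w ⟩
    Λ (suc q) (λ w → D (y ∷ w)) w - Λ (suc q) (λ w → D ((y ∷ w) at-head)) w
      ≈⟨ +-congʳ (under-D (y ∷ w)) ⟩
    t y * ⟨ w ∣ k ⟩ - Λ (suc q) (λ w → D ((y ∷ w) at-head)) w ∎
    where
    D : Functional (suc (suc q))
    D = t⊗ λ w → ⟨ w ∣ k ⟩
    under-D : under (Λ (suc q)) D ≐ D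
    under-D (x ∷ w) = Λ-vanishing (suc q) (λ w ¬c → trans (*-congˡ (⟨⟩-vanishes k w ¬c)) (zeroʳ _)) w

-- Linear extension from a monoid to its algebra

module _ {a ℓ m ℓm} (R : CommutativeRing a ℓ) (M : CommutativeMonoid m ℓm) where

  private
    module M = CommutativeMonoid M
  open CommutativeRing R

  -- `lin H` extends `H` linearly over the coefficients, not over the algebra. This is what the
  -- homotopy requires, since separating the last letter is not multiplicative. The interface hides
  -- the representation of elements as lists of terms.
  record IsLinearExtension (monomial : M.Carrier → Carrier) (lin : (M.Carrier → Carrier) → Carrier → Carrier) :
                           Set (a ⊔ ℓ ⊔ m ⊔ ℓm) where
    field
      monomial-cong : ∀ {p q} → p M.≈ q → monomial p ≈ monomial q
      monomial-ε    : monomial M.ε ≈ 1#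
      monomial-∙    : ∀ p q → monomial (p M.∙ q) ≈ monomial p * monomial q
      lin-cong      : ∀ {H H′} → (∀ p → H p ≈ H′ p) → ∀ f → lin H f ≈ lin H′ f
      lin-resp      : ∀ {H} → (∀ {p q} → p M.≈ q → H p ≈ H q) → ∀ {f g} → f ≈ g → lin H f ≈ lin H g
      lin-0         : ∀ f → lin (λ _ → 0#) f ≈ 0#
      lin-+         : ∀ H H′ f → lin (λ p → H p + H′ p) f ≈ lin H f + lin H′ f
      lin-sub       : ∀ H f g → lin H (f - g) ≈ lin H f - lin H g
      lin-*         : ∀ H f g → lin H (f * g) ≈ lin (λ p → lin (λ q → H (p M.∙ q)) g) f
      lin-*ʳ        : ∀ H a f → lin (λ p → H p * a) f ≈ lin H f * a
      lin-monomial  : ∀ H p → lin H (monomial p) ≈ H p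
      lin-id        : ∀ f → lin monomial f ≈ f

module LinearExtension {c ℓ m ℓm : Level} (K : CommutativeRing c ℓ) (M : CommutativeMonoid m ℓm)
                       (_≟_ : Decidable (CommutativeMonoid._≈_ M)) where

  private
    module K = CommutativeRing K
    module M = CommutativeMonoid M
  open M using (_∙_) renaming (_≈_ to _≈ᴹ_; ε to εᴹ)
  open MonoidAlgebra K M _≟_ hiding (Carrier)
  open CommutativeRing commutativeRing hiding (zero)
  open import Algebra.Properties.CommutativeSemigroup +-commutativeSemigroup using (interchange)

  coeff-scalar-* : ∀ r c f → coeff r (scalar c * f) K.≈ c K.* coeff r f
  coeff-scalar-* r c f = begin
    coeff r (scalar c * f)               ≈⟨ K.trans (coeff-∫ r (scalar c * f)) (∫-* (δ r) (scalar c) f) ⟩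
    c K.* ∫ (λ q → δ r (εᴹ ∙ q)) f K.+ K.0#  ≈⟨ K.+-identityʳ _ ⟩
    c K.* ∫ (λ q → δ r (εᴹ ∙ q)) f           ≈⟨ K.*-congˡ (∫-cong (λ q → δ-cong r (M.identityˡ q)) f) ⟩
    c K.* ∫ (δ r) f                          ≈⟨ K.*-congˡ (coeff-∫ r f) ⟨
    c K.* coeff r f                          ∎
    where open import Relation.Binary.Reasoning.Setoid K.setoid

  lin : (M.Carrier → Carrier) → Carrier → Carrier
  lin H []            = 0#
  lin H ((c , p) ∷ f) = scalar c * H p + lin H f

  coeff-lin : ∀ r H f → coeff r (lin H f) K.≈ ∫ (λ p → coeff r (H p)) f
  coeff-lin r H []            = K.refl
  coeff-lin r H ((c , p) ∷ f) = K.trans (coeff-++ r (scalar c * H p) (lin H f))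
    (K.+-cong (coeff-scalar-* r c (H p)) (coeff-lin r H f))

  coeff-monomial : ∀ r p → coeff r (monomial p) K.≈ δ r p
  coeff-monomial r p = K.+-identityʳ _

  monomial-cong : ∀ {p q} → p ≈ᴹ q → monomial p ≈ monomial q
  monomial-cong = term-cong K.1#

  monomial-∙ : ∀ p q → monomial (p ∙ q) ≈ monomial p * monomial q
  monomial-∙ p q = coeffwise λ r → K.+-congʳ (lemma (does (r ≟ (p ∙ q))))
    where
    lemma : ∀ b → (if b then K.1# else K.0#) K.≈ (if b then K.1# K.* K.1# else K.0#)
    lemma true  = K.sym (K.*-identityʳ _)
    lemma false = K.refl

  lin-cong : ∀ {H H′} → (∀ p → H p ≈ H′ p) → ∀ f → lin H f ≈ lin H′ f
  lin-cong H≈H′ []            = refl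
  lin-cong H≈H′ ((c , p) ∷ f) = +-cong (*-congˡ {scalar c} (H≈H′ p)) (lin-cong H≈H′ f)

  lin-resp : ∀ {H} → (∀ {p q} → p ≈ᴹ q → H p ≈ H q) → ∀ {f g} → f ≈ g → lin H f ≈ lin H g
  lin-resp {H} H-cong {f} {g} f≈g = coeffwise λ r → K.trans (coeff-lin r H f)
    (K.trans (∫-resp (λ p≈q → coeff-≈ (H-cong p≈q) r) f≈g) (K.sym (coeff-lin r H g)))

  lin-++ : ∀ H f g → lin H (f + g) ≈ lin H f + lin H g
  lin-++ H []            g = refl
  lin-++ H ((c , p) ∷ f) g = trans (+-congˡ {scalar c * H p} (lin-++ H f g))
                                   (sym (+-assoc (scalar c * H p) (lin H f) (lin H g)))

  lin-+ : ∀ H H′ f → lin (λ p → H p + H′ p) f ≈ lin H f + lin H′ f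
  lin-+ H H′ []            = refl
  lin-+ H H′ ((c , p) ∷ f) = trans (+-cong (distribˡ (scalar c) (H p) (H′ p)) (lin-+ H H′ f))
                                   (interchange (scalar c * H p) (scalar c * H′ p) (lin H f) (lin H′ f))

  lin-*ʳ : ∀ H a f → lin (λ p → H p * a) f ≈ lin H f * a
  lin-*ʳ H a []            = refl
  lin-*ʳ H a ((c , p) ∷ f) = trans (+-cong (sym (*-assoc (scalar c) (H p) a)) (lin-*ʳ H a f))
                                   (sym (distribʳ a (scalar c * H p) (lin H f)))

  lin-0 : ∀ f → lin (λ _ → 0#) f ≈ 0#
  lin-0 f = coeffwise λ r → K.trans (coeff-lin r (λ _ → 0#) f) (∫-zero f)

  lin-* : ∀ H f g → lin H (f * g) ≈ lin (λ p → lin (λ q → H (p ∙ q)) g) f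
  lin-* H f g = coeffwise λ r → begin
    coeff r (lin H (f * g))                             ≈⟨ K.trans (coeff-lin r H (f * g)) (∫-* _ f g) ⟩
    ∫ (λ p → ∫ (λ q → coeff r (H (p ∙ q))) g) f         ≈⟨ ∫-cong (λ p → coeff-lin r _ g) f ⟨
    ∫ (λ p → coeff r (lin (λ q → H (p ∙ q)) g)) f       ≈⟨ coeff-lin r _ f ⟨
    coeff r (lin (λ p → lin (λ q → H (p ∙ q)) g) f)     ∎
    where open import Relation.Binary.Reasoning.Setoid K.setoid

  lin-neg : ∀ H f → lin H (- f) ≈ - lin H f
  lin-neg H f = coeffwise λ r → K.trans (coeff-lin r H (- f)) (K.trans (∫-neg _ f)
    (K.trans (K.-‿cong (K.sym (coeff-lin r H f))) (K.sym (coeff-neg r (lin H f)))))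

  lin-sub : ∀ H f g → lin H (f - g) ≈ lin H f - lin H g
  lin-sub H f g = trans (lin-++ H f (- g)) (+-congˡ {lin H f} (lin-neg H g))

  lin-monomial : ∀ H p → lin H (monomial p) ≈ H p
  lin-monomial H p = trans (+-identityʳ (1# * H p)) (*-identityˡ (H p))

  lin-id : ∀ f → lin monomial f ≈ f
  lin-id f = coeffwise λ r → K.trans (coeff-lin r monomial f)
    (K.trans (∫-cong (coeff-monomial r) f) (K.sym (coeff-∫ r f)))

  isLinearExtension : IsLinearExtension commutativeRing M monomial lin
  isLinearExtension = record
    { monomial-cong = monomial-cong
    ; monomial-ε    = refl
    ; monomial-∙    = monomial-∙
    ; lin-cong      = λ {H} {H′} → lin-cong {H} {H′}
    ; lin-resp      = λ {H} H-cong {f} {g} → lin-resp {H} H-cong {f} {g}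
    ; lin-0         = lin-0
    ; lin-+         = lin-+
    ; lin-sub       = lin-sub
    ; lin-*         = lin-*
    ; lin-*ʳ        = lin-*ʳ
    ; lin-monomial  = lin-monomial
    ; lin-id        = lin-id
    }

-- Normal forms in a monoid and the contracting homotopy

module _ {m ℓm} (M : CommutativeMonoid m ℓm) where

  open CommutativeMonoid M

  record BraidedLetters (deg : Carrier → ℕ) : Set (m ⊔ ℓm) where
    field
      {size}      : ℕ
      letter      : Fin size → Carrier
      letter-deg  : ∀ i → deg (letter i) ≡ 1
      ρ₁ ρ₂       : Fin size → Fin size → Fin size
      isZeroHecke : Words.IsZeroHecke ρ₁ ρ₂
      letter-ρ    : ∀ i j → letter i ∙ letter j ≈ letter (ρ₁ i j) ∙ letter (ρ₂ i j)

    Split : Set m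
    Split = Maybe (Carrier × Fin size)

    infix 4 _≈ˢ_
    _≈ˢ_ : Split → Split → Set (m ⊔ ℓm)
    _≈ˢ_ = Maybe.Pointwise λ s s′ → proj₁ s ≈ proj₁ s′ × proj₂ s ≡ proj₂ s′

    merge : Split → Carrier
    merge nothing        = ε
    merge (just (u , i)) = u ∙ letter i

    extend : Split → Fin size → Carrier × Fin size
    extend nothing        i = ε , i
    extend (just (u , j)) i = u ∙ letter (ρ₁ j i) , ρ₂ j i

  -- split separates the last letter of the normal form of an element from the
  -- product of the other letters.
  record LetterSplitting (deg : Carrier → ℕ) : Set (m ⊔ ℓm) where
    field
      letters : BraidedLetters deg
    open BraidedLetters letters public
    field
      split        : Carrier → Split
      split-cong   : ∀ {p q} → p ≈ q → split p ≈ˢ split q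
      split-merge  : ∀ p → p ≈ merge (split p)
      -- A new letter is braided with the last letter only. The other letters enter through their
      -- product, so they need not be straightened again.
      split-letter : ∀ p i → split (p ∙ letter i) ≈ˢ just (extend (split p) i)

module ContractingHomotopy {m ℓm} {M : CommutativeMonoid m ℓm} {deg : CommutativeMonoid.Carrier M → ℕ}
  (splitting : LetterSplitting M deg) {a ℓ} (R : CommutativeRing a ℓ)
  {monomial : CommutativeMonoid.Carrier M → CommutativeRing.Carrier R}
  {lin : (CommutativeMonoid.Carrier M → CommutativeRing.Carrier R) → CommutativeRing.Carrier R → CommutativeRing.Carrier R}
  (isLinearExtension : IsLinearExtension R M monomial lin) where

  private
    module M = CommutativeMonoid M
  open CommutativeRing R hiding (zero)
  open LetterSplitting splitting
  open IsLinearExtension isLinearExtension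
  open Words ρ₁ ρ₂
  open Chains ρ₁ ρ₂ public
  open Antisymmetrizer ρ₁ ρ₂ +-abelianGroup
  open SemiringSum semiring using (sum; sum-cong-≋; ∑-comm; ∑-distrib-+; *-distribˡ-sum; *-distribʳ-sum; sum-replicate-zero)
  open import Relation.Binary.Reasoning.Setoid setoid

  t : Fin size → Carrier
  t i = monomial (letter i)

  t-ρ : RespectsBraiding R ρ₁ ρ₂ t
  t-ρ i j = begin
    t i * t j                                        ≈⟨ monomial-∙ (letter i) (letter j) ⟨
    monomial (letter i M.∙ letter j)                 ≈⟨ monomial-cong (letter-ρ i j) ⟩
    monomial (letter (ρ₁ i j) M.∙ letter (ρ₂ i j))   ≈⟨ monomial-∙ _ _ ⟩
    t (ρ₁ i j) * t (ρ₂ i j)                          ∎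

  open ChainComplex R ρ₁ ρ₂ isZeroHecke t t-ρ public

  lin-sum : ∀ {n} (H : Fin n → M.Carrier → Carrier) f → lin (λ p → sum (λ k → H k p)) f ≈ sum (λ k → lin (H k) f)
  lin-sum {zero}  H f = lin-0 f
  lin-sum {suc n} H f = trans (lin-+ (H zero) (λ p → sum (λ k → H (suc k) p)) f)
                              (+-congˡ (lin-sum (λ k → H (suc k)) f))

  lin-sub-zero : ∀ {H} → (∀ {p q} → p M.≈ q → H p ≈ H q) → lin H 0# ≈ 0#
  lin-sub-zero {H} H-cong = begin
    lin H 0#              ≈⟨ lin-resp H-cong (-‿inverseʳ 0#) ⟨
    lin H (0# - 0#)       ≈⟨ lin-sub H 0# 0# ⟩
    lin H 0# - lin H 0#   ≈⟨ -‿inverseʳ _ ⟩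
    0#                    ∎

  lin-neg : ∀ {H} → (∀ {p q} → p M.≈ q → H p ≈ H q) → ∀ f → lin H (- f) ≈ - lin H f
  lin-neg {H} H-cong f = begin
    lin H (- f)             ≈⟨ lin-resp H-cong (+-identityˡ (- f)) ⟨
    lin H (0# - f)          ≈⟨ lin-sub H 0# f ⟩
    lin H 0# - lin H f      ≈⟨ +-congʳ (lin-sub-zero H-cong) ⟩
    0# - lin H f            ≈⟨ +-identityˡ _ ⟩
    - lin H f               ∎

  lin-additive : ∀ {H} → (∀ {p q} → p M.≈ q → H p ≈ H q) → ∀ f g → lin H (f + g) ≈ lin H f + lin H g
  lin-additive {H} H-cong f g = begin
    lin H (f + g)            ≈⟨ lin-resp H-cong (+-congˡ (⁻¹-involutive g)) ⟨
    lin H (f - - g)          ≈⟨ lin-sub H f (- g) ⟩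
    lin H f - lin H (- g)    ≈⟨ +-congˡ (-‿cong (lin-neg H-cong g)) ⟩
    lin H f - - lin H g      ≈⟨ +-congˡ (⁻¹-involutive _) ⟩
    lin H f + lin H g        ∎
    where open import Algebra.Properties.Group +-group using (⁻¹-involutive)

  lin-sumʳ : ∀ {H} → (∀ {p q} → p M.≈ q → H p ≈ H q) → ∀ {n} (f : Vector Carrier n) →
             lin H (sum f) ≈ sum (λ k → lin H (f k))
  lin-sumʳ H-cong {zero}  f = lin-sub-zero H-cong
  lin-sumʳ H-cong {suc n} f = trans (lin-additive H-cong (f zero) _) (+-congˡ (lin-sumʳ H-cong (λ k → f (suc k))))

  -- The neutral element has no last letter to move, so the homotopy is zero on `1 ⊗ w`.
  contract′ : ∀ {q} → Functional (suc q) → Vec (Fin size) q → Maybe (M.Carrier × Fin size) → Carrier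
  contract′ G w nothing        = 0#
  contract′ G w (just (u , i)) = monomial u * G (i ∷ w)

  contract : ∀ {q} → Functional (suc q) → Vec (Fin size) q → M.Carrier → Carrier
  contract G w p = contract′ G w (split p)

  contract′-cong : ∀ {q} (G : Functional (suc q)) w {s s′} → s ≈ˢ s′ → contract′ G w s ≈ contract′ G w s′
  contract′-cong G w nothing                = refl
  contract′-cong G w (just (u≈v , ≡.refl)) = *-congʳ (monomial-cong u≈v)

  contract-cong : ∀ {q} (G : Functional (suc q)) w {p p′} → p M.≈ p′ → contract G w p ≈ contract G w p′
  contract-cong G w p≈p′ = contract′-cong G w (split-cong p≈p′)

  contract-vanishes : ∀ {q} {G : Functional (suc q)} → VanishesOffChains G → ∀ p → VanishesOffChains (λ w → contract G w p)
  contract-vanishes G⊥ p w ¬c with split p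
  ... | nothing      = refl
  ... | just (u , i) = trans (*-congˡ (G⊥ (i ∷ w) (λ c → ¬c (chain-tail w c)))) (zeroʳ _)

  -- h(t^p ⊗ w) = t^u ⊗ x w, where x is the last letter of p = u x
  h : ∀ q → Vector Carrier (β q) → Vector Carrier (β (suc q))
  h q v k = sum (λ l → lin (contract (λ w → ⟨ w ∣ k ⟩) (word q l)) (v l))

  h-zero : ∀ q {v} → (∀ k → v k ≈ 0#) → ∀ k → h q v k ≈ 0#
  h-zero q v≈0 k = trans
    (sum-cong-≋ {β q} (λ l → trans (lin-resp (contract-cong _ (word q l)) (v≈0 l)) (lin-sub-zero (contract-cong _ (word q l)))))
    (sum-replicate-zero (β q))

  -- Both composites are brought to the form of a sum of values of `lin` at the components of `v`.
  -- The homotopy identity then has to be checked only for one `p` and one word.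
  ∂h : ∀ q v k → ∂ q (h q v) k ≈ sum (λ l → lin (contract (entry q k) (word q l)) (v l))
  ∂h q v k = begin
    sum (λ i → sum (λ l → H i l (v l)) * e i)       ≈⟨ sum-cong-≋ (λ i → *-distribʳ-sum (e i) (λ l → H i l (v l))) ⟩
    sum (λ i → sum (λ l → H i l (v l) * e i))       ≈⟨ ∑-comm (λ i l → H i l (v l) * e i) ⟩
    sum (λ l → sum (λ i → H i l (v l) * e i))       ≈⟨ sum-cong-≋ {β q} (λ l → begin
      sum (λ i → H i l (v l) * e i)                   ≈⟨ sum-cong-≋ {β (suc q)} (λ i → lin-*ʳ (C i l) (e i) (v l)) ⟨
      sum (λ i → lin (λ p → C i l p * e i) (v l))     ≈⟨ lin-sum (λ i p → C i l p * e i) (v l) ⟨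
      lin (λ p → sum (λ i → C i l p * e i)) (v l)     ≈⟨ lin-cong (λ p → expanded l (split p)) (v l) ⟩
      lin (contract (entry q k) (word q l)) (v l)     ∎) ⟩
    sum (λ l → lin (contract (entry q k) (word q l)) (v l)) ∎
    where
    C : Fin (β (suc q)) → Fin (β q) → M.Carrier → Carrier
    C i l = contract (λ w → ⟨ w ∣ i ⟩) (word q l)
    H : Fin (β (suc q)) → Fin (β q) → Carrier → Carrier
    H i l = lin (C i l)
    e : Fin (β (suc q)) → Carrier
    e i = entry q k (word (suc q) i)
    expanded : ∀ l s → sum (λ i → contract′ (λ w → ⟨ w ∣ i ⟩) (word q l) s * e i) ≈ contract′ (entry q k) (word q l) s
    expanded l nothing        = trans (sum-cong-≋ {β (suc q)} (λ i → zeroˡ (e i))) (sum-replicate-zero (β (suc q)))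
    expanded l (just (u , y)) = begin
      sum (λ i → (monomial u * ⟨ y ∷ word q l ∣ i ⟩) * e i)   ≈⟨ sum-cong-≋ {β (suc q)} (λ i → *-assoc (monomial u) _ (e i)) ⟩
      sum (λ i → monomial u * (⟨ y ∷ word q l ∣ i ⟩ * e i))   ≈⟨ *-distribˡ-sum (monomial u) (λ i → ⟨ y ∷ word q l ∣ i ⟩ * e i) ⟨
      monomial u * sum (λ i → ⟨ y ∷ word q l ∣ i ⟩ * e i)     ≈⟨ *-congˡ (expand (entry-vanishes q k) (y ∷ word q l)) ⟩
      monomial u * entry q k (y ∷ word q l)                   ∎

  -- The contraction of t^p x ⊗ w as a function of the word x w.
  slide : ∀ {q} → Functional (suc q) → M.Carrier → Functional (suc q)
  slide G p (x ∷ w) = contract G w (p M.∙ letter x)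

  h∂ : ∀ q v k → h q (∂ q v) k ≈
       sum (λ l → lin (λ p → Λ (suc q) (slide (λ w → ⟨ w ∣ k ⟩) p) (word (suc q) l)) (v l))
  h∂ q v k = begin
    sum (λ i → lin (C i) (sum (λ l → v l * e i l)))                    ≈⟨ sum-cong-≋ {β q} (λ i → lin-sumʳ (C-cong i) (λ l → v l * e i l)) ⟩
    sum (λ i → sum (λ l → lin (C i) (v l * e i l)))                    ≈⟨ ∑-comm (λ i l → lin (C i) (v l * e i l)) ⟩
    sum (λ l → sum (λ i → lin (C i) (v l * e i l)))                    ≈⟨ sum-cong-≋ {β (suc q)} (λ l → begin
      sum (λ i → lin (C i) (v l * e i l))                                ≈⟨ sum-cong-≋ {β q} (λ i → lin-* (C i) (v l) (e i l)) ⟩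
      sum (λ i → lin (λ p → lin (λ r → C i (p M.∙ r)) (e i l)) (v l))    ≈⟨ lin-sum (λ i p → lin (λ r → C i (p M.∙ r)) (e i l)) (v l) ⟨
      lin (λ p → sum (λ i → lin (λ r → C i (p M.∙ r)) (e i l))) (v l)    ≈⟨ lin-cong (λ p → slid p (word (suc q) l)) (v l) ⟩
      lin (λ p → Λ (suc q) (slide G p) (word (suc q) l)) (v l)           ∎) ⟩
    sum (λ l → lin (λ p → Λ (suc q) (slide G p) (word (suc q) l)) (v l)) ∎
    where
    G : Functional (suc q)
    G w = ⟨ w ∣ k ⟩
    C : Fin (β q) → M.Carrier → Carrier
    C i = contract G (word q i)
    C-cong : ∀ i {p p′} → p M.≈ p′ → C i p ≈ C i p′
    C-cong i = contract-cong G (word q i)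
    e : Fin (β q) → Fin (β (suc q)) → Carrier
    e i l = entry q i (word (suc q) l)

    slid : ∀ p w → sum (λ i → lin (λ r → C i (p M.∙ r)) (entry q i w)) ≈ Λ (suc q) (slide G p) w
    slid p w = begin
      sum (λ i → L i (entry q i w))                          ≈⟨ sum-cong-≋ {β q} (λ i → Λ-hom (L i) (lin-resp (Ci-cong i)) (lin-sub _) (suc q) (t⊗ λ w → ⟨ w ∣ i ⟩) w) ⟨
      sum (λ i → Λ (suc q) (λ w → L i ((t⊗ λ w → ⟨ w ∣ i ⟩) w)) w) ≈⟨ Λ-sum (suc q) (λ i w → L i ((t⊗ λ w → ⟨ w ∣ i ⟩) w)) w ⟨
      Λ (suc q) (λ w → sum (λ i → L i ((t⊗ λ w → ⟨ w ∣ i ⟩) w))) w ≈⟨ Λ-cong (suc q) pointwise w ⟩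
      Λ (suc q) (slide G p) w ∎
      where
      L : Fin (β q) → Carrier → Carrier
      L i = lin (λ r → C i (p M.∙ r))
      Ci-cong : ∀ i {r r′} → r M.≈ r′ → C i (p M.∙ r) ≈ C i (p M.∙ r′)
      Ci-cong i r≈r′ = C-cong i (M.∙-congˡ r≈r′)

      -- `lin` does not commute with multiplication in the ring. The coordinate is a choice between
      -- `1#` and `0#`, and deciding it leaves a single monomial or zero.
      L-indicator : ∀ i x b → L i (t x * (if b then 1# else 0#)) ≈ (if b then 1# else 0#) * C i (p M.∙ letter x)
      L-indicator i x true  = trans (lin-resp (Ci-cong i) (*-identityʳ (t x)))
        (trans (lin-monomial _ (letter x)) (sym (*-identityˡ _)))
      L-indicator i x false = trans (lin-resp (Ci-cong i) (zeroʳ (t x)))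
        (trans (lin-sub-zero (Ci-cong i)) (sym (zeroˡ _)))

      pointwise : ∀ w → sum (λ i → L i ((t⊗ λ w → ⟨ w ∣ i ⟩) w)) ≈ slide G p w
      pointwise (x ∷ w) = begin
        sum (λ i → L i (t x * ⟨ w ∣ i ⟩))                     ≈⟨ sum-cong-≋ {β q} (λ i → L-indicator i x (does (w ≟ʷ word q i))) ⟩
        sum (λ i → ⟨ w ∣ i ⟩ * C i (p M.∙ letter x))          ≈⟨ expand (contract-vanishes (⟨⟩-vanishes k) (p M.∙ letter x)) w ⟩
        contract G w (p M.∙ letter x)                         ∎

  -- For `p = u y` the first term is `u` times the entry at `y ∷ w`, and by `split-letter` the
  -- second is `u` times exactly what `entry-∷` subtracts. For `p = ε` the first term is zero, while
  -- sliding turns each letter back into the first letter of the word, so `Λ` meets the coordinate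
  -- function itself.
  homotopy-term : ∀ q k w p → contract (entry (suc q) k) w p + Λ (suc q) (slide (λ w → ⟨ w ∣ k ⟩) p) w ≈ monomial p * ⟨ w ∣ k ⟩
  homotopy-term q k w p = begin
    contract′ (entry (suc q) k) w (split p) + Λ (suc q) (slide G p) w
      ≈⟨ +-congˡ (Λ-cong (suc q) (λ { (x ∷ w) → contract′-cong G w (split-letter p x) }) w) ⟩
    contract′ (entry (suc q) k) w (split p) + Λ (suc q) (slide′ (split p)) w
      ≈⟨ split-term (split p) ⟩
    monomial (merge (split p)) * ⟨ w ∣ k ⟩
      ≈⟨ *-congʳ (monomial-cong (split-merge p)) ⟨
    monomial p * ⟨ w ∣ k ⟩ ∎
    where
    G : Functional (suc q)
    G w = ⟨ w ∣ k ⟩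
    slide′ : Maybe (M.Carrier × Fin size) → Functional (suc q)
    slide′ s (x ∷ w) = contract′ G w (just (extend s x))

    split-term : ∀ s → contract′ (entry (suc q) k) w s + Λ (suc q) (slide′ s) w ≈ monomial (merge s) * ⟨ w ∣ k ⟩
    split-term nothing = begin
      0# + Λ (suc q) (slide′ nothing) w   ≈⟨ +-identityˡ _ ⟩
      Λ (suc q) (slide′ nothing) w        ≈⟨ Λ-cong (suc q) (λ { (x ∷ w) → trans (*-congʳ monomial-ε) (*-identityˡ _) }) w ⟩
      Λ (suc q) G w                       ≈⟨ Λ-vanishing (suc q) (⟨⟩-vanishes k) w ⟩
      ⟨ w ∣ k ⟩                           ≈⟨ trans (*-congʳ monomial-ε) (*-identityˡ _) ⟨
      monomial M.ε * ⟨ w ∣ k ⟩            ∎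
    split-term (just (u , y)) = begin
      μ * entry (suc q) k (y ∷ w) + Λ (suc q) (slide′ (just (u , y))) w
        ≈⟨ +-cong (*-congˡ (entry-∷ q k y w)) (trans
             (Λ-cong (suc q) (λ { (x ∷ w) → trans (*-congʳ (monomial-∙ u _)) (*-assoc μ _ _) }) w)
             (Λ-*ˡ (suc q) μ D′ w)) ⟩
      μ * (t y * ⟨ w ∣ k ⟩ - Λ (suc q) D′ w) + μ * Λ (suc q) D′ w
        ≈⟨ distribˡ μ _ _ ⟨
      μ * ((t y * ⟨ w ∣ k ⟩ - Λ (suc q) D′ w) + Λ (suc q) D′ w)
        ≈⟨ *-congˡ (trans (+-assoc _ _ _) (trans (+-congˡ (-‿inverseˡ _)) (+-identityʳ _))) ⟩
      μ * (t y * ⟨ w ∣ k ⟩)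
        ≈⟨ *-assoc μ (t y) _ ⟨
      (μ * t y) * ⟨ w ∣ k ⟩
        ≈⟨ *-congʳ (monomial-∙ u (letter y)) ⟨
      monomial (u M.∙ letter y) * ⟨ w ∣ k ⟩ ∎
      where
      μ : Carrier
      μ = monomial u
      D′ : Functional (suc q)
      D′ w = (t⊗ λ w → ⟨ w ∣ k ⟩) ((y ∷ w) at-head)

  lin-collect : ∀ q (v : Vector Carrier (β q)) k → sum (λ l → lin (λ p → monomial p * ⟨ word q l ∣ k ⟩) (v l)) ≈ v k
  lin-collect q v k = trans
    (sum-cong-≋ {β q} (λ l → trans (lin-*ʳ monomial _ (v l)) (*-congʳ (lin-id (v l)))))
    (collect {q} v k)

  ∂h+h∂≈id : ∀ q v k → ∂ (suc q) (h (suc q) v) k + h q (∂ q v) k ≈ v k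
  ∂h+h∂≈id q v k = begin
    ∂ (suc q) (h (suc q) v) k + h q (∂ q v) k
      ≈⟨ +-cong (∂h (suc q) v k) (h∂ q v k) ⟩
    sum (λ l → lin (P l) (v l)) + sum (λ l → lin (Q l) (v l))
      ≈⟨ ∑-distrib-+ (λ l → lin (P l) (v l)) (λ l → lin (Q l) (v l)) ⟨
    sum (λ l → lin (P l) (v l) + lin (Q l) (v l))
      ≈⟨ sum-cong-≋ {β (suc q)} (λ l → trans (sym (lin-+ (P l) (Q l) (v l)))
           (lin-cong (homotopy-term q k (word (suc q) l)) (v l))) ⟩
    sum (λ l → lin (λ p → monomial p * ⟨ word (suc q) l ∣ k ⟩) (v l))
      ≈⟨ lin-collect (suc q) v k ⟩
    v k ∎
    where
    P Q : Fin (β (suc q)) → M.Carrier → Carrier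
    P l = contract (entry (suc q) k) (word (suc q) l)
    Q l p = Λ (suc q) (slide (λ w → ⟨ w ∣ k ⟩) p) (word (suc q) l)

  -- Extended by `lin`, the projection onto the span of the monomials other than 1.
  positive′ : M.Carrier → Maybe (M.Carrier × Fin size) → Carrier
  positive′ p nothing  = 0#
  positive′ p (just _) = monomial p

  positive : M.Carrier → Carrier
  positive p = positive′ p (split p)

  -- There is no `h ∂` at the end of the complex: `∂ h` annihilates 1 and fixes every other
  -- monomial. The identity therefore fails exactly on constants, which survive in the residue
  -- field.
  ∂h≈id : ∀ v → (∀ k → lin positive (v k) ≈ v k) → ∀ k → ∂ 0 (h 0 v) k ≈ v k
  ∂h≈id v v⁺ k = begin
    ∂ 0 (h 0 v) k
      ≈⟨ ∂h 0 v k ⟩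
    sum (λ l → lin (contract (entry 0 k) (word 0 l)) (v l))
      ≈⟨ sum-cong-≋ {β 0} (λ l → trans (lin-cong (λ p → term p (word 0 l) (split p) (split-merge p)) (v l))
           (trans (lin-*ʳ positive _ (v l)) (*-congʳ (v⁺ l)))) ⟩
    sum (λ l → v l * ⟨ word 0 l ∣ k ⟩)
      ≈⟨ collect {0} v k ⟩
    v k ∎
    where
    term : ∀ p w s → p M.≈ merge s → contract′ (entry 0 k) w s ≈ positive′ p s * ⟨ w ∣ k ⟩
    term p w  nothing        p≈ = sym (zeroˡ _)
    term p w (just (u , y)) p≈ = begin
      monomial u * (t y * ⟨ w ∣ k ⟩)          ≈⟨ *-assoc _ _ _ ⟨
      (monomial u * t y) * ⟨ w ∣ k ⟩          ≈⟨ *-congʳ (trans (monomial-cong p≈) (monomial-∙ u (letter y))) ⟨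
      monomial p * ⟨ w ∣ k ⟩                  ∎

  exact : ∀ q v → (∀ k → ∂ q v k ≈ 0#) → ∀ k → ∂ (suc q) (h (suc q) v) k ≈ v k
  exact q v ∂v≈0 k = begin
    ∂ (suc q) (h (suc q) v) k                       ≈⟨ +-identityʳ _ ⟨
    ∂ (suc q) (h (suc q) v) k + 0#                  ≈⟨ +-congˡ (h-zero q ∂v≈0 k) ⟨
    ∂ (suc q) (h (suc q) v) k + h q (∂ q v) k       ≈⟨ ∂h+h∂≈id q v k ⟩
    v k                                             ∎

-- From the homotopy to a linear resolution and Koszulness

module KoszulResolution {c ℓ a r p} {K : CommutativeRing c ℓ} (A : GradedAlgebra K a r p)
  {m ℓm} {M : CommutativeMonoid m ℓm} {deg : CommutativeMonoid.Carrier M → ℕ} (splitting : LetterSplitting M deg)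
  {monomial : CommutativeMonoid.Carrier M → GradedAlgebra.Carrier A}
  {lin : (CommutativeMonoid.Carrier M → GradedAlgebra.Carrier A) → GradedAlgebra.Carrier A → GradedAlgebra.Carrier A}
  (isLinearExtension : IsLinearExtension (GradedAlgebra.commutativeRing A) M monomial lin) where

  private
    module K = CommutativeRing K
  open GradedAlgebra A hiding (zero)
  open ContractingHomotopy splitting commutativeRing isLinearExtension
  open SemiringSum semiring using (sum; sum-cong-≋; ∑-distrib-+; *-distribˡ-sum; sum-replicate-zero)
  open import Algebra.Properties.Ring ring using (-1*x≈-x; -‿distribˡ-*; -0#≈0#)
  open RingMorphisms.IsRingHomomorphism algebraMap-isRingHomomorphism
    using (1#-homo; -‿homo)
  open import Relation.Binary.Reasoning.Setoid setoid

  -- Closure under negation is obtained from multiplication by the constant -1, which has degree 0.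
  neg-homogeneous : ∀ {d x} → Homogeneous d x → Homogeneous d (- x)
  neg-homogeneous {x = x} x∈ = Homogeneous-resp
    (trans (*-congʳ (trans (-‿homo K.1#) (-‿cong 1#-homo))) (-1*x≈-x x))
    (*-homogeneous (algebraMap-homogeneous (K.- K.1#)) x∈)

  sub-homogeneous : ∀ {d x y} → Homogeneous d x → Homogeneous d y → Homogeneous d (x - y)
  sub-homogeneous x∈ y∈ = +-homogeneous x∈ (neg-homogeneous y∈)

  sum-homogeneous : ∀ {d n} {f : Vector Carrier n} → (∀ i → Homogeneous d (f i)) → Homogeneous d (sum f)
  sum-homogeneous {n = zero}  f∈ = 0#-homogeneous
  sum-homogeneous {n = suc n} f∈ = +-homogeneous (f∈ zero) (sum-homogeneous (λ i → f∈ (suc i)))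

  module _ (t-homogeneous : ∀ i → Homogeneous 1 (t i)) where

    open Antisymmetrizer (LetterSplitting.ρ₁ splitting) (LetterSplitting.ρ₂ splitting) +-abelianGroup using (Λ-closed)

    entry-homogeneous : ∀ q k w → Homogeneous 1 (entry q k w)
    entry-homogeneous q k w = Λ-closed (Homogeneous 1) sub-homogeneous (suc q) term w
      where
      indicator : ∀ i b → Homogeneous 1 (t i * (if b then 1# else 0#))
      indicator i true  = Homogeneous-resp (sym (*-identityʳ (t i))) (t-homogeneous i)
      indicator i false = Homogeneous-resp (sym (zeroʳ (t i))) 0#-homogeneous

      term : ∀ w → Homogeneous 1 ((t⊗ λ w → ⟨ w ∣ k ⟩) w)
      term (x ∷ w) = indicator x (does (w ≟ʷ word q k))

    ∂-cong : ∀ q {u v} → Pointwise _≈_ u v → Pointwise _≈_ (∂ q u) (∂ q v)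
    ∂-cong q u≈v k = sum-cong-≋ (λ l → *-congʳ (u≈v l))

    ∂-zero : ∀ q {v} → (∀ k → v k ≈ 0#) → ∀ k → ∂ q v k ≈ 0#
    ∂-zero q v≈0 k = trans (sum-cong-≋ {β (suc q)} (λ l → trans (*-congʳ (v≈0 l)) (zeroˡ _))) (sum-replicate-zero (β (suc q)))

    ∂-homogeneous : ∀ q {e v} → (∀ k → Homogeneous e (v k)) → ∀ k → Homogeneous (suc e) (∂ q v k)
    ∂-homogeneous q {e} {v} v∈ k = ≡.subst (λ d → Homogeneous d (∂ q v k)) (ℕ.+-comm e 1)
      (sum-homogeneous (λ l → *-homogeneous (v∈ l) (entry-homogeneous q k (word (suc q) l))))

    Twisted⇒Homogeneous : ∀ {i e x} → Twisted A i (i ℕ.+ e) x → Homogeneous e x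
    Twisted⇒Homogeneous {i} (inj₁ (e , i+e≡ , x∈)) = ≡.subst (λ e → Homogeneous e _) (ℕ.+-cancelˡ-≡ i _ _ i+e≡) x∈
    Twisted⇒Homogeneous     (inj₂ (_ , x≈0))       = Homogeneous-resp (sym x≈0) 0#-homogeneous

    Twisted-below : ∀ {i d x} → d ℕ.< i → Twisted A i d x → x ≈ 0#
    Twisted-below {i} d<i (inj₁ (e , ≡.refl , _)) = ⊥-elim (ℕ.<⇒≱ d<i (ℕ.m≤m+n i e))
    Twisted-below     d<i (inj₂ (_ , x≈0))        = x≈0

    ∂-graded : ∀ q {d} v → (∀ k → Twisted A (suc q) d (v k)) → ∀ k → Twisted A q d (∂ q v k)
    ∂-graded q {d} v v∈ k with suc q ℕ.≤? d
    ... | yes q<d with ℕ.m≤n⇒∃[o]m+o≡n q<d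
    ...   | e , ≡.refl = inj₁ (suc e , ℕ.+-suc q e , ∂-homogeneous q (λ k → Twisted⇒Homogeneous (v∈ k)) k)
    ∂-graded q {d} v v∈ k | no q≮d with ℕ.m≤n⇒m<n∨m≡n (ℕ.s≤s⁻¹ (ℕ.≰⇒> q≮d)) | ∂-zero q (λ k → Twisted-below (ℕ.≰⇒> q≮d) (v∈ k)) k
    ...   | inj₁ d<q    | ∂v≈0 = inj₂ (d<q , ∂v≈0)
    -- For `d = q` the source component is zero but the target component is the degree 0 part, so
    -- zero has to be presented as a homogeneous element.
    ...   | inj₂ ≡.refl | ∂v≈0 = inj₁ (0 , ℕ.+-identityʳ q , Homogeneous-resp (sym ∂v≈0) 0#-homogeneous)

    irrelevant-resp : ∀ {x y} → x ≈ y → x ∈ IrrelevantIdeal A → y ∈ IrrelevantIdeal A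
    irrelevant-resp x≈y (xs , xs∈ , x≈) = xs , xs∈ , trans (sym x≈y) x≈

    irrelevant-0 : ∀ {x} → x ≈ 0# → x ∈ IrrelevantIdeal A
    irrelevant-0 x≈0 = [] , [] , x≈0

    irrelevant-+ : ∀ {x y} → x ∈ IrrelevantIdeal A → y ∈ IrrelevantIdeal A → x + y ∈ IrrelevantIdeal A
    irrelevant-+ {y = y} (xs , xs∈ , x≈) (ys , ys∈ , y≈) =
      xs ++ ys , All.++⁺ xs∈ ys∈ , trans (+-cong x≈ y≈) (foldr-++ xs)
      where
      foldr-++ : ∀ xs → foldr _+_ 0# xs + foldr _+_ 0# ys ≈ foldr _+_ 0# (xs ++ ys)
      foldr-++ []       = +-identityˡ _
      foldr-++ (x ∷ xs) = trans (+-assoc x _ _) (+-congˡ (foldr-++ xs))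

    irrelevant-sum : ∀ {n} {f : Vector Carrier n} → (∀ i → f i ∈ IrrelevantIdeal A) → sum f ∈ IrrelevantIdeal A
    irrelevant-sum {zero}  f∈ = irrelevant-0 refl
    irrelevant-sum {suc n} f∈ = irrelevant-+ (f∈ zero) (irrelevant-sum (λ i → f∈ (suc i)))

    irrelevant-* : ∀ x {y} → Homogeneous 1 y → x * y ∈ IrrelevantIdeal A
    irrelevant-* x {y} y∈ with xs , xs∈ , x≈ ← decomposition x = irrelevant-resp (*-congʳ (sym x≈)) (go xs∈)
      where
      go : ∀ {xs} → All (λ x → ∃[ d ] Homogeneous d x) xs → foldr _+_ 0# xs * y ∈ IrrelevantIdeal A
      go []                           = irrelevant-0 (zeroˡ y)
      go {x ∷ xs} ((d , x∈) ∷ xs∈) = irrelevant-resp (sym (distribʳ y x _)) (irrelevant-+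
        ((x * y) ∷ [] , (d , ≡.subst (λ e → Homogeneous e (x * y)) (ℕ.+-comm d 1) (*-homogeneous x∈ y∈)) ∷ [] , sym (+-identityʳ _))
        (go xs∈))

    irrelevant-≈ : ∀ {x y} → x ≈ y → x - y ∈ IrrelevantIdeal A
    irrelevant-≈ {y = y} x≈y = irrelevant-0 (trans (+-congʳ x≈y) (-‿inverseʳ y))

    linearResolution : (∀ {x} → x ∈ IrrelevantIdeal A → lin positive x ≈ x) → LinearResolution A
    linearResolution positive-irrelevant = record
      { β            = β
      ; ∂            = ∂
      -- `β 0` computes to 1, the empty word being the only chain of length 0.
      ; ε            = λ v → v zero
      ; ∂-linear     = λ q → record
        { +ᴹ-isGroupHomomorphism = record
          { isMonoidHomomorphism = record
            { isMagmaHomomorphism = record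
              { isRelHomomorphism = record { cong = ∂-cong q }
              ; homo = λ u v k → trans
                  (sum-cong-≋ {β (suc q)} (λ l → distribʳ _ (u l) (v l)))
                  (∑-distrib-+ (λ l → u l * entry q k (word (suc q) l)) (λ l → v l * entry q k (word (suc q) l)))
              }
            ; ε-homo = ∂-zero q (λ _ → refl)
            }
          ; ⁻¹-homo = λ v k → trans
              (sum-cong-≋ {β (suc q)} (λ l → trans (sym (-‿distribˡ-* (v l) _)) (sym (-1*x≈-x _))))
              (trans (sym (*-distribˡ-sum (- 1#) (λ l → v l * entry q k (word (suc q) l)))) (-1*x≈-x _))
          }
        ; *ₗ-homo = λ x v k → trans
            (sum-cong-≋ {β (suc q)} (λ l → *-assoc x (v l) _))
            (sym (*-distribˡ-sum x (λ l → v l * entry q k (word (suc q) l))))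
        }
      ; ε-linear     = record
        { +ᴹ-isGroupHomomorphism = record
          { isMonoidHomomorphism = record
            { isMagmaHomomorphism = record
              { isRelHomomorphism = record { cong = λ u≈v → irrelevant-≈ (u≈v zero) }
              ; homo = λ u v → irrelevant-≈ refl
              }
            ; ε-homo = irrelevant-≈ refl
            }
          ; ⁻¹-homo = λ v → irrelevant-≈ refl
          }
        ; *ₗ-homo = λ x v → irrelevant-≈ refl
        }
      ; ∂-graded     = ∂-graded
      ; ε-graded     = λ v v∈ → v zero , Twisted⇒Homogeneous (v∈ zero) , irrelevant-≈ refl
      ; ε-surjective = λ y → (λ _ → y) , λ z≈y → irrelevant-≈ (z≈y zero)
      ; ε-exact      = λ v → mk⇔
          (λ v∈ → h 0 v , ∂h≈id v λ { zero → positive-irrelevant (irrelevant-resp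
            (trans (+-congˡ -0#≈0#) (+-identityʳ _)) v∈) })
          (λ (w , ∂w≈v) → irrelevant-resp
            (trans (∂w≈v zero) (sym (trans (+-congˡ -0#≈0#) (+-identityʳ _))))
            (irrelevant-sum (λ l → irrelevant-* (w l) (entry-homogeneous 0 zero (word 1 l)))))
      ; ∂-exact      = λ q v → mk⇔
          (λ ∂v≈0 → h (suc q) v , exact q v ∂v≈0)
          (λ (w , ∂w≈v) k → trans (∂-cong q (λ l → sym (∂w≈v l)) k) (∂∂≈0 q w k))
      }

module KoszulMonoidAlgebra {c ℓ m ℓm : Level} (K : CommutativeRing c ℓ)
  (M : CommutativeMonoid m ℓm) (_≟_ : Decidable (CommutativeMonoid._≈_ M))
  (deg : CommutativeMonoid.Carrier M → ℕ)
  (deg-isMonoidHomomorphism : MonoidMorphisms.IsMonoidHomomorphism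
    (CommutativeMonoid.rawMonoid M) ℕ.+-0-rawMonoid deg)
  (splitting : LetterSplitting M deg)
  where

  private
    module K = CommutativeRing K
    module M = CommutativeMonoid M
    module deg = MonoidMorphisms.IsMonoidHomomorphism deg-isMonoidHomomorphism
    A : GradedAlgebra K (c ⊔ m) (m ⊔ ℓ) (m ⊔ ℓ)
    A = GradedMonoidAlgebra.gradedAlgebra K M _≟_ deg deg-isMonoidHomomorphism
  open MonoidAlgebra K M _≟_ hiding (Carrier; commutativeRing)
  open LinearExtension K M _≟_
  open GradedAlgebra A hiding (zero)
  open LetterSplitting splitting
  open KoszulResolution A splitting isLinearExtension
  open ContractingHomotopy splitting commutativeRing isLinearExtension using (t; positive)

  monomial-homogeneous : ∀ q → Homogeneous (deg q) (monomial q)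
  monomial-homogeneous q p p≢q with p ≟ q
  ... | yes p≈q = ⊥-elim (p≢q (deg.⟦⟧-cong p≈q))
  ... | no _    = K.+-identityʳ _

  t-homogeneous : ∀ i → Homogeneous 1 (t i)
  t-homogeneous i = ≡.subst (λ d → Homogeneous d (t i)) (letter-deg i) (monomial-homogeneous (letter i))

  deg-merge : ∀ u i → deg (u M.∙ letter i) ≡ suc (deg u)
  deg-merge u i = ≡.trans (deg.homo u (letter i)) (≡.trans (≡.cong (deg u ℕ.+_) (letter-deg i)) (ℕ.+-comm (deg u) 1))

  deg≡0⇒ε : ∀ {p} → deg p ≡ 0 → p M.≈ M.ε
  deg≡0⇒ε {p} deg≡0 with split p | split-merge p
  ... | nothing      | p≈ = p≈
  ... | just (u , i) | p≈ with () ← ≡.trans (≡.sym deg≡0) (≡.trans (deg.⟦⟧-cong p≈) (deg-merge u i))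

  -- Coefficientwise, `positive` drops exactly those `r` without a last letter. They have degree 0,
  -- where a sum of elements of positive degree has coefficient zero.
  positive-irrelevant : ∀ {x} → x ∈ IrrelevantIdeal A → lin positive x ≈ x
  positive-irrelevant {x} (xs , xs∈ , x≈) = coeffwise λ r →
    K.trans (coeff-lin r positive x) (lemma r (split r) ≡.refl)
    where
    coeff-irrelevant : ∀ r → deg r ≡ 0 → ∀ {xs} → All (λ y → ∃[ d ] Homogeneous (suc d) y) xs → coeff r (foldr _+_ 0# xs) K.≈ K.0#
    coeff-irrelevant r r≡0 []                     = K.refl
    coeff-irrelevant r r≡0 {y ∷ ys} ((d , y∈) ∷ ys∈) = K.trans (coeff-++ r y (foldr _+_ 0# ys))
      (K.trans (K.+-cong (y∈ r (λ r≡ → ℕ.0≢1+n (≡.trans (≡.sym r≡0) r≡))) (coeff-irrelevant r r≡0 ys∈)) (K.+-identityˡ _))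

    lemma : ∀ r s → split r ≡ s → ∫ (λ p → coeff r (positive p)) x K.≈ coeff r x
    lemma r nothing r↦ = K.trans (K.trans (∫-cong off x) (∫-zero x))
      (K.sym (K.trans (coeff-≈ x≈ r) (coeff-irrelevant r deg-r xs∈)))
      where
      deg-r : deg r ≡ 0
      deg-r = ≡.trans (deg.⟦⟧-cong (≡.subst (λ s → r M.≈ merge s) r↦ (split-merge r))) deg.ε-homo
      off : ∀ p → coeff r (positive p) K.≈ K.0#
      off p with split p | split-cong {p} {r}
      ... | nothing | _ = K.refl
      ... | just _  | p≈r⇒ with r ≟ p
      ...   | no _    = K.+-identityʳ _
      ...   | yes r≈p with () ← ≡.subst (_ ≈ˢ_) r↦ (p≈r⇒ (M.sym r≈p))
    lemma r (just s) r↦ = K.trans (∫-cong on x) (K.sym (coeff-∫ r x))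
      where
      on : ∀ p → coeff r (positive p) K.≈ δ r p
      on p with split p | split-cong {p} {r}
      ... | just _  | _ = coeff-monomial r p
      ... | nothing | p≈r⇒ with r ≟ p
      ...   | no _    = K.refl
      ...   | yes r≈p with () ← ≡.subst (_ ≈ˢ_) r↦ (p≈r⇒ (M.sym r≈p))

  generators : List Carrier
  generators = List.map t (allFin size)

  open Membership setoid using () renaming (_∈_ to _∈ᴸ_)

  -- Induction on the degree, removing the last letter.
  adjoin-monomial : ∀ d p → deg p ≡ d → Adjoin A (_∈ᴸ generators) (monomial p)
  adjoin-monomial d p p≡d with split p | split-merge p
  ... | nothing      | p≈ = resp (monomial-cong (M.sym p≈)) (constant K.1#)
  adjoin-monomial zero    p p≡d | just (u , i) | p≈ with () ← ≡.trans (≡.sym p≡d) (≡.trans (deg.⟦⟧-cong p≈) (deg-merge u i))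
  adjoin-monomial (suc d) p p≡d | just (u , i) | p≈ =
    resp (trans (sym (monomial-∙ u (letter i))) (monomial-cong (M.sym p≈))) (times
      (adjoin-monomial d u (ℕ.suc-injective (≡.trans (≡.sym (≡.trans (deg.⟦⟧-cong p≈) (deg-merge u i))) p≡d)))
      (generator (Any.map reflexive (∈-map⁺ t (∈-allFin i)))))

  adjoin : ∀ f → Adjoin A (_∈ᴸ generators) f
  adjoin []            = resp (coeffwise λ r → if-0 (does (r ≟ M.ε))) (constant K.0#)
    where
    if-0 : ∀ b → (if b then K.0# else K.0#) K.+ K.0# K.≈ K.0#
    if-0 true  = K.+-identityˡ _
    if-0 false = K.+-identityˡ _
  adjoin ((c , p) ∷ f) = resp term (plus (times (constant c) (adjoin-monomial (deg p) p ≡.refl)) (adjoin f))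
    where
    if-cong : ∀ b {c d} → c K.≈ d → (if b then c else K.0#) K.≈ (if b then d else K.0#)
    if-cong true  e = e
    if-cong false e = K.refl
    term : scalar c * monomial p + f ≈ (c , p) ∷ f
    term = trans (+-congʳ {f} {scalar c * monomial p} {(c , M.ε M.∙ p) ∷ []} (coeffwise λ r → K.+-congʳ (if-cong (does (r ≟ (M.ε M.∙ p))) (K.*-identityʳ c))))
                 (+-congʳ {f} {(c , M.ε M.∙ p) ∷ []} {(c , p) ∷ []} (term-cong c (M.identityˡ p)))

  isStandardGraded : IsStandardGraded A
  isStandardGraded = record
    { algebraMap-injective  = λ {c} {d} c≈d → K.trans (K.sym (coeff-scalar c)) (K.trans (coeff-≈ c≈d M.ε) (coeff-scalar d))
    ; algebraMap-onto       = λ {f} f∈ → coeff M.ε f , coeffwise λ r → onto f f∈ r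
    ; generators            = generators
    ; generators-degree-one = All.map⁺ (All.universal t-homogeneous (allFin size))
    ; generates             = adjoin
    }
    where
    coeff-scalar : ∀ c → coeff M.ε (scalar c) K.≈ c
    coeff-scalar c with M.ε ≟ M.ε
    ... | yes _  = K.+-identityʳ c
    ... | no ε≉ε = ⊥-elim (ε≉ε M.refl)

    onto : ∀ f → Homogeneous 0 f → ∀ r → coeff r f K.≈ coeff r (scalar (coeff M.ε f))
    onto f f∈ r with r ≟ M.ε
    ... | yes r≈ε = K.trans (K.trans (coeff-∫ r f) (K.trans (∫-cong (λ p → δ-congˡ r≈ε p) f) (K.sym (coeff-∫ M.ε f)))) (K.sym (K.+-identityʳ _))
      where
      δ-congˡ : ∀ {r s} → r M.≈ s → ∀ p → δ r p K.≈ δ s p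
      δ-congˡ {r} {s} r≈s p with r ≟ p | s ≟ p
      ... | yes _   | yes _   = K.refl
      ... | no _    | no _    = K.refl
      ... | yes r≈p | no s≉p  = ⊥-elim (s≉p (M.trans (M.sym r≈s) r≈p))
      ... | no r≉p  | yes s≈p = ⊥-elim (r≉p (M.trans r≈s s≈p))
    ... | no r≉ε = K.trans (f∈ r (λ r≡0 → r≉ε (deg≡0⇒ε r≡0))) (K.sym (K.+-identityʳ _))

  isKoszul : IsKoszul A
  isKoszul = record
    { isStandardGraded = isStandardGraded
    ; linearResolution = linearResolution t-homogeneous positive-irrelevant
    }

-- Paths as vectors of integral partial sums

snoc : ∀ {a} {A : Set a} {n} → Vector A n → A → Vector A (suc n)
snoc {n = zero}  f x _       = x
snoc {n = suc n} f x zero    = f zero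
snoc {n = suc n} f x (suc k) = snoc (λ j → f (suc j)) x k

snoc-inject₁ : ∀ {a} {A : Set a} {n} (f : Vector A n) x j → snoc f x (inject₁ j) ≡ f j
snoc-inject₁ f x zero    = ≡.refl
snoc-inject₁ f x (suc j) = snoc-inject₁ (λ j → f (suc j)) x j

snoc-fromℕ : ∀ {a} {A : Set a} n (f : Vector A n) x → snoc f x (fromℕ n) ≡ x
snoc-fromℕ zero    f x = ≡.refl
snoc-fromℕ (suc n) f x = snoc-fromℕ n (λ j → f (suc j)) x

snoc⁺ : ∀ {a p} {A : Set a} (P : A → Set p) {n} {f : Vector A n} {x} → (∀ j → P (f j)) → P x → ∀ k → P (snoc f x k)
snoc⁺ P {zero}  Pf Px _       = Px
snoc⁺ P {suc n} Pf Px zero    = Pf zero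
snoc⁺ P {suc n} Pf Px (suc k) = snoc⁺ P (λ j → Pf (suc j)) Px k

module Fractions where

  open import Data.Integer.Base using (+_)

  infixl 7 _÷_
  -- A fraction is kept as a product with `1 / d`, the shape in which lattice coefficients occur. It
  -- is opaque so that only cross multiplication is used and the normalisation of rationals never
  -- unfolds.
  opaque
    _÷_ : ℤ → (d : ℕ) → .{{NonZero d}} → ℚ
    z ÷ d = (z / 1) ℚ.* (+ 1 / d)

    ÷-toℚᵘ : ∀ z d → toℚᵘ (z ÷ suc d) ℚᵘ.≃ mkℚᵘ z d
    ÷-toℚᵘ z d = ℚᵘ.≃-trans (ℚ.toℚᵘ-homo-* (z / 1) (+ 1 / suc d)) (ℚᵘ.≃-trans
      (ℚᵘ.*-cong (ℚ.toℚᵘ-fromℚᵘ (mkℚᵘ z 0)) (ℚ.toℚᵘ-fromℚᵘ (mkℚᵘ (+ 1) d)))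
      (*≡* (≡.cong₂ ℤ._*_ (ℤ.*-identityʳ z) (≡.cong +_ (≡.sym (ℕ.+-identityʳ (suc d)))))))

    ÷-nonNeg : ∀ z d .{{_ : NonZero d}} → 0ℚ ℚ.≤ z ÷ d → + ℤ.∣ z ∣ ≡ z
    ÷-nonNeg z (suc d) 0≤ with *≤* p ← ℚᵘ.≤-respʳ-≃ (÷-toℚᵘ z d) (ℚ.toℚᵘ-mono-≤ 0≤) =
      ℤ.0≤i⇒+∣i∣≡i (≡.subst (ℤ.0ℤ ℤ.≤_) (ℤ.*-identityʳ z) p)

    ÷-mono : ∀ m d m′ d′ .{{_ : NonZero d}} .{{_ : NonZero d′}} → m ℕ.* d′ ℕ.≤ m′ ℕ.* d → + m ÷ d ℚ.≤ + m′ ÷ d′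
    ÷-mono m (suc d) m′ (suc d′) le = ℚ.toℚᵘ-cancel-≤
      (ℚᵘ.≤-respˡ-≃ (ℚᵘ.≃-sym (÷-toℚᵘ (+ m) d)) (ℚᵘ.≤-respʳ-≃ (ℚᵘ.≃-sym (÷-toℚᵘ (+ m′) d′))
        (*≤* (≡.subst₂ ℤ._≤_ (ℤ.pos-* m (suc d′)) (ℤ.pos-* m′ (suc d)) (ℤ.+≤+ le)))))

    ÷-cancel : ∀ m d m′ d′ .{{_ : NonZero d}} .{{_ : NonZero d′}} → + m ÷ d ℚ.≤ + m′ ÷ d′ → m ℕ.* d′ ℕ.≤ m′ ℕ.* d
    ÷-cancel m (suc d) m′ (suc d′) le with *≤* p ← ℚᵘ.≤-respˡ-≃ (÷-toℚᵘ (+ m) d) (ℚᵘ.≤-respʳ-≃ (÷-toℚᵘ (+ m′) d′) (ℚ.toℚᵘ-mono-≤ le)) =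
      ℤ.drop‿+≤+ (≡.subst₂ ℤ._≤_ (≡.sym (ℤ.pos-* m (suc d′))) (≡.sym (ℤ.pos-* m′ (suc d))) p)

    ÷-+ : ∀ m m′ d .{{_ : NonZero d}} → + (m ℕ.+ m′) ÷ d ≡ + m ÷ d ℚ.+ + m′ ÷ d
    ÷-+ m m′ d = ≡.trans (≡.cong (ℚ._* (+ 1 / d)) /1-+) (ℚ.*-distribʳ-+ (+ 1 / d) (+ m / 1) (+ m′ / 1))
      where
      /1-+ : + (m ℕ.+ m′) / 1 ≡ (+ m / 1) ℚ.+ (+ m′ / 1)
      /1-+ = ℚ.toℚᵘ-injective (ℚᵘ.≃-trans (ℚ.toℚᵘ-fromℚᵘ (mkℚᵘ (+ (m ℕ.+ m′)) 0)) (ℚᵘ.≃-trans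
        (*≡* (≡.cong (ℤ._* (+ 1)) (≡.sym (≡.cong₂ ℤ._+_ (ℤ.*-identityʳ (+ m)) (ℤ.*-identityʳ (+ m′))))))
        (ℚᵘ.≃-sym (ℚᵘ.≃-trans (ℚ.toℚᵘ-homo-+ (+ m / 1) (+ m′ / 1))
          (ℚᵘ.+-cong (ℚ.toℚᵘ-fromℚᵘ (mkℚᵘ (+ m) 0)) (ℚ.toℚᵘ-fromℚᵘ (mkℚᵘ (+ m′) 0)))))))

    0÷≡0 : ∀ d .{{_ : NonZero d}} → + 0 ÷ d ≡ 0ℚ
    0÷≡0 d = ℚ.*-zeroˡ (+ 1 / d)

    ÷-def : ∀ z d .{{_ : NonZero d}} → z ÷ d ≡ (z / 1) ℚ.* (+ 1 / d)
    ÷-def z d = ≡.refl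

  p-q≡0⇒p≡q : ∀ p q → p ℚ.- q ≡ 0ℚ → p ≡ q
  p-q≡0⇒p≡q p q eq = begin
    p                ≡⟨ solve 2 (λ p q → p := (p :- q) :+ q) ≡.refl p q ⟩
    (p ℚ.- q) ℚ.+ q  ≡⟨ ≡.cong (ℚ._+ q) eq ⟩
    0ℚ ℚ.+ q         ≡⟨ ℚ.+-identityˡ q ⟩
    q                ∎
    where
    open ≡-Reasoning
    open ℚSolver.+-*-Solver

prev : ∀ {n} → Vector ℚ (suc n) → Vector ℚ (suc n)
prev S zero    = 0ℚ
prev S (suc k) = S (inject₁ k)

prev-cong : ∀ {n} {S T : Vector ℚ (suc n)} → S ≗ T → prev S ≗ prev T
prev-cong S≗T zero    = ≡.refl
prev-cong S≗T (suc k) = S≗T (inject₁ k)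

module _ where
  open SemiringSum (CommutativeRing.semiring ℚ.+-*-commutativeRing) using (sum; sum-cong-≗; sum-replicate-zero)
  open ℚSolver.+-*-Solver
  open ≡-Reasoning

  δℚ : ∀ {n} → Fin n → Fin n → ℚ
  δℚ i k = if does (i Fin.≟ k) then 1ℚ else 0ℚ

  -- Summation by parts: the coefficients with respect to `e_j - e_{j+1}` and the last basis vector
  -- are the partial sums of the coordinates.
  differences : ∀ {n} (s : Vector ℚ n) s′ k →
    sum (λ j → s j ℚ.* (δℚ (inject₁ j) k ℚ.- δℚ (suc j) k)) ℚ.+ s′ ℚ.* δℚ (fromℕ n) k ≡ snoc s s′ k ℚ.- prev (snoc s s′) k
  differences {zero} s s′ zero = solve 1 (λ x → con 0ℚ :+ x :* con 1ℚ := x :- con 0ℚ) ≡.refl s′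
  differences {suc n} s s′ zero = begin
    (s zero ℚ.* 1ℚ ℚ.+ sum (λ j → s (suc j) ℚ.* 0ℚ)) ℚ.+ s′ ℚ.* 0ℚ
      ≡⟨ ≡.cong (λ x → (s zero ℚ.* 1ℚ ℚ.+ x) ℚ.+ s′ ℚ.* 0ℚ)
           (≡.trans (sum-cong-≗ (λ j → ℚ.*-zeroʳ (s (suc j)))) (sum-replicate-zero n)) ⟩
    (s zero ℚ.* 1ℚ ℚ.+ 0ℚ) ℚ.+ s′ ℚ.* 0ℚ
      ≡⟨ solve 2 (λ x y → (x :* con 1ℚ :+ con 0ℚ) :+ y :* con 0ℚ := x :- con 0ℚ) ≡.refl (s zero) s′ ⟩
    s zero ℚ.- 0ℚ ∎
  differences {suc n} s s′ (suc k) = begin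
    (s zero ℚ.* (0ℚ ℚ.- δℚ zero k) ℚ.+ Σ) ℚ.+ s′ ℚ.* δℚ (fromℕ n) k
      ≡⟨ ℚ.+-assoc (s zero ℚ.* (0ℚ ℚ.- δℚ zero k)) Σ (s′ ℚ.* δℚ (fromℕ n) k) ⟩
    s zero ℚ.* (0ℚ ℚ.- δℚ zero k) ℚ.+ (Σ ℚ.+ s′ ℚ.* δℚ (fromℕ n) k)
      ≡⟨ ≡.cong (s zero ℚ.* (0ℚ ℚ.- δℚ zero k) ℚ.+_) (differences s₊ s′ k) ⟩
    s zero ℚ.* (0ℚ ℚ.- δℚ zero k) ℚ.+ (snoc s₊ s′ k ℚ.- prev (snoc s₊ s′) k)
      ≡⟨ shift k ⟩
    snoc s₊ s′ k ℚ.- snoc s s′ (inject₁ k) ∎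
    where
    s₊ : Vector ℚ n
    s₊ j = s (suc j)
    Σ : ℚ
    Σ = sum (λ j → s₊ j ℚ.* (δℚ (inject₁ j) k ℚ.- δℚ (suc j) k))
    shift : ∀ k → s zero ℚ.* (0ℚ ℚ.- δℚ zero k) ℚ.+ (snoc s₊ s′ k ℚ.- prev (snoc s₊ s′) k) ≡
                  snoc s₊ s′ k ℚ.- snoc s s′ (inject₁ k)
    shift zero    = solve 2 (λ x y → x :* (con 0ℚ :- con 1ℚ) :+ (y :- con 0ℚ) := y :- x) ≡.refl (s zero) (snoc s₊ s′ zero)
    shift (suc k) = solve 3 (λ x y z → x :* (con 0ℚ :- con 0ℚ) :+ (y :- z) := y :- z) ≡.refl
                      (s zero) (snoc s₊ s′ (suc k)) (snoc s₊ s′ (inject₁ k))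

-- A path is encoded by the numbers b_k (a_1 + ⋯ + a_k), where b_{n+1} = 1: membership in L(b)
-- says that they are integers, and positivity that the fractions height k / B k increase.
module Heights (n : ℕ) (b : Fin n → ℕ) (b>0 : ∀ j → NonZero (b j)) where

  open import Data.Integer.Base using (+_)
  open Fractions
  open LSPaths n b b>0
  open SemiringSum (CommutativeRing.semiring ℚ.+-*-commutativeRing) using (sum; sum-cong-≗)

  B : Fin (suc n) → ℕ
  B = snoc b 1

  instance
    B>0 : ∀ {k} → NonZero (B k)
    B>0 = snoc⁺ NonZero b>0 _ _

  B-last : B (fromℕ n) ≡ 1
  B-last = snoc-fromℕ n b 1

  ratio : Vector ℤ (suc n) → Vector ℚ (suc n)
  ratio z k = z k ÷ B k

  ÷-cong : ∀ {z z′ d d′} .{{_ : NonZero d}} .{{_ : NonZero d′}} → z ≡ z′ → d ≡ d′ → z ÷ d ≡ z′ ÷ d′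
  ÷-cong ≡.refl ≡.refl = ≡.refl

  snoc-ratio : ∀ (z : Vector ℤ n) z′ → snoc (λ j → (z j / 1) ℚ.* 1/b j) (z′ / 1) ≗ ratio (snoc z z′)
  snoc-ratio z z′ k with view k
  ... | ‵fromℕ     = ≡.trans (snoc-fromℕ n _ _) (≡.trans (≡.sym (≡.trans (÷-def z′ 1) (ℚ.*-identityʳ (z′ / 1))))
    (÷-cong (≡.sym (snoc-fromℕ n z z′)) (≡.sym B-last)))
  ... | ‵inject₁ j = ≡.trans (snoc-inject₁ _ _ j) (≡.trans (≡.sym (÷-def (z j) (b j) {{b>0 j}}))
    (÷-cong {{b>0 j}} (≡.sym (snoc-inject₁ z z′ j)) (≡.sym (snoc-inject₁ b 1 j))))

  lattice-differences : ∀ (z : Vector ℤ n) z′ k → sum (λ j → (z j / 1) ℚ.* v j k) ℚ.+ (z′ / 1) ℚ.* v-last k ≡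
                        ratio (snoc z z′) k ℚ.- prev (ratio (snoc z z′)) k
  lattice-differences z z′ k = begin
    sum (λ j → (z j / 1) ℚ.* v j k) ℚ.+ (z′ / 1) ℚ.* v-last k
      ≡⟨ ≡.cong (ℚ._+ (z′ / 1) ℚ.* v-last k) (sum-cong-≗ (λ j →
           solve 3 (λ x y c → x :* (y :* c) := (x :* c) :* y) ≡.refl (z j / 1) (e (inject₁ j) k ℚ.- e (suc j) k) (1/b j))) ⟩
    sum (λ j → ((z j / 1) ℚ.* 1/b j) ℚ.* (e (inject₁ j) k ℚ.- e (suc j) k)) ℚ.+ (z′ / 1) ℚ.* v-last k
      ≡⟨ differences (λ j → (z j / 1) ℚ.* 1/b j) (z′ / 1) k ⟩
    snoc (λ j → (z j / 1) ℚ.* 1/b j) (z′ / 1) k ℚ.- prev (snoc (λ j → (z j / 1) ℚ.* 1/b j) (z′ / 1)) k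
      ≡⟨ ≡.cong₂ ℚ._-_ (snoc-ratio z z′ k) (prev-cong (snoc-ratio z z′) k) ⟩
    ratio (snoc z z′) k ℚ.- prev (ratio (snoc z z′)) k ∎
    where
    open ≡-Reasoning
    open ℚSolver.+-*-Solver

  integral : LSPath → Vector ℤ (suc n)
  integral π = snoc (proj₁ (inLattice π)) (proj₁ (proj₂ (inLattice π)))

  -- Taking absolute values loses nothing: partial sums of a path are non-negative, as
  -- `partial-height` records.
  opaque
    height : LSPath → Vector ℕ (suc n)
    height π k = ℤ.∣ integral π k ∣

    height-integral : ∀ π k → height π k ≡ ℤ.∣ integral π k ∣
    height-integral π k = ≡.refl

  height-last : ∀ π → height π (fromℕ n) ≡ deg π
  height-last π = ≡.trans (height-integral π (fromℕ n)) (≡.cong ℤ.∣_∣ (snoc-fromℕ n (proj₁ (inLattice π)) _))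

  private
    partial : LSPath → Vector ℚ (suc n)
    partial π = ratio (integral π)

    coord-partial : ∀ π k → coord π k ≡ partial π k ℚ.- prev (partial π) k
    coord-partial π k = ≡.trans (proj₂ (proj₂ (inLattice π)) k) (lattice-differences _ _ k)

    partial-coord : ∀ π k → partial π k ≡ coord π k ℚ.+ prev (partial π) k
    partial-coord π k = ≡.trans
      (solve 2 (λ x y → x := (x :- y) :+ y) ≡.refl (partial π k) (prev (partial π) k))
      (≡.cong (ℚ._+ prev (partial π) k) (≡.sym (coord-partial π k)))
      where open ℚSolver.+-*-Solver

    partial-step : ∀ π k → prev (partial π) k ℚ.≤ partial π k
    partial-step π k = ℚ.≤-trans (ℚ.≤-reflexive (≡.sym (ℚ.+-identityˡ _)))
      (ℚ.≤-trans (ℚ.+-monoˡ-≤ (prev (partial π) k) (coord≥0 π k)) (ℚ.≤-reflexive (≡.sym (partial-coord π k))))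

    partial-nonNeg : ∀ π k → 0ℚ ℚ.≤ partial π k
    partial-nonNeg π = Fin.<-weakInduction _ (partial-step π zero) (λ j 0≤ → ℚ.≤-trans 0≤ (partial-step π (suc j)))

    partial-height : ∀ π k → partial π k ≡ + height π k ÷ B k
    partial-height π k = ≡.cong (_÷ B k) (≡.sym (≡.trans (≡.cong +_ (height-integral π k))
      (÷-nonNeg (integral π k) (B k) (partial-nonNeg π k))))

    ÷-injective : ∀ {m m′ d} .{{_ : NonZero d}} → + m ÷ d ≡ + m′ ÷ d → m ≡ m′
    ÷-injective {m} {m′} {d} eq = ℕ.*-cancelʳ-≡ m m′ d (ℕ.≤-antisym
      (÷-cancel m d m′ d (ℚ.≤-reflexive eq)) (÷-cancel m′ d m d (ℚ.≤-reflexive (≡.sym eq))))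

  Monotone : Vector ℕ (suc n) → Set
  Monotone Z = ∀ j → Z (inject₁ j) ℕ.* B (suc j) ℕ.≤ Z (suc j) ℕ.* B (inject₁ j)

  height-monotone : ∀ π → Monotone (height π)
  height-monotone π j = ÷-cancel _ (B (inject₁ j)) _ (B (suc j))
    (≡.subst₂ ℚ._≤_ (partial-height π (inject₁ j)) (partial-height π (suc j)) (partial-step π (suc j)))

  partial-cong : ∀ {π η} → π ≈ᴾ η → ∀ k → partial π k ≡ partial η k
  partial-cong {π} {η} π≈η = Fin.<-weakInduction _ (step zero ≡.refl) (λ j eq → step (suc j) eq)
    where
    step : ∀ k → prev (partial π) k ≡ prev (partial η) k → partial π k ≡ partial η k
    step k eq = ≡.trans (partial-coord π k) (≡.trans (≡.cong₂ ℚ._+_ (π≈η k) eq) (≡.sym (partial-coord η k)))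

  -- Heights are read off the lattice coefficients stored in a path, which `≈ᴾ` ignores. The
  -- coordinates determine the partial sums, and these determine the coefficients.
  height-cong : ∀ {π η} → π ≈ᴾ η → height π ≗ height η
  height-cong {π} {η} π≈η k = ÷-injective {d = B k}
    (≡.trans (≡.sym (partial-height π k)) (≡.trans (partial-cong {π} {η} π≈η k) (partial-height η k)))

  height-injective : ∀ {π η} → height π ≗ height η → π ≈ᴾ η
  height-injective {π} {η} Zπ≗Zη k = ≡.trans (coord-partial π k) (≡.trans
    (≡.cong₂ ℚ._-_ (partials k) (prev-cong partials k)) (≡.sym (coord-partial η k)))
    where
    partials : partial π ≗ partial η
    partials k = ≡.trans (partial-height π k) (≡.trans (≡.cong (λ m → + m ÷ B k) (Zπ≗Zη k)) (≡.sym (partial-height η k)))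

  height-+ : ∀ π η k → height (π +ᴾ η) k ≡ height π k ℕ.+ height η k
  height-+ π η k = ÷-injective {d = B k} (begin
    + height (π +ᴾ η) k ÷ B k                   ≡⟨ partial-height (π +ᴾ η) k ⟨
    partial (π +ᴾ η) k                          ≡⟨ partial-+ k ⟩
    partial π k ℚ.+ partial η k                 ≡⟨ ≡.cong₂ ℚ._+_ (partial-height π k) (partial-height η k) ⟩
    + height π k ÷ B k ℚ.+ + height η k ÷ B k   ≡⟨ ÷-+ (height π k) (height η k) (B k) ⟨
    + (height π k ℕ.+ height η k) ÷ B k         ∎)
    where
    open ≡-Reasoning
    step : ∀ k → prev (partial (π +ᴾ η)) k ≡ prev (partial π) k ℚ.+ prev (partial η) k →
           partial (π +ᴾ η) k ≡ partial π k ℚ.+ partial η k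
    step k eq = begin
      partial (π +ᴾ η) k                                          ≡⟨ partial-coord (π +ᴾ η) k ⟩
      (coord π k ℚ.+ coord η k) ℚ.+ prev (partial (π +ᴾ η)) k     ≡⟨ ≡.cong ((coord π k ℚ.+ coord η k) ℚ.+_) eq ⟩
      (coord π k ℚ.+ coord η k) ℚ.+ (prev (partial π) k ℚ.+ prev (partial η) k)
        ≡⟨ solve 4 (λ x y z w → (x :+ y) :+ (z :+ w) := (x :+ z) :+ (y :+ w)) ≡.refl (coord π k) (coord η k) (prev (partial π) k) (prev (partial η) k) ⟩
      (coord π k ℚ.+ prev (partial π) k) ℚ.+ (coord η k ℚ.+ prev (partial η) k)
        ≡⟨ ≡.cong₂ ℚ._+_ (partial-coord π k) (partial-coord η k) ⟨
      partial π k ℚ.+ partial η k ∎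
      where open ℚSolver.+-*-Solver
    partial-+ : ∀ k → partial (π +ᴾ η) k ≡ partial π k ℚ.+ partial η k
    partial-+ = Fin.<-weakInduction _ (step zero ≡.refl) (λ j eq → step (suc j) eq)

  private
    snoc-η : ∀ {a} {A : Set a} {m} (f : Vector A (suc m)) → snoc (λ j → f (inject₁ j)) (f (fromℕ m)) ≗ f
    snoc-η {m = zero}  f zero    = ≡.refl
    snoc-η {m = suc m} f zero    = ≡.refl
    snoc-η {m = suc m} f (suc k) = snoc-η (λ j → f (suc j)) k

  opaque
    fromHeight : ∀ Z → Monotone Z → LSPath
    fromHeight Z mono = record
      { coord     = λ k → ratio (λ k → + Z k) k ℚ.- prev (ratio (λ k → + Z k)) k
      ; inLattice = (λ j → + Z (inject₁ j)) , + Z (fromℕ n) , λ k → ≡.sym (≡.trans (lattice-differences _ _ k)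
          (≡.cong₂ ℚ._-_ (ratio-η k) (prev-cong ratio-η k)))
      ; coord≥0   = λ k → ℚ.≤-trans (ℚ.≤-reflexive (≡.sym (ℚ.+-inverseʳ (prev (ratio (λ k → + Z k)) k)))) (ℚ.+-monoˡ-≤ (ℚ.- prev (ratio (λ k → + Z k)) k) (step k))
      }
      where
      ratio-η : ratio (snoc (λ j → + Z (inject₁ j)) (+ Z (fromℕ n))) ≗ ratio (λ k → + Z k)
      ratio-η k = ≡.cong (_÷ B k) (snoc-η (λ k → + Z k) k)

      step : ∀ k → prev (ratio (λ k → + Z k)) k ℚ.≤ ratio (λ k → + Z k) k
      step zero    = ≡.subst (ℚ._≤ + Z zero ÷ B zero) (0÷≡0 1) (÷-mono 0 1 (Z zero) (B zero) ℕ.z≤n)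
      step (suc j) = ÷-mono (Z (inject₁ j)) (B (inject₁ j)) (Z (suc j)) (B (suc j)) (mono j)

    height-fromHeight : ∀ Z mono → height (fromHeight Z mono) ≗ Z
    height-fromHeight Z mono k = ≡.trans (height-integral _ k) (≡.cong ℤ.∣_∣ (snoc-η (λ k → + Z k) k))

    deg-fromHeight : ∀ Z mono → deg (fromHeight Z mono) ≡ Z (fromℕ n)
    deg-fromHeight Z mono = ≡.refl

  partial-mono : ∀ π {j k} → j Fin.≤ k → partial π j ℚ.≤ partial π k
  partial-mono π {j} j≤k = Fin.<-weakInduction-startingFrom (λ k → partial π j ℚ.≤ partial π k) ℚ.≤-refl
    (λ k le → ℚ.≤-trans le (partial-step π (suc k))) j≤k

  height-mono : ∀ π {j k} → j Fin.≤ k → height π j ℕ.* B k ℕ.≤ height π k ℕ.* B j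
  height-mono π {j} {k} j≤k = ÷-cancel _ (B j) _ (B k)
    (≡.subst₂ ℚ._≤_ (partial-height π j) (partial-height π k) (partial-mono π j≤k))

  height≤deg*B : ∀ π k → height π k ℕ.≤ deg π ℕ.* B k
  height≤deg*B π k = ≡.subst₂ ℕ._≤_
    (≡.trans (≡.cong (height π k ℕ.*_) B-last) (ℕ.*-identityʳ _)) (≡.cong (ℕ._* B k) (height-last π))
    (height-mono π (Fin.≤fromℕ k))

  -- If `height η k` is not 0, some `j ≤ k` lies in the support of `η`. The support of `π` then ends
  -- at or before `k`, so its partial sum at `k` is already the total 1.
  ⊴⇒ : ∀ {π η} → deg π ≡ 1 → π ⊴ η → ∀ k → height π k ≡ B k ⊎ height η k ≡ 0
  ⊴⇒ {π} {η} π∈ π⊴η k with height π k ℕ.≟ B k | height η k ℕ.≟ 0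
  ... | yes eq | _      = inj₁ eq
  ... | no _   | yes eq = inj₂ eq
  ... | no π≢  | no η≢  = ⊥-elim (π≢ (≡.sym full))
    where
    nonempty : ∀ k → height η k ≢ 0 → ∃[ j ] j Fin.≤ k × j ∈ supp η
    nonempty k ηk≢0 with Fin.any? (λ j → (j Fin.≤? k) ×-dec ¬? (coord η j ℚ.≟ 0ℚ))
    ... | yes (j , j≤k , j∈) = j , j≤k , j∈
    ... | no none = ⊥-elim (ηk≢0 (÷-injective {d = B k} (≡.trans (≡.sym (partial-height η k)) (≡.trans (empty k ℕ.≤-refl) (≡.sym (0÷≡0 (B k)))))))
      where
      zero-coord : ∀ j → j Fin.≤ k → coord η j ≡ 0ℚ
      zero-coord j j≤k with coord η j ℚ.≟ 0ℚ
      ... | yes eq = eq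
      ... | no neq = ⊥-elim (none (j , j≤k , neq))
      empty : ∀ j → j Fin.≤ k → partial η j ≡ 0ℚ
      empty = Fin.<-weakInduction _
        (λ 0≤k → ≡.trans (partial-coord η zero) (≡.trans (ℚ.+-identityʳ _) (zero-coord zero 0≤k)))
        (λ j ih sj≤k → ≡.trans (partial-coord η (suc j)) (≡.cong₂ ℚ._+_ (zero-coord (suc j) sj≤k)
          (ih (≡.subst (ℕ._≤ toℕ k) (≡.sym (Fin.toℕ-inject₁ j)) (ℕ.<⇒≤ sj≤k)))))
    saturated : ∀ i → k Fin.≤ i → partial π i ≡ partial π k
    saturated i k≤i = Fin.<-weakInduction-startingFrom (λ i → k Fin.≤ i → partial π i ≡ partial π k) (λ _ → ≡.refl)
      next k≤i k≤i
      where
      next : ∀ i → (k Fin.≤ inject₁ i → partial π (inject₁ i) ≡ partial π k) → k Fin.≤ suc i → partial π (suc i) ≡ partial π k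
      next i ih k≤si with ℕ.m≤n⇒m<n∨m≡n k≤si
      ... | inj₂ k≡si = ≡.cong (partial π) (≡.sym (Fin.toℕ-injective k≡si))
      ... | inj₁ k<si with coord π (suc i) ℚ.≟ 0ℚ
      ...   | yes eq = ≡.trans (partial-coord π (suc i)) (≡.trans (≡.cong (ℚ._+ partial π (inject₁ i)) eq)
                (≡.trans (ℚ.+-identityˡ _) (ih (≡.subst (toℕ k ℕ.≤_) (≡.sym (Fin.toℕ-inject₁ i)) (ℕ.s≤s⁻¹ k<si)))))
      ...   | no neq with j , j≤k , j∈ ← nonempty k η≢ = ⊥-elim (ℕ.<⇒≱ k<si (ℕ.≤-trans (π⊴η neq j∈) j≤k))

    full : B k ≡ height π k
    full = ÷-injective {d = B k} (begin
      + B k ÷ B k                        ≡⟨ one (B k) ⟩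
      1ℚ                                 ≡⟨ one (B (fromℕ n)) ⟨
      + B (fromℕ n) ÷ B (fromℕ n)        ≡⟨ ≡.cong (λ m → + m ÷ B (fromℕ n)) (≡.trans B-last (≡.sym (≡.trans (height-last π) π∈))) ⟩
      + height π (fromℕ n) ÷ B (fromℕ n) ≡⟨ partial-height π (fromℕ n) ⟨
      partial π (fromℕ n)                ≡⟨ saturated (fromℕ n) (Fin.≤fromℕ k) ⟩
      partial π k                        ≡⟨ partial-height π k ⟩
      + height π k ÷ B k                 ∎)
      where
      open ≡-Reasoning
      one : ∀ d .{{_ : NonZero d}} → + d ÷ d ≡ 1ℚ
      one d = ≡.trans (ℚ.≤-antisym (÷-mono d d 1 1 (ℕ.≤-reflexive (ℕ.*-comm d 1))) (÷-mono 1 1 d d (ℕ.≤-reflexive (ℕ.*-comm 1 d)))) (÷-def (+ 1) 1)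

  -- Suppose `j < i` with `i` in the support of `π` and `j` in that of `η`, and look at position
  -- `i - 1`. If `π` is full there, its coordinate at `i` is zero; if `η` is empty there, so is its
  -- coordinate at `j`.
  ⇒⊴ : ∀ {π η} → deg π ≡ 1 → (∀ k → height π k ≡ B k ⊎ height η k ≡ 0) → π ⊴ η
  ⇒⊴ {π} {η} π∈ sat {i} {j} i∈ j∈ with ℕ.<-≤-connex (toℕ j) (toℕ i)
  ... | inj₂ i≤j = i≤j
  ... | inj₁ j<i = ⊥-elim (gap i j<i i∈)
    where
    gap : ∀ i → j Fin.< i → coord π i ≢ 0ℚ → ⊥
    gap (suc i) (ℕ.s≤s j≤i) i∈ with sat (inject₁ i)
    ... | inj₁ full  = i∈ (≡.trans (coord-partial π (suc i)) (≡.trans (≡.cong (ℚ._- partial π (inject₁ i)) (ℚ.≤-antisym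
        (≡.subst₂ ℚ._≤_ (≡.sym (partial-height π (suc i))) (≡.sym (partial-height π (inject₁ i)))
          (÷-mono _ (B (suc i)) _ (B (inject₁ i)) (ℕ.≤-trans
            (ℕ.*-monoˡ-≤ (B (inject₁ i)) (ℕ.≤-trans (height≤deg*B π (suc i)) (ℕ.≤-reflexive (≡.trans (≡.cong (ℕ._* B (suc i)) π∈) (ℕ.*-identityˡ _)))))
            (ℕ.≤-reflexive (≡.trans (ℕ.*-comm (B (suc i)) (B (inject₁ i))) (≡.cong (ℕ._* B (suc i)) (≡.sym full)))))))
        (partial-step π (suc i)))) (ℚ.+-inverseʳ (partial π (inject₁ i)))))
    ... | inj₂ empty = j∈ (≡.trans (coord-partial η j) (≡.cong₂ ℚ._-_ (zero-below j≤j′) (prev-zero j j≤j′)))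
      where
      j≤j′ : j Fin.≤ inject₁ i
      j≤j′ = ≡.subst (toℕ j ℕ.≤_) (≡.sym (Fin.toℕ-inject₁ i)) j≤i
      zero-below : ∀ {j} → j Fin.≤ inject₁ i → partial η j ≡ 0ℚ
      zero-below {j} j≤ = ℚ.≤-antisym
        (ℚ.≤-trans (partial-mono η j≤) (ℚ.≤-reflexive (≡.trans (partial-height η (inject₁ i))
          (≡.trans (≡.cong (λ m → + m ÷ B (inject₁ i)) empty) (0÷≡0 (B (inject₁ i)))))))
        (partial-nonNeg η j)
      prev-zero : ∀ j → j Fin.≤ inject₁ i → prev (partial η) j ≡ 0ℚ
      prev-zero zero    _  = ≡.refl
      prev-zero (suc j) j≤ = zero-below (≡.subst (ℕ._≤ toℕ (inject₁ i)) (≡.sym (Fin.toℕ-inject₁ j)) (ℕ.<⇒≤ j≤))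

  infix 4 _≻ᴴ_
  _≻ᴴ_ : Vector ℕ (suc n) → Vector ℕ (suc n) → Set
  Z ≻ᴴ Z′ = ∃[ k ] Z k ℕ.< Z′ k × (∀ j → j Fin.< k → Z j ≡ Z′ j)

  private
    prev-equal : ∀ {S T : Vector ℚ (suc n)} k → (∀ j → j Fin.< k → S j ≡ T j) → prev S k ≡ prev T k
    prev-equal zero    eq = ≡.refl
    prev-equal (suc k) eq = eq (inject₁ k) (ℕ.s≤s (ℕ.≤-reflexive (Fin.toℕ-inject₁ k)))

    difference : ∀ (x y p : ℚ) → (x ℚ.- p) ℚ.- (y ℚ.- p) ≡ x ℚ.- y
    difference = solve 3 (λ x y p → (x :- p) :- (y :- p) := x :- y) ≡.refl
      where open ℚSolver.+-*-Solver

    coord-difference : ∀ π η k → prev (partial π) k ≡ prev (partial η) k → coord π k ℚ.- coord η k ≡ partial π k ℚ.- partial η k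
    coord-difference π η k eq = ≡.trans (≡.cong₂ ℚ._-_ (coord-partial π k) (coord-partial η k))
      (≡.trans (≡.cong (λ p → (partial π k ℚ.- p) ℚ.- (partial η k ℚ.- prev (partial η) k)) eq) (difference (partial π k) (partial η k) (prev (partial η) k)))

    partial-equal : ∀ π η k → height π k ≡ height η k → partial π k ≡ partial η k
    partial-equal π η k eq = ≡.trans (partial-height π k) (≡.trans (≡.cong (λ m → + m ÷ B k) eq) (≡.sym (partial-height η k)))

    cancel-< : ∀ {x y} → x ℚ.- y ℚ.< 0ℚ → x ℚ.< y
    cancel-< {x} {y} lt = ≡.subst₂ ℚ._<_ (solve 2 (λ x y → (x :- y) :+ y := x) ≡.refl x y) (ℚ.+-identityˡ y) (ℚ.+-monoˡ-< y lt)
      where open ℚSolver.+-*-Solver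

  -- The coordinates and the partial sums of two paths first differ at the same place and by the
  -- same amount.
  ≻⇒ : ∀ π η → π ≻ η → height (path π) ≻ᴴ height (path η)
  ≻⇒ (π , _) (η , _) (k , lt , eqs) = k , ℕ.≰⇒> (λ ηk≤πk → ℚ.<-irrefl ≡.refl (ℚ.<-≤-trans (cancel-< partial-lt)
      (≡.subst₂ ℚ._≤_ (≡.sym (partial-height η k)) (≡.sym (partial-height π k))
        (÷-mono _ (B k) _ (B k) (ℕ.*-monoˡ-≤ (B k) ηk≤πk))))) , λ j j<k → ÷-injective {d = B j}
      (≡.trans (≡.sym (partial-height π j)) (≡.trans (partials j j<k) (partial-height η j)))
    where
    step : ∀ j → j Fin.< k → prev (partial π) j ≡ prev (partial η) j → partial π j ≡ partial η j
    step j j<k eq = ≡.trans (partial-coord π j) (≡.trans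
      (≡.cong₂ ℚ._+_ (p-q≡0⇒p≡q (coord π j) (coord η j) (eqs j j<k)) eq) (≡.sym (partial-coord η j)))
    partials : ∀ j → j Fin.< k → partial π j ≡ partial η j
    partials = Fin.<-weakInduction _ (λ 0<k → step zero 0<k ≡.refl)
      (λ j ih sj<k → step (suc j) sj<k (ih (ℕ.≤-trans (ℕ.s≤s (ℕ.≤-trans (ℕ.≤-reflexive (Fin.toℕ-inject₁ j)) (ℕ.n≤1+n _))) sj<k)))
    partial-lt : partial π k ℚ.- partial η k ℚ.< 0ℚ
    partial-lt = ≡.subst (ℚ._< 0ℚ) (coord-difference π η k (prev-equal k partials)) lt

  ⇒≻ : ∀ π η → height (path π) ≻ᴴ height (path η) → π ≻ η
  ⇒≻ (π , _) (η , _) (k , lt , eqs) = k ,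
      ≡.subst (ℚ._< 0ℚ) (≡.sym (coord-difference π η k (prev-equal k partials)))
        (≡.subst (partial π k ℚ.- partial η k ℚ.<_) (ℚ.+-inverseʳ (partial η k)) (ℚ.+-monoˡ-< (ℚ.- partial η k)
          (ℚ.≰⇒> (λ η≤π → ℕ.<⇒≱ (ℕ.*-monoˡ-< (B k) lt) (÷-cancel _ (B k) _ (B k)
            (≡.subst₂ ℚ._≤_ (partial-height η k) (partial-height π k) η≤π)))))) ,
      λ j j<k → ≡.trans (coord-difference π η j (prev-equal j (λ i i<j → partials i (ℕ.<-trans i<j j<k))))
        (≡.trans (≡.cong (ℚ._- partial η j) (partials j j<k)) (ℚ.+-inverseʳ (partial η j)))
    where
    partials : ∀ j → j Fin.< k → partial π j ≡ partial η j
    partials j j<k = partial-equal π η j (eqs j j<k)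

-- Degree-one paths as a braided finite alphabet

lookup-injective : ∀ {a} {A : Set a} {xs : List A} → Unique xs → ∀ i j → List.lookup xs i ≡ List.lookup xs j → i ≡ j
lookup-injective {xs = x ∷ xs} (x∉xs ∷ xs!) zero    zero    eq = ≡.refl
lookup-injective {xs = x ∷ xs} (x∉xs ∷ xs!) zero    (suc j) eq = ⊥-elim (All.lookup x∉xs (∈-lookup j) eq)
lookup-injective {xs = x ∷ xs} (x∉xs ∷ xs!) (suc i) zero    eq = ⊥-elim (All.lookup x∉xs (∈-lookup i) (≡.sym eq))
lookup-injective {xs = x ∷ xs} (x∉xs ∷ xs!) (suc i) (suc j) eq = ≡.cong suc (lookup-injective xs! i j eq)

-- A finite region containing all degree-one heights, since these are bounded by `B`.
box : ∀ {n} → Vector ℕ n → List (Vec ℕ n)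
box {zero}  B = [] ∷ []
box {suc n} B = cartesianProductWith _∷_ (upTo (suc (B zero))) (box (λ k → B (suc k)))

∈-box : ∀ {n} (B : Vector ℕ n) Z → (∀ k → Vec.lookup Z k ℕ.≤ B k) → Z ∈ˡ box B
∈-box B []      Z≤B = here ≡.refl
∈-box B (z ∷ Z) Z≤B = ∈-cartesianProductWith⁺ _∷_ (∈-upTo⁺ (ℕ.s≤s (Z≤B zero))) (∈-box _ Z (λ k → Z≤B (suc k)))

box-unique : ∀ {n} (B : Vector ℕ n) → Unique (box B)
box-unique {zero}  B = [] ∷ []
box-unique {suc n} B = Unique.cartesianProductWith⁺ _∷_ Vec.∷-injective (Unique.upTo⁺ (suc (B zero))) (box-unique (λ k → B (suc k)))

-- B ⊓ (x + y) and (x + y) ∸ B are the two halves of a straightening at one coordinate.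
module Overflow where

  open import Data.Nat.Base using (_+_; _∸_; _⊓_; _≤_)

  ∸-overflow : ∀ {x B} p c → x ≤ B → ((p ∸ c) + x) ∸ B ≡ (p + x) ∸ (c + B)
  ∸-overflow {x} {B} p c x≤B with ℕ.≤-total c p
  ... | inj₁ c≤p = ≡.trans (≡.cong (_∸ B) (≡.sym (ℕ.+-∸-comm x c≤p))) (ℕ.∸-+-assoc (p + x) c B)
  ... | inj₂ p≤c = ≡.trans (≡.cong (λ z → (z + x) ∸ B) (ℕ.m≤n⇒m∸n≡0 p≤c))
    (≡.trans (ℕ.m≤n⇒m∸n≡0 x≤B) (≡.sym (ℕ.m≤n⇒m∸n≡0 (ℕ.+-mono-≤ p≤c x≤B))))

  -- The complement of `∸-overflow`: on both sides the minimum and the overflow add up to `p + x`.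
  ⊓-overflow : ∀ {x B} p c → x ≤ B → (c + B) ⊓ (p + x) ≡ (c ⊓ p) + (B ⊓ ((p ∸ c) + x))
  ⊓-overflow {x} {B} p c x≤B = ℕ.+-cancelʳ-≡ ((p + x) ∸ (c + B)) _ _ (begin
    (c + B) ⊓ (p + x) + ((p + x) ∸ (c + B))                          ≡⟨ ℕ.m⊓n+n∸m≡n (c + B) (p + x) ⟩
    p + x                                                            ≡⟨ ≡.cong (_+ x) (ℕ.m⊓n+n∸m≡n c p) ⟨
    ((c ⊓ p) + (p ∸ c)) + x                                          ≡⟨ ℕ.+-assoc (c ⊓ p) (p ∸ c) x ⟩
    (c ⊓ p) + ((p ∸ c) + x)                                          ≡⟨ ≡.cong ((c ⊓ p) +_) (ℕ.m⊓n+n∸m≡n B ((p ∸ c) + x)) ⟨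
    (c ⊓ p) + (B ⊓ ((p ∸ c) + x) + (((p ∸ c) + x) ∸ B))              ≡⟨ ≡.cong (λ z → (c ⊓ p) + (B ⊓ ((p ∸ c) + x) + z)) (∸-overflow p c x≤B) ⟩
    (c ⊓ p) + (B ⊓ ((p ∸ c) + x) + ((p + x) ∸ (c + B)))              ≡⟨ ℕ.+-assoc (c ⊓ p) _ _ ⟨
    ((c ⊓ p) + (B ⊓ ((p ∸ c) + x))) + ((p + x) ∸ (c + B))            ∎)
    where open ≡-Reasoning

  ⊓-+-⊓ : ∀ B x y → B ⊓ (x + (B ⊓ y)) ≡ B ⊓ (x + y)
  ⊓-+-⊓ B x y with ℕ.≤-total y B
  ... | inj₁ y≤B = ≡.cong (λ z → B ⊓ (x + z)) (ℕ.m≥n⇒m⊓n≡n y≤B)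
  ... | inj₂ B≤y = ≡.trans (ℕ.m≤n⇒m⊓n≡m (ℕ.≤-trans (ℕ.≤-reflexive (≡.sym (ℕ.m≤n⇒m⊓n≡m B≤y))) (ℕ.m≤n+m _ x)))
                           (≡.sym (ℕ.m≤n⇒m⊓n≡m (ℕ.≤-trans B≤y (ℕ.m≤n+m _ x))))

  module _ (B : ℕ) where
    lo hi : ℕ → ℕ → ℕ
    lo x y = B ⊓ (x + y)
    hi x y = (x + y) ∸ B

    lo+hi : ∀ x y → lo x y + hi x y ≡ x + y
    lo+hi x y = ℕ.m⊓n+n∸m≡n B (x + y)

    hi≤B : ∀ {x y} → x ≤ B → y ≤ B → hi x y ≤ B
    hi≤B {x} {y} x≤B y≤B = ℕ.m≤n+o⇒m∸n≤o (x + y) B (ℕ.+-mono-≤ x≤B y≤B)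

    lo-idem : ∀ x y → lo (lo x y) (hi x y) ≡ lo x y
    lo-idem x y = ≡.cong (B ⊓_) (lo+hi x y)

    hi-idem : ∀ x y → hi (lo x y) (hi x y) ≡ hi x y
    hi-idem x y = ≡.cong (_∸ B) (lo+hi x y)

    -- Both sides of the braid relation turn (x , y , z) into the standard
    -- filling of x + y + z; it suffices to compare the outer entries.
    braid-first : ∀ x y z → lo (lo x y) (lo (hi x y) z) ≡ lo x (lo y z)
    braid-first x y z = begin
      B ⊓ (lo x y + lo (hi x y) z)     ≡⟨ ⊓-+-⊓ B (lo x y) (hi x y + z) ⟩
      B ⊓ (lo x y + (hi x y + z))      ≡⟨ ≡.cong (B ⊓_) (≡.trans (≡.sym (ℕ.+-assoc (lo x y) (hi x y) z)) (≡.cong (_+ z) (lo+hi x y))) ⟩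
      B ⊓ ((x + y) + z)                ≡⟨ ≡.cong (B ⊓_) (ℕ.+-assoc x y z) ⟩
      B ⊓ (x + (y + z))                ≡⟨ ⊓-+-⊓ B x (y + z) ⟨
      B ⊓ (x + lo y z)                 ∎
      where open ≡-Reasoning

    braid-last : ∀ {x y z} → x ≤ B → y ≤ B → z ≤ B → hi (hi x y) z ≡ hi (hi x (lo y z)) (hi y z)
    braid-last {x} {y} {z} x≤B y≤B z≤B = begin
      (((x + y) ∸ B) + z) ∸ B                    ≡⟨ ∸-overflow (x + y) B z≤B ⟩
      ((x + y) + z) ∸ (B + B)                    ≡⟨ ≡.cong (_∸ (B + B)) (≡.trans (ℕ.+-assoc x y z)
                                                      (≡.trans (≡.cong (x +_) (≡.sym (lo+hi y z))) (≡.sym (ℕ.+-assoc x (lo y z) (hi y z))))) ⟩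
      ((x + lo y z) + hi y z) ∸ (B + B)          ≡⟨ ∸-overflow (x + lo y z) B (hi≤B y≤B z≤B) ⟨
      (((x + lo y z) ∸ B) + hi y z) ∸ B          ∎
      where open ≡-Reasoning

    braid-middle : ∀ {x y z} → x ≤ B → y ≤ B → z ≤ B →
                   hi (lo x y) (lo (hi x y) z) ≡ lo (hi x (lo y z)) (hi y z)
    braid-middle {x} {y} {z} x≤B y≤B z≤B =
      ℕ.+-cancelʳ-≡ (hi (hi x y) z) _ _ (ℕ.+-cancelˡ-≡ (lo (lo x y) (lo (hi x y) z)) _ _ (begin
        a + (hi (lo x y) c + d)                           ≡⟨ ℕ.+-assoc a _ d ⟨
        (a + hi (lo x y) c) + d                           ≡⟨ ≡.cong (_+ d) (lo+hi (lo x y) c) ⟩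
        (lo x y + c) + d                                  ≡⟨ ℕ.+-assoc (lo x y) c d ⟩
        lo x y + (c + d)                                  ≡⟨ ≡.cong (lo x y +_) (lo+hi (hi x y) z) ⟩
        lo x y + (hi x y + z)                             ≡⟨ ℕ.+-assoc (lo x y) (hi x y) z ⟨
        (lo x y + hi x y) + z                             ≡⟨ ≡.cong (_+ z) (lo+hi x y) ⟩
        (x + y) + z                                       ≡⟨ ℕ.+-assoc x y z ⟩
        x + (y + z)                                       ≡⟨ ≡.cong (x +_) (lo+hi y z) ⟨
        x + (lo y z + hi y z)                             ≡⟨ ℕ.+-assoc x _ _ ⟨
        (x + lo y z) + hi y z                             ≡⟨ ≡.cong (_+ hi y z) (lo+hi x (lo y z)) ⟨
        (lo x (lo y z) + hi x (lo y z)) + hi y z          ≡⟨ ℕ.+-assoc (lo x (lo y z)) _ _ ⟩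
        lo x (lo y z) + (hi x (lo y z) + hi y z)          ≡⟨ ≡.cong₂ _+_ (≡.sym (braid-first x y z)) (≡.sym (lo+hi (hi x (lo y z)) (hi y z))) ⟩
        a + (lo (hi x (lo y z)) (hi y z) + hi (hi x (lo y z)) (hi y z))
          ≡⟨ ≡.cong (λ d → a + (lo (hi x (lo y z)) (hi y z) + d)) (braid-last x≤B y≤B z≤B) ⟨
        a + (lo (hi x (lo y z)) (hi y z) + d)             ∎))
      where
      open ≡-Reasoning
      a c d : ℕ
      a = lo (lo x y) (lo (hi x y) z)
      c = lo (hi x y) z
      d = hi (hi x y) z

module LSLetters (n : ℕ) (b : Fin n → ℕ) (b>0 : ∀ j → NonZero (b j)) where

  open import Data.Nat.Base using (_+_; _*_; _∸_; _⊓_; _≤_)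
  open LSPaths n b b>0
  open Heights n b b>0
  private
    module Π = CommutativeMonoid monoid
    module deg = MonoidMorphisms.IsMonoidHomomorphism deg-isMonoidHomomorphism

  private
    swap-* : ∀ c x y → (c * x) * y ≡ (c * y) * x
    swap-* c x y = ≡.trans (ℕ.*-assoc c x y) (≡.trans (≡.cong (c *_) (ℕ.*-comm x y)) (≡.sym (ℕ.*-assoc c y x)))

  opaque
    -- The part of a path up to total mass c, and the rest.
    low high : ℕ → LSPath → LSPath
    low c π = fromHeight (λ k → (c * B k) ⊓ height π k) λ j →
      ≡.subst₂ _≤_ (≡.sym (ℕ.*-distribʳ-⊓ (B (suc j)) (c * B (inject₁ j)) (height π (inject₁ j))))
        (≡.sym (ℕ.*-distribʳ-⊓ (B (inject₁ j)) (c * B (suc j)) (height π (suc j))))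
        (ℕ.⊓-mono-≤ (ℕ.≤-reflexive (swap-* c (B (inject₁ j)) (B (suc j)))) (height-monotone π j))
    high c π = fromHeight (λ k → height π k ∸ c * B k) λ j →
      ≡.subst₂ _≤_ (≡.sym (ℕ.*-distribʳ-∸ (B (suc j)) (height π (inject₁ j)) (c * B (inject₁ j))))
        (≡.sym (ℕ.*-distribʳ-∸ (B (inject₁ j)) (height π (suc j)) (c * B (suc j))))
        (ℕ.∸-mono (height-monotone π j) (ℕ.≤-reflexive (swap-* c (B (suc j)) (B (inject₁ j)))))

    height-low : ∀ c π k → height (low c π) k ≡ (c * B k) ⊓ height π k
    height-low c π = height-fromHeight (λ k → (c * B k) ⊓ height π k) _

    height-high : ∀ c π k → height (high c π) k ≡ height π k ∸ c * B k
    height-high c π = height-fromHeight (λ k → height π k ∸ c * B k) _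

  low+high : ∀ c π → π ≈ᴾ low c π +ᴾ high c π
  low+high c π = height-injective {π} {low c π +ᴾ high c π} λ k → ≡.sym (≡.trans (height-+ (low c π) (high c π) k)
    (≡.trans (≡.cong₂ _+_ (height-low c π k) (height-high c π k)) (ℕ.m⊓n+n∸m≡n (c * B k) (height π k))))

  c*B-last : ∀ c → c * B (fromℕ n) ≡ c
  c*B-last c = ≡.trans (≡.cong (c *_) B-last) (ℕ.*-identityʳ c)

  opaque
    unfolding low high

    deg-low : ∀ c π → deg (low c π) ≡ c ⊓ deg π
    deg-low c π = ≡.trans (deg-fromHeight _ _) (≡.cong₂ _⊓_ (c*B-last c) (height-last π))

    deg-high : ∀ c π → deg (high c π) ≡ deg π ∸ c
    deg-high c π = ≡.trans (deg-fromHeight _ _) (≡.cong₂ _∸_ (height-last π) (c*B-last c))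

  low-cong : ∀ c {π η} → π ≈ᴾ η → low c π ≈ᴾ low c η
  low-cong c {π} {η} π≈η = height-injective {low c π} {low c η} λ k → ≡.trans (height-low c π k)
    (≡.trans (≡.cong ((c * B k) ⊓_) (height-cong {π} {η} π≈η k)) (≡.sym (height-low c η k)))

  high-cong : ∀ c {π η} → π ≈ᴾ η → high c π ≈ᴾ high c η
  high-cong c {π} {η} π≈η = height-injective {high c π} {high c η} λ k → ≡.trans (height-high c π k)
    (≡.trans (≡.cong (_∸ c * B k) (height-cong {π} {η} π≈η k)) (≡.sym (height-high c η k)))

  first : ∀ π → deg π ≡ 2 → LSPath₁
  first π π∈ = low 1 π , ≡.trans (deg-low 1 π) (≡.cong (1 ⊓_) π∈)

  last : ∀ d π → deg π ≡ suc d → LSPath₁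
  last d π π∈ = high d π , ≡.trans (deg-high d π) (≡.trans (≡.cong (_∸ d) π∈) (ℕ.m+n∸n≡m 1 d))

  deg-+₁ : ∀ (π η : LSPath₁) → deg (path π +ᴾ path η) ≡ 2
  deg-+₁ (π , π∈) (η , η∈) = ≡.trans (deg.homo π η) (≡.cong₂ _+_ π∈ η∈)

  height₁≤B : ∀ (π : LSPath₁) k → height (path π) k ≤ B k
  height₁≤B (π , π∈) k = ℕ.≤-trans (height≤deg*B π k)
    (ℕ.≤-reflexive (≡.trans (≡.cong (_* B k) π∈) (ℕ.*-identityˡ (B k))))

  IsLetter : Vec ℕ (suc n) → Set
  IsLetter Z = Monotone (Vec.lookup Z) × Vec.lookup Z (fromℕ n) ≡ 1

  isLetter? : ∀ Z → Dec (IsLetter Z)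
  isLetter? Z = Fin.all? (λ j → _ ℕ.≤? _) ×-dec (_ ℕ.≟ 1)

  -- Letters are listed by their height vectors, each occurring once, so equal paths have equal
  -- indices. The 0-Hecke laws are equations between indices and need this.
  opaque
    alphabet : List (Vec ℕ (suc n))
    alphabet = filter isLetter? (box B)

    size : ℕ
    size = List.length alphabet

    heights : Fin size → Vec ℕ (suc n)
    heights = List.lookup alphabet

    heights-injective : ∀ {i j} → heights i ≡ heights j → i ≡ j
    heights-injective = lookup-injective (Unique.filter⁺ isLetter? (box-unique B)) _ _

    letter : Fin size → LSPath
    letter i = fromHeight (Vec.lookup (heights i)) (proj₁ (proj₂ (∈-filter⁻ isLetter? {xs = box B} (∈-lookup i))))

    letter-deg : ∀ i → deg (letter i) ≡ 1
    letter-deg i = ≡.trans (deg-fromHeight _ _) (proj₂ (proj₂ (∈-filter⁻ isLetter? {xs = box B} (∈-lookup i))))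

    height-letter : ∀ i k → height (letter i) k ≡ Vec.lookup (heights i) k
    height-letter i = height-fromHeight (Vec.lookup (heights i)) _

    ∈-alphabet : ∀ (π : LSPath₁) → Vec.tabulate (height (path π)) ∈ˡ alphabet
    ∈-alphabet (π , π∈) = ∈-filter⁺ isLetter?
      (∈-box B _ (λ k → ≡.subst (_≤ B k) (≡.sym (Vec.lookup∘tabulate (height π) k)) (height₁≤B (π , π∈) k)))
      ( (λ j → ≡.subst₂ (λ x y → x * B (suc j) ≤ y * B (inject₁ j))
          (≡.sym (Vec.lookup∘tabulate (height π) (inject₁ j))) (≡.sym (Vec.lookup∘tabulate (height π) (suc j))) (height-monotone π j))
      , ≡.trans (Vec.lookup∘tabulate (height π) (fromℕ n)) (≡.trans (height-last π) π∈))

    index : LSPath₁ → Fin size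
    index π = Any.index (∈-alphabet π)

    letter-index : ∀ π → letter (index π) ≈ᴾ path π
    letter-index π = height-injective {letter (index π)} {path π} λ k → ≡.trans (height-letter (index π) k)
      (≡.trans (≡.cong (λ Z → Vec.lookup Z k) (≡.sym (Any.lookup-index (∈-alphabet π)))) (Vec.lookup∘tabulate (height (path π)) k))

    letter-injective : ∀ {i j} → letter i ≈ᴾ letter j → i ≡ j
    letter-injective {i} {j} i≈j = heights-injective (begin
      heights i                                ≡⟨ Vec.tabulate∘lookup (heights i) ⟨
      Vec.tabulate (Vec.lookup (heights i))    ≡⟨ Vec.tabulate-cong (λ k → begin
        Vec.lookup (heights i) k                 ≡⟨ height-letter i k ⟨
        height (letter i) k                      ≡⟨ height-cong {letter i} {letter j} i≈j k ⟩
        height (letter j) k                      ≡⟨ height-letter j k ⟩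
        Vec.lookup (heights j) k                 ∎) ⟩
      Vec.tabulate (Vec.lookup (heights j))    ≡⟨ Vec.tabulate∘lookup (heights j) ⟩
      heights j                                ∎)
      where open ≡-Reasoning

    index-cong : ∀ {π η} → path π ≈ᴾ path η → index π ≡ index η
    index-cong {π} {η} π≈η = letter-injective (Π.trans {letter (index π)} {path π} {letter (index η)} (letter-index π)
      (Π.trans {path π} {path η} {letter (index η)} π≈η (Π.sym {letter (index η)} {path η} (letter-index η))))

  letter₁ : Fin size → LSPath₁
  letter₁ i = letter i , letter-deg i

  H : Fin size → Vector ℕ (suc n)
  H i = height (letter i)

  H-injective : ∀ {i j} → H i ≗ H j → i ≡ j
  H-injective {i} {j} eq = letter-injective (height-injective {letter i} {letter j} eq)

  H-index : ∀ π k → H (index π) k ≡ height (path π) k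
  H-index π = height-cong {letter (index π)} {path π} (letter-index π)

  H≤B : ∀ i k → H i k ≤ B k
  H≤B i = height₁≤B (letter₁ i)

  open Overflow

  opaque
    -- The two factors are the parts of the sum below and above mass 1.
    ρ₁ ρ₂ : Fin size → Fin size → Fin size
    ρ₁ i j = index (first (letter i +ᴾ letter j) (deg-+₁ (letter₁ i) (letter₁ j)))
    ρ₂ i j = index (last 1 (letter i +ᴾ letter j) (deg-+₁ (letter₁ i) (letter₁ j)))

    H-ρ₁ : ∀ i j k → H (ρ₁ i j) k ≡ lo (B k) (H i k) (H j k)
    H-ρ₁ i j k = begin
      H (ρ₁ i j) k                                     ≡⟨ H-index (first (letter i +ᴾ letter j) (deg-+₁ (letter₁ i) (letter₁ j))) k ⟩
      height (low 1 (letter i +ᴾ letter j)) k          ≡⟨ height-low 1 (letter i +ᴾ letter j) k ⟩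
      (1 * B k) ⊓ height (letter i +ᴾ letter j) k      ≡⟨ ≡.cong₂ _⊓_ (ℕ.*-identityˡ (B k)) (height-+ (letter i) (letter j) k) ⟩
      lo (B k) (H i k) (H j k)                         ∎
      where open ≡-Reasoning

    H-ρ₂ : ∀ i j k → H (ρ₂ i j) k ≡ hi (B k) (H i k) (H j k)
    H-ρ₂ i j k = begin
      H (ρ₂ i j) k                                     ≡⟨ H-index (last 1 (letter i +ᴾ letter j) (deg-+₁ (letter₁ i) (letter₁ j))) k ⟩
      height (high 1 (letter i +ᴾ letter j)) k         ≡⟨ height-high 1 (letter i +ᴾ letter j) k ⟩
      height (letter i +ᴾ letter j) k ∸ 1 * B k        ≡⟨ ≡.cong₂ _∸_ (height-+ (letter i) (letter j) k) (ℕ.*-identityˡ (B k)) ⟩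
      hi (B k) (H i k) (H j k)                         ∎
      where open ≡-Reasoning

  H-ρ₁′ : ∀ {x y} i j k → H i k ≡ x → H j k ≡ y → H (ρ₁ i j) k ≡ lo (B k) x y
  H-ρ₁′ i j k ≡.refl ≡.refl = H-ρ₁ i j k

  H-ρ₂′ : ∀ {x y} i j k → H i k ≡ x → H j k ≡ y → H (ρ₂ i j) k ≡ hi (B k) x y
  H-ρ₂′ i j k ≡.refl ≡.refl = H-ρ₂ i j k

  letter-ρ : ∀ i j → (letter i +ᴾ letter j) ≈ᴾ (letter (ρ₁ i j) +ᴾ letter (ρ₂ i j))
  letter-ρ i j = height-injective {letter i +ᴾ letter j} {letter (ρ₁ i j) +ᴾ letter (ρ₂ i j)} λ k → begin
    height (letter i +ᴾ letter j) k                          ≡⟨ height-+ (letter i) (letter j) k ⟩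
    H i k + H j k                                            ≡⟨ lo+hi (B k) (H i k) (H j k) ⟨
    lo (B k) (H i k) (H j k) + hi (B k) (H i k) (H j k)      ≡⟨ ≡.cong₂ _+_ (H-ρ₁ i j k) (H-ρ₂ i j k) ⟨
    H (ρ₁ i j) k + H (ρ₂ i j) k                              ≡⟨ height-+ (letter (ρ₁ i j)) (letter (ρ₂ i j)) k ⟨
    height (letter (ρ₁ i j) +ᴾ letter (ρ₂ i j)) k            ∎
    where open ≡-Reasoning

  isZeroHecke : Words.IsZeroHecke ρ₁ ρ₂
  isZeroHecke = record
    { idempotent = λ { (i ∷ j ∷ w) → ≡.cong₂ (λ i j → i ∷ j ∷ w)
        (H-injective λ k → ≡.trans (H-ρ₁′ _ _ k (H-ρ₁ i j k) (H-ρ₂ i j k)) (≡.trans (lo-idem (B k) (H i k) (H j k)) (≡.sym (H-ρ₁ i j k))))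
        (H-injective λ k → ≡.trans (H-ρ₂′ _ _ k (H-ρ₁ i j k) (H-ρ₂ i j k)) (≡.trans (hi-idem (B k) (H i k) (H j k)) (≡.sym (H-ρ₂ i j k)))) }
    ; braid = λ { (i ∷ j ∷ l ∷ w) → cong₃ (λ i j l → i ∷ j ∷ l ∷ w)
        (H-injective λ k → ≡.trans (H-ρ₁′ _ _ k (H-ρ₁ i j k) (H-ρ₁′ _ l k (H-ρ₂ i j k) ≡.refl))
          (≡.trans (braid-first (B k) (H i k) (H j k) (H l k)) (≡.sym (H-ρ₁′ i _ k ≡.refl (H-ρ₁ j l k)))))
        (H-injective λ k → ≡.trans (H-ρ₂′ _ _ k (H-ρ₁ i j k) (H-ρ₁′ _ l k (H-ρ₂ i j k) ≡.refl))
          (≡.trans (braid-middle (B k) (H≤B i k) (H≤B j k) (H≤B l k))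
            (≡.sym (H-ρ₁′ _ _ k (H-ρ₂′ i _ k ≡.refl (H-ρ₁ j l k)) (H-ρ₂ j l k)))))
        (H-injective λ k → ≡.trans (H-ρ₂′ _ l k (H-ρ₂ i j k) ≡.refl)
          (≡.trans (braid-last (B k) (H≤B i k) (H≤B j k) (H≤B l k))
            (≡.sym (H-ρ₂′ _ _ k (H-ρ₂′ i _ k ≡.refl (H-ρ₁ j l k)) (H-ρ₂ j l k))))) }
    }
    where
    cong₃ : ∀ {a b c d} {A : Set a} {B : Set b} {C : Set c} {D : Set d} (f : A → B → C → D) {x x′ y y′ z z′} →
            x ≡ x′ → y ≡ y′ → z ≡ z′ → f x y z ≡ f x′ y′ z′
    cong₃ f ≡.refl ≡.refl ≡.refl = ≡.refl

  braidedLetters : BraidedLetters monoid deg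
  braidedLetters = record
    { letter      = letter
    ; letter-deg  = λ i → proj₂ (letter₁ i)
    ; ρ₁          = ρ₁
    ; ρ₂          = ρ₂
    ; isZeroHecke = isZeroHecke
    ; letter-ρ    = letter-ρ
    }

  open BraidedLetters braidedLetters using (Split; _≈ˢ_; merge; extend)

  -- In degree `d + 1` the last factor is the part above mass `d`, and the product of the others is
  -- the part below.
  splitAt : ∀ d π → deg π ≡ d → Split
  splitAt zero    π π∈ = nothing
  splitAt (suc d) π π∈ = just (low d π , index (last d π π∈))

  splitAt-cong : ∀ {d e π η} (π∈ : deg π ≡ d) (η∈ : deg η ≡ e) → π ≈ᴾ η → d ≡ e → splitAt d π π∈ ≈ˢ splitAt e η η∈
  splitAt-cong {zero}          π∈ η∈ π≈η ≡.refl = nothing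
  splitAt-cong {suc d} {π = π} {η} π∈ η∈ π≈η ≡.refl =
    just (low-cong d {π} {η} π≈η , index-cong {last d π π∈} {last d η η∈} (high-cong d {π} {η} π≈η))

  splitAt-merge : ∀ d π (π∈ : deg π ≡ d) → π ≈ᴾ merge (splitAt d π π∈)
  splitAt-merge zero    π π∈ = height-injective {π} {0ᴾ} λ k → ≡.trans
    (ℕ.n≤0⇒n≡0 (ℕ.≤-trans (height≤deg*B π k) (ℕ.≤-reflexive (≡.cong (_* B k) π∈))))
    (≡.sym (ℕ.n≤0⇒n≡0 (height≤deg*B 0ᴾ k)))
  splitAt-merge (suc d) π π∈ = Π.trans {π} {low d π +ᴾ high d π} {low d π +ᴾ letter (index (last d π π∈))} (low+high d π)
    (Π.∙-congˡ {low d π} {high d π} {letter (index (last d π π∈))}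
      (Π.sym {letter (index (last d π π∈))} {high d π} (letter-index (last d π π∈))))

  H-last : ∀ d π (π∈ : deg π ≡ suc d) k → H (index (last d π π∈)) k ≡ height π k ∸ d * B k
  H-last d π π∈ k = ≡.trans (H-index (last d π π∈) k) (height-high d π k)

  -- A letter has height at most `B`, so raising the threshold from `d` to `d + 1` affects only the
  -- mass above `d`: the old last factor together with the new letter.
  low-letter : ∀ d π (π∈ : deg π ≡ suc d) i →
               low (suc d) (π +ᴾ letter i) ≈ᴾ (low d π +ᴾ letter (ρ₁ (index (last d π π∈)) i))
  low-letter d π π∈ i = height-injective {low (suc d) (π +ᴾ letter i)} {low d π +ᴾ letter (ρ₁ y i)} λ k → begin
    height (low (suc d) (π +ᴾ letter i)) k                           ≡⟨ height-low (suc d) (π +ᴾ letter i) k ⟩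
    (B k + d * B k) ⊓ height (π +ᴾ letter i) k                       ≡⟨ ≡.cong₂ _⊓_ (ℕ.+-comm (B k) (d * B k)) (height-+ π (letter i) k) ⟩
    (d * B k + B k) ⊓ (height π k + H i k)                           ≡⟨ ⊓-overflow (height π k) (d * B k) (H≤B i k) ⟩
    (d * B k) ⊓ height π k + lo (B k) (height π k ∸ d * B k) (H i k) ≡⟨ ≡.cong₂ _+_ (height-low d π k) (H-ρ₁′ y i k (H-last d π π∈ k) ≡.refl) ⟨
    height (low d π) k + H (ρ₁ y i) k                                ≡⟨ height-+ (low d π) (letter (ρ₁ y i)) k ⟨
    height (low d π +ᴾ letter (ρ₁ y i)) k                            ∎
    where
    open ≡-Reasoning
    y : Fin size
    y = index (last d π π∈)

  last-letter : ∀ d π (π∈ : deg π ≡ suc d) i (πi∈ : deg (π +ᴾ letter i) ≡ suc (suc d)) →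
                index (last (suc d) (π +ᴾ letter i) πi∈) ≡ ρ₂ (index (last d π π∈)) i
  last-letter d π π∈ i πi∈ = H-injective λ k → begin
    H (index (last (suc d) (π +ᴾ letter i) πi∈)) k       ≡⟨ H-last (suc d) (π +ᴾ letter i) πi∈ k ⟩
    height (π +ᴾ letter i) k ∸ (B k + d * B k)           ≡⟨ ≡.cong₂ _∸_ (height-+ π (letter i) k) (ℕ.+-comm (B k) (d * B k)) ⟩
    (height π k + H i k) ∸ (d * B k + B k)               ≡⟨ ∸-overflow (height π k) (d * B k) (H≤B i k) ⟨
    hi (B k) (height π k ∸ d * B k) (H i k)              ≡⟨ H-ρ₂′ (index (last d π π∈)) i k (H-last d π π∈ k) ≡.refl ⟨
    H (ρ₂ (index (last d π π∈)) i) k                     ∎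
    where open ≡-Reasoning

  splitAt-letter : ∀ d π (π∈ : deg π ≡ d) i (πi∈ : deg (π +ᴾ letter i) ≡ suc d) →
                   splitAt (suc d) (π +ᴾ letter i) πi∈ ≈ˢ just (extend (splitAt d π π∈) i)
  splitAt-letter zero π π∈ i πi∈ = just
    ( height-injective {low 0 (π +ᴾ letter i)} {0ᴾ} (λ k → ≡.trans (height-low 0 (π +ᴾ letter i) k) (≡.sym (ℕ.n≤0⇒n≡0 (height≤deg*B 0ᴾ k))))
    , H-injective λ k → ≡.trans (H-last 0 (π +ᴾ letter i) πi∈ k)
        (≡.trans (height-+ π (letter i) k) (≡.cong (_+ H i k)
          (ℕ.n≤0⇒n≡0 (ℕ.≤-trans (height≤deg*B π k) (ℕ.≤-reflexive (≡.cong (_* B k) π∈)))))) )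
  splitAt-letter (suc d) π π∈ i πi∈ = just (low-letter d π π∈ i , last-letter d π π∈ i πi∈)

  letterSplitting : LetterSplitting monoid deg
  letterSplitting = record
    { letters      = braidedLetters
    ; split        = λ π → splitAt (deg π) π ≡.refl
    ; split-cong   = λ {π} {η} π≈η → splitAt-cong ≡.refl ≡.refl π≈η (deg.⟦⟧-cong {π} {η} π≈η)
    ; split-merge  = λ π → splitAt-merge (deg π) π ≡.refl
    ; split-letter = λ π i → ≡.subst (_≈ˢ just (extend (splitAt (deg π) π ≡.refl) i)) (reindex π i)
        (splitAt-letter (deg π) π ≡.refl i (deg-+letter π i))
    }
    where
    deg-+letter : ∀ π i → deg (π +ᴾ letter i) ≡ suc (deg π)
    deg-+letter π i = ≡.trans (deg.homo π (letter i)) (≡.trans (≡.cong (deg π +_) (proj₂ (letter₁ i))) (ℕ.+-comm (deg π) 1))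

    -- The degree of `π +ᴾ letter i` equals `suc (deg π)` only propositionally, so the index `d` and
    -- its proof are varied together.
    reindex-gen : ∀ {d e} π (p : deg π ≡ d) (q : deg π ≡ e) → splitAt d π p ≡ splitAt e π q
    reindex-gen π ≡.refl ≡.refl = ≡.refl

    reindex : ∀ π i → splitAt (suc (deg π)) (π +ᴾ letter i) (deg-+letter π i) ≡ splitAt (deg (π +ᴾ letter i)) (π +ᴾ letter i) ≡.refl
    reindex π i = reindex-gen (π +ᴾ letter i) (deg-+letter π i) ≡.refl

-- The monomial order and minimality of standard monomials

lex-compare : ∀ {n} (Z Z′ : Vector ℕ n) →
  (∃[ k ] Z k ℕ.< Z′ k × (∀ j → j Fin.< k → Z j ≡ Z′ j)) ⊎ Z ≗ Z′ ⊎ (∃[ k ] Z′ k ℕ.< Z k × (∀ j → j Fin.< k → Z′ j ≡ Z j))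
lex-compare {zero}  Z Z′ = inj₂ (inj₁ λ ())
lex-compare {suc n} Z Z′ with ℕ.<-cmp (Z zero) (Z′ zero)
... | tri< lt _ _ = inj₁ (zero , lt , λ _ ())
... | tri> _ _ gt = inj₂ (inj₂ (zero , gt , λ _ ()))
... | tri≈ _ eq _ with lex-compare (λ k → Z (suc k)) (λ k → Z′ (suc k))
...   | inj₁ (k , lt , eqs)        = inj₁ (suc k , lt , λ { zero _ → eq ; (suc j) (ℕ.s≤s j<k) → eqs j j<k })
...   | inj₂ (inj₁ eqs)            = inj₂ (inj₁ λ { zero → eq ; (suc k) → eqs k })
...   | inj₂ (inj₂ (k , lt , eqs)) = inj₂ (inj₂ (suc k , lt , λ { zero _ → ≡.sym eq ; (suc j) (ℕ.s≤s j<k) → eqs j j<k }))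

module MonomialOrder {x ℓx o} (X : DecSetoid x ℓx) (_≻_ : Rel (DecSetoid.Carrier X) o) where

  private
    module X = DecSetoid X
  open import Data.Nat.Base using (_<_)
  open X using (_≈_; _≟_)
  open Monomials X
  open Monomials.DegRevLex X _≻_
  open Permutation X.setoid using (_↭_)
  open PermutationProperties X.setoid using (xs↭ys⇒|xs|≡|ys|; filter⁺)
  open Membership X.setoid using (_∉_)

  exponent-↭ : ∀ y {m m′} → m ↭ m′ → exponent y m ≡ exponent y m′
  exponent-↭ y m↭m′ = xs↭ys⇒|xs|≡|ys| (filter⁺ (y ≟_) (λ z≈w y≈z → X.trans y≈z z≈w) m↭m′)

  exponent-accept : ∀ {y z} m → y ≈ z → exponent y (z ∷ m) ≡ suc (exponent y m)
  exponent-accept {y} m y≈z = ≡.cong length (filter-accept (y ≟_) {xs = m} y≈z)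

  exponent-reject : ∀ {y z} m → ¬ y ≈ z → exponent y (z ∷ m) ≡ exponent y m
  exponent-reject {y} m y≉z = ≡.cong length (filter-reject (y ≟_) {xs = m} y≉z)

  exponent-cong : ∀ {y z} → y ≈ z → ∀ m → exponent y m ≡ exponent z m
  exponent-cong y≈z []      = ≡.refl
  exponent-cong {y} {z} y≈z (w ∷ m) = by (y ≟ w)
    where
    by : Dec (y ≈ w) → exponent y (w ∷ m) ≡ exponent z (w ∷ m)
    by (yes y≈w) = ≡.trans (exponent-accept m y≈w) (≡.trans (≡.cong suc (exponent-cong y≈z m))
      (≡.sym (exponent-accept m (X.trans (X.sym y≈z) y≈w))))
    by (no y≉w)  = ≡.trans (exponent-reject m y≉w) (≡.trans (exponent-cong y≈z m)
      (≡.sym (exponent-reject m (λ z≈w → y≉w (X.trans y≈z z≈w)))))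

  exponent-∉ : ∀ {y} m → y ∉ m → exponent y m ≡ 0
  exponent-∉ []      y∉ = ≡.refl
  exponent-∉ (z ∷ m) y∉ = ≡.trans (exponent-reject m (λ y≈z → y∉ (here y≈z))) (exponent-∉ m (λ y∈ → y∉ (there y∈)))

  ≻ᵐ-resp : ∀ {m₁ m₁′ m₂ m₂′} → m₁ ↭ m₁′ → m₂ ↭ m₂′ → m₁ ≻ᵐ m₂ → m₁′ ≻ᵐ m₂′
  ≻ᵐ-resp p q (inj₁ longer) = inj₁ (≡.subst₂ _<_ (xs↭ys⇒|xs|≡|ys| q) (xs↭ys⇒|xs|≡|ys| p) longer)
  ≻ᵐ-resp p q (inj₂ (len , y , lt , eqs)) = inj₂
    ( ≡.trans (≡.sym (xs↭ys⇒|xs|≡|ys| p)) (≡.trans len (xs↭ys⇒|xs|≡|ys| q))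
    , y , ≡.subst₂ _<_ (exponent-↭ y p) (exponent-↭ y q) lt
    , λ z y≻z → ≡.trans (≡.sym (exponent-↭ z p)) (≡.trans (eqs z y≻z) (exponent-↭ z q)))

  ≻ᵐ-∷ : ∀ y {m m′} → m ≻ᵐ m′ → (y ∷ m) ≻ᵐ (y ∷ m′)
  ≻ᵐ-∷ y (inj₁ longer) = inj₁ (ℕ.s≤s longer)
  ≻ᵐ-∷ y {m} {m′} (inj₂ (len , z , lt , eqs)) =
    inj₂ (≡.cong suc len , z , by-< (z ≟ y) , λ w z≻w → by-≡ w (w ≟ y) (eqs w z≻w))
    where
    by-< : Dec (z ≈ y) → exponent z (y ∷ m) < exponent z (y ∷ m′)
    by-< (yes z≈y) = ≡.subst₂ _<_ (≡.sym (exponent-accept m z≈y)) (≡.sym (exponent-accept m′ z≈y)) (ℕ.s≤s lt)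
    by-< (no z≉y)  = ≡.subst₂ _<_ (≡.sym (exponent-reject m z≉y)) (≡.sym (exponent-reject m′ z≉y)) lt
    by-≡ : ∀ w → Dec (w ≈ y) → exponent w m ≡ exponent w m′ → exponent w (y ∷ m) ≡ exponent w (y ∷ m′)
    by-≡ w (yes w≈y) eq = ≡.trans (exponent-accept m w≈y) (≡.trans (≡.cong suc eq) (≡.sym (exponent-accept m′ w≈y)))
    by-≡ w (no w≉y)  eq = ≡.trans (exponent-reject m w≉y) (≡.trans eq (≡.sym (exponent-reject m′ w≉y)))

  ≻ᵐ-irrefl : ∀ {m m′} → m ↭ m′ → ¬ (m ≻ᵐ m′)
  ≻ᵐ-irrefl p (inj₁ longer)           = ℕ.<-irrefl (≡.sym (xs↭ys⇒|xs|≡|ys| p)) longer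
  ≻ᵐ-irrefl p (inj₂ (_ , y , lt , _)) = ℕ.<-irrefl (exponent-↭ y p) lt

  module _ (total : ∀ y z → y ≻ z ⊎ y ≈ z ⊎ z ≻ y) where

    -- Of two distinct witnesses, the smaller variable lies where the other comparison demands equal
    -- exponents; equal witnesses would give opposite inequalities.
    ≻ᵐ-asym : ∀ {m m′} → m ≻ᵐ m′ → ¬ (m′ ≻ᵐ m)
    ≻ᵐ-asym (inj₁ longer)    (inj₁ shorter)   = ℕ.<-asym longer shorter
    ≻ᵐ-asym (inj₁ longer)    (inj₂ (len , _)) = ℕ.<-irrefl len longer
    ≻ᵐ-asym (inj₂ (len , _)) (inj₁ longer)    = ℕ.<-irrefl len longer
    ≻ᵐ-asym {m} {m′} (inj₂ (_ , y , lt , eqs)) (inj₂ (_ , z , lt′ , eqs′)) with total y z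
    ... | inj₁ y≻z        = ℕ.<-irrefl (≡.sym (eqs z y≻z)) lt′
    ... | inj₂ (inj₁ y≈z) = ℕ.<-asym (≡.subst₂ _<_ (exponent-cong y≈z m) (exponent-cong y≈z m′) lt) lt′
    ... | inj₂ (inj₂ z≻y) = ℕ.<-irrefl (≡.sym (eqs′ y z≻y)) lt

module StandardMonomials {x ℓx o} (X : DecSetoid x ℓx) (_≻_ : Rel (DecSetoid.Carrier X) o)
  {n} (B : Vector ℕ n) {{B>0 : ∀ {k} → NonZero (B k)}} (H : DecSetoid.Carrier X → Vector ℕ n)
  (H-cong : ∀ y z → DecSetoid._≈_ X y z → H y ≗ H z) (H≤B : ∀ y k → H y k ℕ.≤ B k)
  (≻⇒≰ : ∀ y z → y ≻ z → ¬ (∀ k → H z k ℕ.≤ H y k)) where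

  private
    module X = DecSetoid X
  open import Data.Nat.Base using (_+_; _⊓_; _<_)
  open X using (_≈_; _≟_)
  open Monomials X
  open Monomials.DegRevLex X _≻_
  open MonomialOrder X _≻_
  open Permutation X.setoid using (_↭_; ↭-refl; ↭-sym; ↭-trans; ↭-prep; ↭-swap; ↭-reflexive-≋)
  open PermutationProperties X.setoid using (AllPairs-resp-↭; All-resp-↭; shift)
  open Membership X.setoid using (_∉_) renaming (_∈_ to _∈ᴸ_)

  infix 4 _⊑_
  -- The height form of `⊴`. It is not reflexive: `y ⊑ y` requires every height of `y` to be 0 or
  -- full, so squares of variables can be non-standard.
  _⊑_ : Rel X.Carrier _
  y ⊑ z = ∀ k → H y k ≡ B k ⊎ H z k ≡ 0

  _⊑?_ : ∀ y z → Dec (y ⊑ z)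
  y ⊑? z = Fin.all? λ k → (H y k ℕ.≟ B k) ⊎-dec (H z k ℕ.≟ 0)

  saturated≢0 : ∀ {y k} → H y k ≡ B k → H y k ≢ 0
  saturated≢0 {k = k} full empty = ℕ.≢-nonZero⁻¹ (B k) (≡.trans (≡.sym full) empty)

  -- The middle path cannot be both full and empty at `k`, because `B k` is positive.
  ⊑-trans : ∀ {y z w} → y ⊑ z → z ⊑ w → y ⊑ w
  ⊑-trans {y} {z} y⊑z z⊑w k with y⊑z k | z⊑w k
  ... | inj₁ full  | _          = inj₁ full
  ... | inj₂ _     | inj₂ empty = inj₂ empty
  ... | inj₂ empty | inj₁ full  = ⊥-elim (saturated≢0 {z} full empty)

  ⊑-respˡ : ∀ {y z w} → y ≈ z → y ⊑ w → z ⊑ w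
  ⊑-respˡ y≈z y⊑w k with y⊑w k
  ... | inj₁ full  = inj₁ (≡.trans (≡.sym (H-cong _ _ y≈z k)) full)
  ... | inj₂ empty = inj₂ empty

  ⊑-respʳ : ∀ {y z w} → y ≈ z → w ⊑ y → w ⊑ z
  ⊑-respʳ y≈z w⊑y k with w⊑y k
  ... | inj₁ full  = inj₁ full
  ... | inj₂ empty = inj₂ (≡.trans (≡.sym (H-cong _ _ y≈z k)) empty)

  insert : ∀ y s → AllPairs _⊑_ s →
           (∃[ s′ ] (y ∷ s) ↭ s′ × AllPairs _⊑_ s′) ⊎ (∃[ z ] ∃[ r ] s ↭ (z ∷ r) × ¬ y ⊑ z × ¬ z ⊑ y)
  insert y []      _          = inj₁ (y ∷ [] , ↭-refl , [] ∷ [])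
  insert y (z ∷ s) (z⊑s ∷ s⊑) with y ⊑? z | z ⊑? y
  ... | yes y⊑z | _ = inj₁ (y ∷ z ∷ s , ↭-refl , (y⊑z ∷ All.map (⊑-trans y⊑z) z⊑s) ∷ z⊑s ∷ s⊑)
  ... | no y⋢z | no z⋢y = inj₂ (z , s , ↭-refl , y⋢z , z⋢y)
  ... | no _ | yes z⊑y with insert y s s⊑
  ...   | inj₁ (s′ , p , s′⊑) = inj₁ (z ∷ s′ , ↭-trans (↭-swap y z ↭-refl) (↭-prep z p)
                                     , All-resp-↭ (λ e → ⊑-respʳ e) p (z⊑y ∷ z⊑s) ∷ s′⊑)
  ...   | inj₂ (w , r , p , y⋢w , w⋢y) = inj₂ (w , z ∷ r , ↭-trans (↭-prep z p) (↭-swap z w ↭-refl) , y⋢w , w⋢y)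

  -- Insertion sort either succeeds or meets two factors that are comparable in neither direction.
  -- Hence a non-standard monomial has a non-standard quadratic divisor.
  sort : ∀ m → (∃[ s ] m ↭ s × AllPairs _⊑_ s) ⊎ (∃[ y ] ∃[ z ] ∃[ r ] m ↭ (y ∷ z ∷ r) × ¬ y ⊑ z × ¬ z ⊑ y)
  sort []      = inj₁ ([] , ↭-refl , [])
  sort (y ∷ m) with sort m
  ... | inj₂ (z , w , r , p , z⋢w , w⋢z) =
    inj₂ (z , w , y ∷ r , ↭-trans (↭-prep y p) (↭-trans (↭-swap y z ↭-refl) (↭-prep z (↭-swap y w ↭-refl))) , z⋢w , w⋢z)
  ... | inj₁ (s , p , s⊑) with insert y s s⊑
  ...   | inj₁ (s′ , q , s′⊑)        = inj₁ (s′ , ↭-trans (↭-prep y p) q , s′⊑)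
  ...   | inj₂ (z , r , q , y⋢z , z⋢y) = inj₂ (y , z , r , ↭-trans (↭-prep y p) (↭-prep y q) , y⋢z , z⋢y)

  -- Sortedness is not invariant under permutation, but comparability of all pairs in one direction
  -- or the other is.
  comparable : ∀ {y z s} → (y ∷ z ∷ []) ↭ s → AllPairs _⊑_ s → y ⊑ z ⊎ z ⊑ y
  comparable {y} {z} p s⊑ with AllPairs-resp-↭ {R = λ y z → y ⊑ z ⊎ z ⊑ y} Sum.swap (respʳ , respˡ) (↭-sym p) (AllPairs.map inj₁ s⊑)
    where
    respʳ : ∀ {w y z} → y ≈ z → w ⊑ y ⊎ y ⊑ w → w ⊑ z ⊎ z ⊑ w
    respʳ y≈z (inj₁ w⊑y) = inj₁ (⊑-respʳ y≈z w⊑y)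
    respʳ y≈z (inj₂ y⊑w) = inj₂ (⊑-respˡ y≈z y⊑w)
    respˡ : ∀ {w y z} → y ≈ z → y ⊑ w ⊎ w ⊑ y → z ⊑ w ⊎ w ⊑ z
    respˡ y≈z c = Sum.swap (respʳ y≈z (Sum.swap c))
  ... | (c ∷ []) ∷ _ = c

  profile : Monomial → Vector ℕ n
  profile []      k = 0
  profile (y ∷ m) k = H y k + profile m k

  profile-↭ : ∀ {m m′} → m ↭ m′ → profile m ≗ profile m′
  profile-↭ (Permutation.refl m≋m′) = pointwise m≋m′
    where
    open Pointwise using ([]; _∷_)
    pointwise : ∀ {m m′} → Pointwise.Pointwise _≈_ m m′ → profile m ≗ profile m′
    pointwise []            k = ≡.refl
    pointwise (y≈z ∷ m≋m′) k = ≡.cong₂ _+_ (H-cong _ _ y≈z k) (pointwise m≋m′ k)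
  profile-↭ (Permutation.prep y≈z p)      k = ≡.cong₂ _+_ (H-cong _ _ y≈z k) (profile-↭ p k)
  profile-↭ (Permutation.swap {x = y} {y = z} y≈ z≈ p) k = ≡.trans (x∙yz≈y∙xz (H y k) (H z k) _)
      (≡.cong₂ _+_ (H-cong _ _ z≈ k) (≡.cong₂ _+_ (H-cong _ _ y≈ k) (profile-↭ p k)))
    where open import Algebra.Properties.CommutativeSemigroup ℕ.+-commutativeSemigroup using (x∙yz≈y∙xz)
  profile-↭ (Permutation.trans p q)       k = ≡.trans (profile-↭ p k) (profile-↭ q k)

  H≤profile : ∀ {y m} → y ∈ᴸ m → ∀ k → H y k ℕ.≤ profile m k
  H≤profile {m = z ∷ m} (here y≈z) k = ℕ.≤-trans (ℕ.≤-reflexive (H-cong _ _ y≈z k)) (ℕ.m≤m+n _ _)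
  H≤profile {m = z ∷ m} (there y∈) k = ℕ.≤-trans (H≤profile y∈ k) (ℕ.m≤n+m _ _)

  -- At each `k` either `y` is full or all later factors vanish; the minimum gives `H y k` in both
  -- cases.
  first-factor : ∀ {y m} → Linked _⊑_ (y ∷ m) → ∀ k → H y k ≡ B k ⊓ profile (y ∷ m) k
  first-factor {y} {m} standard k with saturated standard
    where
    saturated : ∀ {y m} → Linked _⊑_ (y ∷ m) → H y k ≡ B k ⊎ profile m k ≡ 0
    saturated [-] = inj₂ ≡.refl
    saturated {y} {z ∷ m} (y⊑z ∷ linked) with y⊑z k | saturated linked
    ... | inj₁ full  | _           = inj₁ full
    ... | inj₂ empty | inj₁ full   = ⊥-elim (saturated≢0 {z} full empty)
    ... | inj₂ empty | inj₂ empty′ = inj₂ (≡.cong₂ _+_ empty empty′)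
  ... | inj₁ full  = ≡.trans full (≡.sym (ℕ.m≤n⇒m⊓n≡m (ℕ.≤-trans (ℕ.≤-reflexive (≡.sym full)) (ℕ.m≤m+n _ _))))
  ... | inj₂ empty = ≡.trans (≡.sym (ℕ.m≥n⇒m⊓n≡n (H≤B y k)))
    (≡.cong (B k ⊓_) (≡.trans (≡.sym (ℕ.+-identityʳ _)) (≡.cong (H y k +_) (≡.sym empty))))

  -- The first factor of a standard monomial is lexicographically the largest, hence the
  -- last in the variable order, among all factors that fit into the profile.
  minimal : ∀ m m′ → Linked _⊑_ m → length m′ ≡ length m → profile m′ ≗ profile m → m′ ↭ m ⊎ m′ ≻ᵐ m
  minimal []      []      _        _   _  = inj₁ ↭-refl
  minimal (y ∷ m) m′ standard len eq with any? (y ≟_) m′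
  -- A common factor is cancelled from both monomials and restored afterwards by `≻ᵐ-∷`.
  ... | yes y∈m′ with hs , zs , w , y≈w , m′≋ ← MembershipProperties.∈-∃++ X.setoid y∈m′
                 with m′↭ ← ↭-trans (↭-reflexive-≋ m′≋) (shift (X.sym y≈w) hs zs)
                 with minimal m (hs List.++ zs) (Linked.tail standard)
                        (ℕ.suc-injective (≡.trans (≡.sym (xs↭ys⇒|xs|≡|ys| m′↭)) len))
                        (λ k → ℕ.+-cancelˡ-≡ (H y k) _ _ (≡.trans (≡.sym (profile-↭ m′↭ k)) (eq k)))
    where open PermutationProperties X.setoid using (xs↭ys⇒|xs|≡|ys|)
  ...   | inj₁ p = inj₁ (↭-trans m′↭ (↭-prep y p))
  ...   | inj₂ g = inj₂ (≻ᵐ-resp (↭-sym m′↭) ↭-refl (≻ᵐ-∷ y g))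
  minimal (y ∷ m) m′ standard len eq | no y∉m′ = inj₂ (inj₂ (len , y
    , ≡.subst₂ _<_ (≡.sym (exponent-∉ m′ y∉m′)) (≡.sym (exponent-accept m X.refl)) ℕ.z<s
    , λ z y≻z → ≡.trans (exponent-∉ m′ (λ z∈ → absent y≻z λ k → ℕ.≤-trans (H≤profile z∈ k) (ℕ.≤-reflexive (eq k))))
        (≡.sym (exponent-∉ (y ∷ m) (λ z∈ → absent y≻z (H≤profile z∈))))))
    where
    absent : ∀ {z} → y ≻ z → (∀ k → H z k ℕ.≤ profile (y ∷ m) k) → ⊥
    absent {z} y≻z z≤ = ≻⇒≰ _ _ y≻z (λ k → ℕ.≤-trans (ℕ.⊓-glb (H≤B z k) (z≤ k)) (ℕ.≤-reflexive (≡.sym (first-factor standard k))))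

-- Coefficient sums over fibres and the Gröbner basis

module VanishingCoefficients {c ℓ m ℓm : Level} (K : CommutativeRing c ℓ) (M : CommutativeMonoid m ℓm)
                             (_≟_ : Decidable (CommutativeMonoid._≈_ M)) where

  private
    module K = CommutativeRing K
    module M = CommutativeMonoid M
  open MonoidAlgebra K M _≟_
  open K using (_≈_; _+_; _*_; 0#)
  open import Relation.Binary.Reasoning.Setoid K.setoid
  open import Algebra.Properties.CommutativeSemigroup K.+-commutativeSemigroup using (interchange; x∙yz≈y∙xz)

  -- The terms of `f` in `P` form a list equal to zero, so its integral may be added to both sides,
  -- against `k` on the left and against `h` on the right. Each term then contributes equally: in
  -- `P` both functions occur on both sides, and outside `P` they agree. No coefficient is tested
  -- for zero.
  ∫-agree : ∀ {p} {P : Pred M.Carrier p} → Unary.Decidable P → (∀ {x y} → x M.≈ y → P x → P y) →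
            ∀ {h k} → (∀ {x y} → x M.≈ y → h x ≈ h y) → (∀ {x y} → x M.≈ y → k x ≈ k y) →
            (∀ x → ¬ P x → h x ≈ k x) → ∀ f → (∀ x → P x → coeff x f ≈ 0#) → ∫ h f ≈ ∫ k f
  ∫-agree {P = P} P? P-resp {h} {k} h-cong k-cong h≈k f f≈0 = begin
    ∫ h f                           ≈⟨ K.+-identityʳ _ ⟨
    ∫ h f + 0#                      ≈⟨ K.+-congˡ (∫-resp k-cong restrict≋0) ⟨
    ∫ h f + ∫ k (restrict f)        ≈⟨ exchange f ⟩
    ∫ k f + ∫ h (restrict f)        ≈⟨ K.+-congˡ (∫-resp h-cong restrict≋0) ⟩
    ∫ k f + 0#                      ≈⟨ K.+-identityʳ _ ⟩
    ∫ k f                           ∎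
    where
    restrict : Carrier → Carrier
    restrict = filter (λ t → P? (proj₂ t))

    exchange : ∀ f → ∫ h f + ∫ k (restrict f) ≈ ∫ k f + ∫ h (restrict f)
    exchange []            = K.refl
    exchange ((c , x) ∷ f) with P? x
    ... | no ¬Px = begin
      (c * h x + ∫ h f) + ∫ k (restrict f)    ≈⟨ K.+-assoc _ _ _ ⟩
      c * h x + (∫ h f + ∫ k (restrict f))    ≈⟨ K.+-cong (K.*-congˡ (h≈k x ¬Px)) (exchange f) ⟩
      c * k x + (∫ k f + ∫ h (restrict f))    ≈⟨ K.+-assoc _ _ _ ⟨
      (c * k x + ∫ k f) + ∫ h (restrict f)    ∎
    ... | yes _ = begin
      (c * h x + ∫ h f) + (c * k x + ∫ k (restrict f))   ≈⟨ interchange _ _ _ _ ⟩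
      (c * h x + c * k x) + (∫ h f + ∫ k (restrict f))   ≈⟨ K.+-cong (K.+-comm _ _) (exchange f) ⟩
      (c * k x + c * h x) + (∫ k f + ∫ h (restrict f))   ≈⟨ interchange _ _ _ _ ⟩
      (c * k x + ∫ k f) + (c * h x + ∫ h (restrict f))   ∎

    coeff-restrict-∈ : ∀ x → P x → ∀ f → coeff x (restrict f) ≈ coeff x f
    coeff-restrict-∈ x Px []            = K.refl
    coeff-restrict-∈ x Px ((c , y) ∷ f) with P? y
    ... | yes _  = K.+-congˡ (coeff-restrict-∈ x Px f)
    ... | no ¬Py with x ≟ y
    ...   | yes x≈y = ⊥-elim (¬Py (P-resp x≈y Px))
    ...   | no _    = K.trans (coeff-restrict-∈ x Px f) (K.sym (K.+-identityˡ _))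

    coeff-restrict-∉ : ∀ x → ¬ P x → ∀ f → coeff x (restrict f) ≈ 0#
    coeff-restrict-∉ x ¬Px []            = K.refl
    coeff-restrict-∉ x ¬Px ((c , y) ∷ f) with P? y
    ... | no _   = coeff-restrict-∉ x ¬Px f
    ... | yes Py with x ≟ y
    ...   | yes x≈y = ⊥-elim (¬Px (P-resp (M.sym x≈y) Py))
    ...   | no _    = K.trans (K.+-identityˡ _) (coeff-restrict-∉ x ¬Px f)

    restrict≋0 : restrict f ≋ []
    restrict≋0 = coeffwise λ x → by x (P? x)
      where
      by : ∀ x → Dec (P x) → coeff x (restrict f) ≈ 0#
      by x (yes Px) = K.trans (coeff-restrict-∈ x Px f) (f≈0 x Px)
      by x (no ¬Px) = coeff-restrict-∉ x ¬Px f

module Binomials {c ℓ m ℓm : Level} (K : CommutativeRing c ℓ) (M : CommutativeMonoid m ℓm)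
                 (_≟_ : Decidable (CommutativeMonoid._≈_ M)) where

  private
    module M = CommutativeMonoid M
  open MonoidAlgebra K M _≟_
  open LinearExtension K M _≟_ using (monomial-cong)
  open CommutativeRing commutativeRing using (+-cong; -‿cong; -‿inverseʳ; trans)

  binomial : M.Carrier → M.Carrier → Carrier
  binomial p q = monomial p ++ -ᴬ monomial q

  binomial-cong : ∀ {p p′ q q′} → p M.≈ p′ → q M.≈ q′ → binomial p q ≋ binomial p′ q′
  binomial-cong {p} {p′} {q} {q′} p≈p′ q≈q′ = +-cong {monomial p} {monomial p′} { -ᴬ monomial q} { -ᴬ monomial q′}
    (monomial-cong p≈p′) (-‿cong {monomial q} {monomial q′} (monomial-cong q≈q′))

  binomial-vanishes : ∀ {p q} → p M.≈ q → binomial p q ≋ []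
  binomial-vanishes {p} {q} p≈q = trans (binomial-cong {p} {q} {q} {q} p≈q M.refl) (-‿inverseʳ (monomial q))

module LSMonomials (n : ℕ) (b : Fin n → ℕ) (b>0 : ∀ j → NonZero (b j)) where

  open LSPaths n b b>0
  open Heights n b b>0
  open LSLetters n b b>0
  open Permutation (DecSetoid.setoid decSetoid₁) using (_↭_; ↭-refl; ↭-sym; ↭-swap)
  private
    module X = DecSetoid decSetoid₁
    module Π = CommutativeMonoid monoid
    module deg = MonoidMorphisms.IsMonoidHomomorphism deg-isMonoidHomomorphism

  H₁ : LSPath₁ → Vector ℕ (suc n)
  H₁ π = height (path π)

  H₁-injective : ∀ π η → H₁ π ≗ H₁ η → path π ≈ᴾ path η
  H₁-injective π η = height-injective {path π} {path η}

  ≻-total : ∀ π η → π ≻ η ⊎ path π ≈ᴾ path η ⊎ η ≻ π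
  ≻-total π η with lex-compare (H₁ π) (H₁ η)
  ... | inj₁ lt          = inj₁ (⇒≻ π η lt)
  ... | inj₂ (inj₁ eq)   = inj₂ (inj₁ (H₁-injective π η eq))
  ... | inj₂ (inj₂ gt)   = inj₂ (inj₂ (⇒≻ η π gt))

  ≻⇒≰ : ∀ π η → π ≻ η → ¬ (∀ k → H₁ η k ℕ.≤ H₁ π k)
  ≻⇒≰ π η π≻η η≤π = let k , lt , _ = ≻⇒ π η π≻η in ℕ.<⇒≱ lt (η≤π k)

  module Order = MonomialOrder decSetoid₁ _≻_
  H₁-cong : ∀ π η → path π ≈ᴾ path η → H₁ π ≗ H₁ η
  H₁-cong π η = height-cong {path π} {path η}

  open StandardMonomials decSetoid₁ _≻_ B H₁ H₁-cong height₁≤B ≻⇒≰ public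

  ⊴⇒⊑ : ∀ {π η} → path π ⊴ path η → π ⊑ η
  ⊴⇒⊑ {π , π∈} {η , _} = ⊴⇒ {π} {η} π∈

  ⊑⇒⊴ : ∀ {π η} → π ⊑ η → path π ⊴ path η
  ⊑⇒⊴ {π , π∈} {η , _} = ⇒⊴ {π} {η} π∈

  StandardForm⇒Linked : ∀ {m} → StandardForm m → Linked _⊑_ m
  StandardForm⇒Linked = Linked.map (λ {π} {η} → ⊴⇒⊑ {π} {η})

  sorted⇒StandardForm : ∀ {m} → AllPairs _⊑_ m → StandardForm m
  sorted⇒StandardForm s = Linked.map (λ {π} {η} → ⊑⇒⊴ {π} {η}) (AllPairs⇒Linked s)

  height-⨁ : ∀ m → height (⨁ m) ≗ profile m
  height-⨁ []      k = ℕ.n≤0⇒n≡0 (height≤deg*B 0ᴾ k)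
  height-⨁ (π ∷ m) k = ≡.trans (height-+ (path π) (⨁ m) k) (≡.cong (H₁ π k ℕ.+_) (height-⨁ m k))

  deg-⨁ : ∀ m → deg (⨁ m) ≡ length m
  deg-⨁ []      = ≡.refl
  deg-⨁ (π ∷ m) = ≡.trans (deg.homo (path π) (⨁ m)) (≡.cong₂ ℕ._+_ (proj₂ π) (deg-⨁ m))

  ⨁-minimal : ∀ m m′ → StandardForm m → ⨁ m′ ≈ᴾ ⨁ m → m′ ↭ m ⊎ m′ ≻ᵐ m
  ⨁-minimal m m′ standard eq = minimal m m′ (StandardForm⇒Linked standard)
    (≡.trans (≡.sym (deg-⨁ m′)) (≡.trans (deg.⟦⟧-cong {⨁ m′} {⨁ m} eq) (deg-⨁ m)))
    (λ k → ≡.trans (≡.sym (height-⨁ m′ k)) (≡.trans (height-cong {⨁ m′} {⨁ m} eq k) (height-⨁ m k)))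

  Incomparable : LSPath₁ → LSPath₁ → Set
  Incomparable π η = ¬ π ⊑ η × ¬ η ⊑ π

  incomparable? : ∀ π η → Dec (Incomparable π η)
  incomparable? π η = ¬? (π ⊑? η) ×-dec ¬? (η ⊑? π)

  incomparable-resp : ∀ {π π′ η η′} → path π ≈ᴾ path π′ → path η ≈ᴾ path η′ → Incomparable π η → Incomparable π′ η′
  incomparable-resp {π} {π′} {η} {η′} π≈π′ η≈η′ (π⋢η , η⋢π) =
    (λ le → π⋢η (⊑-respˡ {π′} {π} {η} (X.sym {π} {π′} π≈π′) (⊑-respʳ {η′} {η} {π′} (X.sym {η} {η′} η≈η′) le))) ,
    (λ le → η⋢π (⊑-respʳ {π′} {π} {η} (X.sym {π} {π′} π≈π′) (⊑-respˡ {η′} {η} {π′} (X.sym {η} {η′} η≈η′) le)))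

  nonstandard : ∀ {π η} → Incomparable π η → ¬ Standard (π ∷ η ∷ [])
  nonstandard {π} {η} (π⋢η , η⋢π) (s , p , standard) =
    [ π⋢η , η⋢π ]′ (comparable p (Linked⇒AllPairs (λ {π} {η} {θ} → ⊑-trans {π} {η} {θ}) (StandardForm⇒Linked standard)))

  incomparable : ∀ {π η} → ¬ Standard (π ∷ η ∷ []) → Incomparable π η
  incomparable {π} {η} ¬standard =
    (λ π⊑η → ¬standard (π ∷ η ∷ [] , ↭-refl , ⊑⇒⊴ {π} {η} π⊑η ∷ [-])) ,
    (λ η⊑π → ¬standard (η ∷ π ∷ [] , ↭-swap π η ↭-refl , ⊑⇒⊴ {η} {π} η⊑π ∷ [-]))

  low-fills : ∀ σ k → height (low 1 σ) k ≡ B k ⊎ height (high 1 σ) k ≡ 0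
  low-fills σ k with ℕ.≤-total (1 ℕ.* B k) (height σ k)
  ... | inj₁ le = inj₁ (≡.trans (height-low 1 σ k) (≡.trans (ℕ.m≤n⇒m⊓n≡m le) (ℕ.*-identityˡ (B k))))
  ... | inj₂ ge = inj₂ (≡.trans (height-high 1 σ k) (ℕ.m≤n⇒m∸n≡0 ge))

  straighten : LSPath₁ → LSPath₁ → Monomial
  straighten π η = first (path π +ᴾ path η) (deg-+₁ π η) ∷ last 1 (path π +ᴾ path η) (deg-+₁ π η) ∷ []

  straighten-canonical : ∀ π η → IsCanonicalDecomposition (path π +ᴾ path η) (straighten π η)
  straighten-canonical π η =
    height-injective {path π +ᴾ path η} {⨁ (straighten π η)} (λ k → ≡.trans
      (≡.trans (height-cong {σ} {low 1 σ +ᴾ high 1 σ} (low+high 1 σ) k) (height-+ (low 1 σ) (high 1 σ) k))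
      (≡.sym (≡.trans (height-⨁ (straighten π η) k) (≡.cong (height (low 1 σ) k ℕ.+_) (ℕ.+-identityʳ _))))) ,
    ⊑⇒⊴ {first σ (deg-+₁ π η)} {last 1 σ (deg-+₁ π η)} (low-fills σ) ∷ [-]
    where
    σ : LSPath
    σ = path π +ᴾ path η

  -- By minimality of both, two different standard monomials over one path would each exceed the
  -- other.
  canonical-unique : ∀ {m m′} → StandardForm m → StandardForm m′ → ⨁ m ≈ᴾ ⨁ m′ → m ↭ m′
  canonical-unique {m} {m′} standard standard′ eq =
    by (⨁-minimal m m′ standard (Π.sym {⨁ m} {⨁ m′} eq)) (⨁-minimal m′ m standard′ eq)
    where
    by : m′ ↭ m ⊎ m′ ≻ᵐ m → m ↭ m′ ⊎ m ≻ᵐ m′ → m ↭ m′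
    by (inj₁ p) _        = ↭-sym p
    by (inj₂ _) (inj₁ p) = p
    by (inj₂ g) (inj₂ l) = ⊥-elim (Order.≻ᵐ-asym ≻-total {m′} {m} g l)

  pair-↭ : ∀ π η π′ η′ → path π ≈ᴾ path π′ → path η ≈ᴾ path η′ → (π ∷ η ∷ []) ↭ (π′ ∷ η′ ∷ [])
  pair-↭ π η π′ η′ π≈π′ η≈η′ = Permutation.prep π≈π′ (Permutation.prep η≈η′ ↭-refl)

  canonical-↭ : ∀ π η π′ η′ {m} → path π ≈ᴾ path π′ → path η ≈ᴾ path η′ →
                IsCanonicalDecomposition (path π +ᴾ path η) m → m ↭ straighten π′ η′
  canonical-↭ π η π′ η′ {m} π≈π′ η≈η′ canonical =
    canonical-unique {m} {straighten π′ η′} (proj₂ canonical) (proj₂ (straighten-canonical π′ η′))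
      (Π.trans {⨁ m} {path π +ᴾ path η} {⨁ (straighten π′ η′)} (Π.sym {path π +ᴾ path η} {⨁ m} (proj₁ canonical))
        (Π.trans {path π +ᴾ path η} {path π′ +ᴾ path η′} {⨁ (straighten π′ η′)}
          (Π.∙-cong {path π} {path π′} {path η} {path η′} π≈π′ η≈η′) (proj₁ (straighten-canonical π′ η′))))

  module _ {π η} (incomp : Incomparable π η) {m} (canonical : IsCanonicalDecomposition (path π +ᴾ path η) m) where

    ⨁-pair : ⨁ (π ∷ η ∷ []) ≈ᴾ ⨁ m
    ⨁-pair = Π.trans {⨁ (π ∷ η ∷ [])} {path π +ᴾ path η} {⨁ m}
      (Π.∙-congˡ {path π} {path η +ᴾ 0ᴾ} {path η} (Π.identityʳ (path η))) (proj₁ canonical)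

    pair≻canonical : (π ∷ η ∷ []) ≻ᵐ m
    pair≻canonical = [ (λ p → ⊥-elim (nonstandard incomp (m , p , proj₂ canonical))) , (λ g → g) ]′
      (⨁-minimal m (π ∷ η ∷ []) (proj₂ canonical) ⨁-pair)

    pair≁canonical : ¬ ((π ∷ η ∷ []) ↭ m)
    pair≁canonical p = nonstandard incomp (m , p , proj₂ canonical)

Ideal-mono : ∀ {a r p q} (R : CommutativeRing a r) {S : Pred (CommutativeRing.Carrier R) p} {T : Pred (CommutativeRing.Carrier R) q} →
             S ⊆ Ideal⟨ R ⟩ T → Ideal⟨ R ⟩ S ⊆ Ideal⟨ R ⟩ T
Ideal-mono R S⊆T (generator s) = S⊆T s
Ideal-mono R S⊆T null          = null
Ideal-mono R S⊆T (plus i j)    = plus (Ideal-mono R S⊆T i) (Ideal-mono R S⊆T j)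
Ideal-mono R S⊆T (times x i)   = times x (Ideal-mono R S⊆T i)
Ideal-mono R S⊆T (resp e i)    = resp e (Ideal-mono R S⊆T i)

module LSGröbner {c ℓ₁ ℓ₂ : Level} (K : HeytingField c ℓ₁ ℓ₂)
                 (n : ℕ) (b : Fin n → ℕ) (b>0 : ∀ j → NonZero (b j)) where

  private
    module K = HeytingField K
    𝕜 : CommutativeRing c ℓ₁
    𝕜 = HeytingCommutativeRing.commutativeRing K.heytingCommutativeRing
    module 𝕜 = CommutativeRing 𝕜
  open LSPaths n b b>0
  open LSLetters n b b>0
  open LSMonomials n b b>0
  open LSAlgebra K n b b>0
  open Permutation (DecSetoid.setoid decSetoid₁) using (_↭_; ↭-refl; ↭-sym; ↭-trans)
  open PermutationProperties (DecSetoid.setoid decSetoid₁) using (++-comm)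
  open 𝒜 using (Carrier; coeff; monomial; _≋_; ∫; δ)
  open RingMorphisms.IsRingHomomorphism φ.isRingHomomorphism using () renaming (⟦⟧-cong to φ-cong)
  module A[b] = MonoidAlgebra 𝕜 monoid _≟ᴾ_
  open LinearExtension 𝕜 monomialMonoid _↭?_ using (monomial-∙; monomial-cong)
  private
    module Π = CommutativeMonoid monoid
    module R = CommutativeRing 𝒜.commutativeRing
    module Aᵇ = CommutativeRing A[b].commutativeRing

  open Binomials 𝕜 monomialMonoid _↭?_ using () renaming (binomial to relation; binomial-cong to relation-cong)

  pairs : List (Fin size × Fin size)
  pairs = filter (λ ij → incomparable? (letter₁ (proj₁ ij)) (letter₁ (proj₂ ij))) (cartesianProduct (allFin size) (allFin size))

  relationOf : Fin size × Fin size → Carrier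
  relationOf (i , j) = relation (letter₁ i ∷ letter₁ j ∷ []) (straighten (letter₁ i) (letter₁ j))

  open Membership R.setoid using () renaming (_∈_ to _∈ᴸ_)

  -- Every degree-one path is `≈ᴾ` to a letter. Passing to letters changes a relation only up to
  -- `≋`, since canonical decompositions are unique up to reordering.
  straightening⇔listed : ∀ f → f ∈ StraighteningRelations ⇔ f ∈ᴸ List.map relationOf pairs
  straightening⇔listed f = mk⇔ to from
    where
    to : f ∈ StraighteningRelations → f ∈ᴸ List.map relationOf pairs
    to (π , η , θ₁ , θ₂ , ¬standard , canonical , f≋) = Any.map⁺ (lose ij∈ (R.trans {f} f≋ (relation-cong
        (pair-↭ π η (letter₁ i) (letter₁ j) π≈ η≈)
        (canonical-↭ π η (letter₁ i) (letter₁ j) {θ₁ ∷ θ₂ ∷ []} π≈ η≈ canonical))))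
      where
      i j : Fin size
      i = index π
      j = index η
      π≈ : path π ≈ᴾ letter i
      π≈ = Π.sym {letter i} {path π} (letter-index π)
      η≈ : path η ≈ᴾ letter j
      η≈ = Π.sym {letter j} {path η} (letter-index η)
      ij∈ = ∈-filter⁺ (λ ij → incomparable? (letter₁ (proj₁ ij)) (letter₁ (proj₂ ij))) {x = i , j}
        (∈-cartesianProduct⁺ (∈-allFin i) (∈-allFin j))
        (incomparable-resp {π} {letter₁ i} {η} {letter₁ j} π≈ η≈ (incomparable ¬standard))

    from : f ∈ᴸ List.map relationOf pairs → f ∈ StraighteningRelations
    from f∈ = let (i , j) , ij∈ , f≋ = find (Any.map⁻ f∈) in
      letter₁ i , letter₁ j , _ , _ ,
      nonstandard (proj₂ (∈-filter⁻ (λ ij → incomparable? (letter₁ (proj₁ ij)) (letter₁ (proj₂ ij)))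
        {xs = cartesianProduct (allFin size) (allFin size)} ij∈)) ,
      straighten-canonical (letter₁ i) (letter₁ j) , f≋

  straightening⊆𝓘 : StraighteningRelations ⊆ 𝓘
  straightening⊆𝓘 {f} (π , η , θ₁ , θ₂ , ¬standard , canonical , f≋) =
    Aᵇ.trans {φ.⟦ f ⟧} {φ.⟦ relation m m′ ⟧} {[]} (φ-cong {f} {relation m m′} f≋)
      (Binomials.binomial-vanishes 𝕜 monoid _≟ᴾ_ {⨁ m} {⨁ m′} (⨁-pair {π} {η} (incomparable ¬standard) {m′} canonical))
    where
    m m′ : Monomial
    m  = π ∷ η ∷ []
    m′ = θ₁ ∷ θ₂ ∷ []

  -- In a Heyting field apartness follows from an invertible difference; here `x - 0` is 1, its own
  -- inverse.
  unit-apart : ∀ {x} → x 𝕜.≈ 𝕜.1# → x K.# 𝕜.0#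
  unit-apart {x} x≈1 = K.invertible⇒# (𝕜.1# , 𝕜.trans (𝕜.*-identityˡ _) x-0≈1 , 𝕜.trans (𝕜.*-identityʳ _) x-0≈1)
    where
    open import Algebra.Properties.Ring 𝕜.ring using (-0#≈0#)
    x-0≈1 : x 𝕜.- 𝕜.0# 𝕜.≈ 𝕜.1#
    x-0≈1 = 𝕜.trans (𝕜.+-congˡ -0#≈0#) (𝕜.trans (𝕜.+-identityʳ x) x≈1)

  pair-leading : ∀ {π η m} → Incomparable π η → IsCanonicalDecomposition (path π +ᴾ path η) m →
                 𝒜.IsLeadingMonomial (π ∷ η ∷ []) (relation (π ∷ η ∷ []) m)
  pair-leading {π} {η} {m} incomp canonical = unit-apart at-pair , above
    where
    pair : Monomial
    pair = π ∷ η ∷ []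
    value : ∀ {p q} {P : Set p} {Q : Set q} → Dec P → Dec Q → 𝕜.Carrier
    value p? q? = (if does p? then 𝕜.1# else 𝕜.0#) 𝕜.+ ((if does q? then 𝕜.- 𝕜.1# else 𝕜.0#) 𝕜.+ 𝕜.0#)
    at-pair : coeff pair (relation pair m) 𝕜.≈ 𝕜.1#
    at-pair = by (pair ↭? pair) (pair ↭? m)
      where
      by : (p? : Dec (pair ↭ pair)) (q? : Dec (pair ↭ m)) → value p? q? 𝕜.≈ 𝕜.1#
      by (yes _) (no _)  = 𝕜.trans (𝕜.+-congˡ (𝕜.+-identityʳ _)) (𝕜.+-identityʳ _)
      by (no ¬p) _       = ⊥-elim (¬p ↭-refl)
      by (yes _) (yes p) = ⊥-elim (pair≁canonical incomp canonical p)
    above : ∀ m′ → m′ ≻ᵐ pair → coeff m′ (relation pair m) 𝕜.≈ 𝕜.0#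
    above m′ m′≻ = by (m′ ↭? pair) (m′ ↭? m)
      where
      by : (p? : Dec (m′ ↭ pair)) (q? : Dec (m′ ↭ m)) → value p? q? 𝕜.≈ 𝕜.0#
      by (yes p) _       = ⊥-elim (Order.≻ᵐ-irrefl {m′} {pair} p m′≻)
      by (no _)  (no _)  = 𝕜.trans (𝕜.+-identityˡ _) (𝕜.+-identityˡ _)
      by (no _)  (yes p) = ⊥-elim (Order.≻ᵐ-asym ≻-total {pair} {m} (pair≻canonical incomp canonical) (Order.≻ᵐ-resp {m′} {m} {pair} {pair} p ↭-refl m′≻))

  coeff-φ : ∀ p f → A[b].coeff p φ.⟦ f ⟧ 𝕜.≈ ∫ (λ m → A[b].δ p (⨁ m)) f
  coeff-φ p []            = 𝕜.refl
  coeff-φ p ((c , m) ∷ f) = 𝕜.+-cong (term (does (p ≟ᴾ ⨁ m))) (coeff-φ p f)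
    where
    term : ∀ t → (if t then c else 𝕜.0#) 𝕜.≈ c 𝕜.* (if t then 𝕜.1# else 𝕜.0#)
    term true  = 𝕜.sym (𝕜.*-identityʳ c)
    term false = 𝕜.sym (𝕜.zeroʳ c)

  -- In the kernel of φ the coefficients over each fibre of ⨁ sum to zero, and the
  -- standard monomial is the smallest one of its fibre.
  standard-not-leading : ∀ {f m s} → f ∈ 𝓘 → m ↭ s → StandardForm s → ¬ 𝒜.IsLeadingMonomial m f
  standard-not-leading {f} {m} {s} f∈ m↭s standard (apart , above) = K.#-irrefl (begin
    coeff m f                              ≈⟨ 𝒜.coeff-∫ m f ⟩
    ∫ (δ m) f                              ≈⟨ ∫-agree over? (λ {x} {y} → over-resp {x} {y}) (λ {x} {y} → 𝒜.δ-cong m {x} {y}) (λ {x} {y} → fibre-cong {x} {y}) agree f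
                                                (λ m′ m′∈ → above m′ (over≻ m′ m′∈)) ⟩
    ∫ (λ m′ → A[b].δ (⨁ m) (⨁ m′)) f       ≈⟨ coeff-φ (⨁ m) f ⟨
    A[b].coeff (⨁ m) φ.⟦ f ⟧               ≈⟨ A[b].coeff-≈ f∈ (⨁ m) ⟩
    𝕜.0#                                   ∎) apart
    where
    open import Relation.Binary.Reasoning.Setoid 𝕜.setoid
    open VanishingCoefficients 𝕜 monomialMonoid _↭?_
    open MonoidMorphisms.IsMonoidHomomorphism ⨁-isMonoidHomomorphism using () renaming (⟦⟧-cong to ⨁-cong)

    -- The rest of the fibre through `m`. Its members exceed `m`, so `f` has coefficient zero there;
    -- outside it the indicators of `m` and of the fibre coincide.
    Over : Pred Monomial _
    Over m′ = ⨁ m ≈ᴾ ⨁ m′ × ¬ (m ↭ m′)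

    over? : ∀ m′ → Dec (Over m′)
    over? m′ = (⨁ m ≟ᴾ ⨁ m′) ×-dec ¬? (m ↭? m′)

    over-resp : ∀ {x y} → x ↭ y → Over x → Over y
    over-resp {x} {y} p (eq , ¬q) = Π.trans {⨁ m} {⨁ x} {⨁ y} eq (⨁-cong p) , λ q → ¬q (↭-trans q (↭-sym p))

    fibre-cong : ∀ {x y} → x ↭ y → A[b].δ (⨁ m) (⨁ x) 𝕜.≈ A[b].δ (⨁ m) (⨁ y)
    fibre-cong {x} {y} p = A[b].δ-cong (⨁ m) {⨁ x} {⨁ y} (⨁-cong p)

    agree : ∀ m′ → ¬ Over m′ → δ m m′ 𝕜.≈ A[b].δ (⨁ m) (⨁ m′)
    agree m′ ¬over = by (m ↭? m′) (⨁ m ≟ᴾ ⨁ m′)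
      where
      by : (p? : Dec (m ↭ m′)) (e? : Dec (⨁ m ≈ᴾ ⨁ m′)) →
           (if does p? then 𝕜.1# else 𝕜.0#) 𝕜.≈ (if does e? then 𝕜.1# else 𝕜.0#)
      by (yes _) (yes _) = 𝕜.refl
      by (no _)  (no _)  = 𝕜.refl
      by (yes p) (no ¬e) = ⊥-elim (¬e (⨁-cong p))
      by (no ¬p) (yes e) = ⊥-elim (¬over (e , ¬p))

    over≻ : ∀ m′ → Over m′ → m′ ≻ᵐ m
    over≻ m′ (eq , ¬p) = [ (λ p → ⊥-elim (¬p (↭-trans m↭s (↭-sym p)))) , Order.≻ᵐ-resp {m′} {m′} {s} {m} ↭-refl (↭-sym m↭s) ]′
      (⨁-minimal s m′ standard (Π.trans {⨁ m′} {⨁ m} {⨁ s} (Π.sym {⨁ m} {⨁ m′} eq) (⨁-cong m↭s)))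

  -- A leading monomial of an element of `𝓘` cannot be sorted, and the incomparable pair found
  -- inside it is the leading monomial of a straightening relation.
  leading∈initial : ∀ {f m g} → f ∈ 𝓘 → 𝒜.IsLeadingMonomial m f → g ≋ monomial m → g ∈ 𝒜.InitialIdeal StraighteningRelations
  leading∈initial {f} {m} {g} f∈ leading g≋ = [
      (λ (s , p , sorted) → ⊥-elim (standard-not-leading {f} {m} {s} f∈ p (sorted⇒StandardForm sorted) leading)) ,
      (λ (π , η , r , p , incomp) → resp
    (R.trans (R.sym (monomial-∙ r (π ∷ η ∷ []))) (R.trans (monomial-cong (↭-trans (++-comm r (π ∷ η ∷ [])) (↭-sym p))) (R.sym g≋)))
    (times (monomial r) (generator
      ( relation (π ∷ η ∷ []) (straighten π η)
      , (π , η , _ , _ , nonstandard incomp , straighten-canonical π η , R.refl)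
      , π ∷ η ∷ [] , pair-leading incomp (straighten-canonical π η) , R.refl)))) ]′
    (sort m)

  isGröbnerBasis : 𝒜.IsGröbnerBasis StraighteningRelations 𝓘
  isGröbnerBasis = record
    { finite        = List.map relationOf pairs , straightening⇔listed
    ; contained     = λ {f} → straightening⊆𝓘 {f}
    ; initial-ideal =
        Ideal-mono 𝒜.commutativeRing (λ { (f , f∈ , leading) → generator (f , straightening⊆𝓘 {f} f∈ , leading) }) ,
        Ideal-mono 𝒜.commutativeRing (λ { (f , f∈ , m , leading , g≋) → leading∈initial {f} {m} f∈ leading g≋ })
    }

  isKoszul : IsKoszul A[b]
  isKoszul = KoszulMonoidAlgebra.isKoszul 𝕜 monoid _≟ᴾ_ deg deg-isMonoidHomomorphism letterSplitting

theorem6p6 : ∀ {c ℓ₁ ℓ₂} (K : HeytingField c ℓ₁ ℓ₂) (n : ℕ) → n ≥ 1 →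
    (b : Fin n → ℕ) (b>0 : ∀ j → NonZero (b j)) →
    let open LSAlgebra K n b b>0 in
    𝒜.IsGröbnerBasis StraighteningRelations 𝓘 × IsKoszul A[b]
theorem6p6 K n _ b b>0 = LSGröbner.isGröbnerBasis K n b b>0 , LSGröbner.isKoszul K n b b>0
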